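{- Let $\mathbb{F}_q$ be a finite field and let $f_1,\ldots,f_r\in\mathbb{F}_q[x_1,\ldots,x_n]$ be polynomials of total degrees $d_1,\ldots,d_r$, with $d=d_1+\cdots+d_r$. Let $z=\{\mathbf{x}\in\mathbb{F}_q^n: f_1(\mathbf{x})=\cdots=f_r(\mathbf{x})=0\}$ and $\mathcal{N}=\# z$. Suppose that $n>d$, that $z$ is non-empty, and that $z$ is not an affine linear subspace of $\mathbb{A}^n(\mathbb{F}_q)=\mathbb{F}_q^n$. Then: (i) for any $q$ we have $\mathcal{N}>q^{n-d}$; (ii) if $q\ge 4$ we have $\mathcal{N}\ge 2q^{n-d}$; (iii) for any $q$, if the polynomials $f_1,\ldots,f_r$ are homogeneous, then $\mathcal{N}\ge q^{n+1-d}/(n+2-d)$.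
   Context: An affine linear subspace of $\mathbb{F}_q^n$ is a translate of a vector subspace (it need not contain the origin). -}

module Defs where

open import Level using (0ℓ)
open import Data.Nat using (ℕ; zero; suc; _≤_) renaming (_+_ to _+ℕ_)
open import Data.Fin using (Fin)
open import Data.Vec using (Vec; []; _∷_; zipWith; replicate; foldr)
open import Data.List using (List; [])
import Data.List as List
open import Data.Product using (Σ; _×_; _,_; ∃; ∃-syntax)
open import Data.Sum using (_⊎_)
open import Relation.Binary.PropositionalEquality using (_≡_; _≢_)
open import Relation.Nullary using (¬_; Dec; yes; no)
open import Relation.Binary.Definitions using (DecidableEquality)
open import Algebra.Structures using (IsCommutativeRing)
open import Function.Bundles using (_↔_)
import Data.Vec.Properties as VecP
import Data.Nat.Properties as NatP

record FiniteField (q : ℕ) : Set₁ where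
  infixl 6 _+_
  infixl 7 _*_
  field
    Carrier : Set
    _+_ _*_ : Carrier → Carrier → Carrier
    -_      : Carrier → Carrier
    0# 1#   : Carrier
    isCommutativeRing : IsCommutativeRing _≡_ _+_ _*_ -_ 0# 1#
    0≢1     : 0# ≢ 1#
    inverse : ∀ x → x ≢ 0# → ∃[ y ] (x * y ≡ 1#)
    _≟_     : DecidableEquality Carrier
    enum    : Carrier ↔ Fin q

-- Polynomials in n variables over F: finite formal sums of terms
-- c · x^e, with e : Vec ℕ n an exponent vector.  The coefficient of a
-- monomial is the sum of the coefficients of all terms with that
-- exponent vector, so the notions below are independent of the
-- representation.

module _ {q : ℕ} (F : FiniteField q) where
  open FiniteField F

  Monomial : ℕ → Set
  Monomial n = Vec ℕ n

  Poly : ℕ → Set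
  Poly n = List (Carrier × Monomial n)

  mdeg : ∀ {n} → Monomial n → ℕ
  mdeg = foldr _ _+ℕ_ 0

  _^ᶠ_ : Carrier → ℕ → Carrier
  x ^ᶠ zero  = 1#
  x ^ᶠ suc k = x * (x ^ᶠ k)

  evalMono : ∀ {n} → Monomial n → Vec Carrier n → Carrier
  evalMono [] [] = 1#
  evalMono (e ∷ es) (x ∷ xs) = (x ^ᶠ e) * evalMono es xs

  eval : ∀ {n} → Poly n → Vec Carrier n → Carrier
  eval [] x = 0#
  eval ((c , e) List.∷ p) x = c * evalMono e x + eval p x

  coeff : ∀ {n} → Poly n → Monomial n → Carrier
  coeff [] m = 0#
  coeff ((c , e) List.∷ p) m with VecP.≡-dec NatP._≟_ e m
  ... | yes _ = c + coeff p m
  ... | no  _ = coeff p m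

  HasTotalDegree : ∀ {n} → Poly n → ℕ → Set
  HasTotalDegree f d =
    (∃[ m ] (mdeg m ≡ d × coeff f m ≢ 0#)) ×
    (∀ m → coeff f m ≢ 0# → mdeg m ≤ d)

  IsHomogeneous : ∀ {n} → Poly n → ℕ → Set
  IsHomogeneous f d = ∀ m → coeff f m ≢ 0# → mdeg m ≡ d

  _⊕_ : ∀ {n} → Vec Carrier n → Vec Carrier n → Vec Carrier n
  _⊕_ = zipWith _+_

  _⊙_ : ∀ {n} → Carrier → Vec Carrier n → Vec Carrier n
  c ⊙ v = Data.Vec.map (c *_) v

  zeroV : ∀ {n} → Vec Carrier n
  zeroV = replicate _ 0#

  IsSubspace : ∀ {n} → (Vec Carrier n → Set) → Set
  IsSubspace V = V zeroV ×
                 (∀ u v → V u → V v → V (u ⊕ v)) ×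
                 (∀ c v → V v → V (c ⊙ v))

  IsAffineSubspace : ∀ {n} → (Vec Carrier n → Set) → Set₁
  IsAffineSubspace {n} S =
    ∃[ p ] ∃[ V ] (IsSubspace {n} V ×
      (∀ x → (S x → ∃[ v ] (V v × x ≡ p ⊕ v)) ×
             ((∃[ v ] (V v × x ≡ p ⊕ v)) → S x)))

  ZeroSet : ∀ {n r} → (Fin r → Poly n) → Vec Carrier n → Set
  ZeroSet fs x = ∀ i → eval (fs i) x ≡ 0#

  Zeros : ∀ {n r} → (Fin r → Poly n) → Set
  Zeros {n} fs = Σ (Vec Carrier n) (ZeroSet fs)

{-# OPTIONS --safe #-}

-- The zero set z is studied through its intersections with flats a + ⟨v₁,…,v_k⟩.  The arithmetic input is Ax's congruence:
-- parallel flats of dimension d contain equally many zeros modulo q.  Write q = pᵏ and replace the Witt vectors of length k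
-- by ℤ[F]/Iᵏ, where ℤ[F] is the monoid ring of (F,·) and I the kernel of ℤ[F] → F; an integer lying in Iᵏ is divisible by pᵏ
-- because a ↦ (φ a − aᵖ)/p maps Iʲ⁺¹ to Iʲ.  With Teichmüller representatives T x = [x], the zeros are counted by
-- Σ Π (1 − T(fᵢ)^(q−1)), and T(f)^(pᵗ) is a sum of terms pⁱ g such that g(x^(pˡ)) has the expected degree for all but i of the
-- twists l < k.  In a product of such terms either the accumulated power of p kills the term, or some twist has total degree
-- at most (q−1)d, and then the sum over the flat depends only on its direction.
--
-- Averaging over all directions w ∈ Fⁿ shows that z is large if every extension of a flat by w ∉ ⟨v⟩ contains new zeros; otherwise
-- the flat can be enlarged without new zeros until it has dimension d, where every parallel flat has as many zeros modulo q.
-- For (i) and (ii) start from a line (for q = 2, a plane) that meets z in at least two points without being contained in z.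
-- For (iii) either some plane spanned by two zeros has a large residue modulo q, or almost all of each such plane lies in z;
-- then n + 1 − d independent zeros, which exist by (i), already generate enough zeros.

module Submission where

open import Defs
open import Level using (0ℓ)
open import Algebra.Bundles using (CommutativeRing; CommutativeMonoid)
open import Data.Bool as Bool using (Bool; true; false; _∨_; if_then_else_)
open import Data.Fin using (Fin; zero; suc; toℕ; inject₁; fromℕ; fromℕ<; punchIn; inject≤)
open import Data.Fin.Permutation using (permutation)
import Data.Fin.Properties as Fin
open import Data.Integer as ℤ using (ℤ; -[1+_]) renaming (+_ to pos)
import Data.Integer.Properties as ℤ
open import Data.Integer.Tactic.RingSolver using () renaming (solve-∀ to solveℤ)
open import Data.List as List using (List; []; _∷_; _++_; length)
open import Data.List.Relation.Unary.All using (All; []; _∷_)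
open import Data.Maybe using (Maybe; just; nothing)
open import Data.Nat as ℕ using (ℕ; zero; suc; _+_; _*_; _∸_; _^_; _<_; _≤_; z≤n; s≤s; _<ᵇ_; NonZero; _%_)
open import Data.Nat.Combinatorics using (_C_; nCn≡1; nCk+nC[k+1]≡[n+1]C[k+1])
open import Data.Nat.Coprimality using (prime⇒coprime; coprime-Bézout)
open import Data.Nat.Divisibility using (_∣_; divides; ∣⇒≤; m%n≡0⇒n∣m)
open import Data.Nat.DivMod using (m%n<n; m<n⇒m%n≡m; [m+n]%n≡m%n; [m+kn]%n≡m%n; m%n≤m; %-distribˡ-+; m≡m%n+[m/n]*n; m%n%n≡m%n; m*n%n≡0)
open import Data.Nat.GCD using (module Bézout)
open import Data.Nat.ListAction using (product)
open import Data.Nat.Primality using (Prime; euclidsLemma; prime⇒nonTrivial)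
open import Data.Nat.Primality.Factorisation using (factorise; PrimeFactorisation)
import Data.Nat.Properties as ℕ
open import Data.Nat.Tactic.RingSolver using (solve-∀)
open import Data.Product using (_×_; _,_; ∃; ∃-syntax; proj₁; proj₂)
open import Data.Sum using (_⊎_; inj₁; inj₂)
open import Data.Unit using (⊤; tt)
open import Data.Vec using (Vec; []; _∷_; last; map; replicate; zipWith; head; tail; lookup)
import Data.Vec.Properties as Vec
open import Function.Base using (_∘_; id)
open import Function.Bundles using (_↔_; Inverse)
open import Function.Definitions using (Injective)
open import Relation.Binary.Definitions using (tri<; tri≈; tri>)
open import Relation.Binary.PropositionalEquality as ≡ using (_≡_; _≢_; refl; sym; trans; cong; cong₂; subst; subst₂; module ≡-Reasoning)
open import Relation.Binary.Structures using (IsEquivalence)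
open import Relation.Nullary using (¬_; Dec; yes; no; contradiction; ¬?; map′)
open import Relation.Nullary.Decidable using (_×-dec_)
open import Relation.Unary using (Decidable)

-- Congruences modulo p, as in Chevalley-Warning, are too weak: a line with c zeros, 0 < c < q, has
-- to be recognised by a nonzero residue, and a residue r is used as a lower bound r for every
-- parallel flat. Hence the lift to a ring in which pᵏ = 0 while integers are still seen modulo pᵏ.
-- There T is multiplicative but not additive, so T(f) is not of degree deg f; the corrections pⁱ g
-- have too large a degree exactly at those twists where an exponent of p wraps around modulo k, and
-- at most i of the k twists do. This is why all twists are followed at once. The bound q ≥ 4 in
-- (ii): the only obstruction is a line with q - 1 zeros, one further zero completing the residue to
-- 0. It produces a line with exactly two zeros, and that line is obstructed only if 2 = q - 1. In
-- (iii), M = n + 2 - d separates two cases. A plane residue of at least q / M suffices directly;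
-- otherwise adjoining a zero keeps at least the fraction 1 - 1/M, and M - 1 such steps keep at
-- least 1/M by Bernoulli's inequality.

-- Binomial coefficients modulo a prime and p-th powers of sums in a commutative ring.

[1+k]*[1+n]C[1+k] : ∀ n k → suc k * (suc n C suc k) ≡ suc n * (n C k)
[1+k]*[1+n]C[1+k] zero    zero    = refl
[1+k]*[1+n]C[1+k] zero    (suc k) = trans (ℕ.*-zeroʳ (suc (suc k))) refl
[1+k]*[1+n]C[1+k] (suc n) zero    = begin
  1 * (suc (suc n) C 1)  ≡⟨ cong (1 *_) (nCk+nC[k+1]≡[n+1]C[k+1] (suc n) 0) ⟨
  1 * (1 + suc n C 1)  ≡⟨ ℕ.*-distribˡ-+ 1 1 (suc n C 1) ⟩
  1 + 1 * (suc n C 1)  ≡⟨ cong (1 +_) ([1+k]*[1+n]C[1+k] n 0) ⟩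
  1 + suc n * 1 ∎
  where open ≡-Reasoning
[1+k]*[1+n]C[1+k] (suc n) (suc k) = begin
  suc (suc k) * (suc (suc n) C suc (suc k))  ≡⟨ cong (suc (suc k) *_) (nCk+nC[k+1]≡[n+1]C[k+1] (suc n) (suc k)) ⟨
  suc (suc k) * (x + y)  ≡⟨ lem k x y ⟩
  x + (suc k * x + suc (suc k) * y)  ≡⟨ cong (x +_) (cong₂ _+_ ([1+k]*[1+n]C[1+k] n k) ([1+k]*[1+n]C[1+k] n (suc k))) ⟩
  x + (suc n * (n C k) + suc n * (n C suc k))  ≡⟨ cong (x +_) (ℕ.*-distribˡ-+ (suc n) (n C k) (n C suc k)) ⟨
  x + suc n * (n C k + n C suc k)  ≡⟨ cong (λ z → x + suc n * z) (nCk+nC[k+1]≡[n+1]C[k+1] n k) ⟩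
  suc (suc n) * x ∎
  where
  open ≡-Reasoning
  x = suc n C suc k
  y = suc n C suc (suc k)
  lem : ∀ k x y → suc (suc k) * (x + y) ≡ x + (suc k * x + suc (suc k) * y)
  lem = solve-∀

-- By (k+1) C(n+1, k+1) = (n+1) C(n, k) the prime n + 1 divides the left side, but not the smaller
-- factor k + 1.
prime∣binomial : ∀ {n} → Prime (suc n) → ∀ k → k < n → suc n ∣ suc n C suc k
prime∣binomial {n} pr k k<n with euclidsLemma (suc k) (suc n C suc k) pr
  (divides (n C k) (trans ([1+k]*[1+n]C[1+k] n k) (ℕ.*-comm (suc n) (n C k))))
... | inj₁ p∣k = contradiction (∣⇒≤ p∣k) (ℕ.<⇒≱ (s≤s k<n))
... | inj₂ p∣C = p∣C

module CommRing {c ℓ} (R : CommutativeRing c ℓ) where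
  open CommutativeRing R hiding (zero) renaming (_+_ to _⊞_; _*_ to _⊠_; -_ to ⊟_; refl to ≈-refl; sym to ≈-sym; trans to ≈-trans) public
  open import Algebra.Properties.Semiring.Mult semiring public
    using (×-congʳ; ×-homo-+; ×-assocˡ; ×-comm-*; ×-assoc-*; ×1-homo-*) renaming (_×_ to _·_)
  open import Algebra.Properties.CommutativeMonoid.Mult +-commutativeMonoid public using () renaming (×-distrib-+ to ·-distrib)
  open import Algebra.Properties.CommutativeSemiring.Exp commutativeSemiring public
    using (^-congˡ; ^-homo-*; ^-assocʳ; ^-distrib-*) renaming (_^_ to _↑_)
  open import Algebra.Properties.Semiring.Sum semiring using (sum; sum-init-last)
  open import Algebra.Properties.CommutativeSemiring.Binomial commutativeSemiring using (binomialTerm; theorem)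
  open import Algebra.Properties.Ring ring public using (-‿distribˡ-*; -‿distribʳ-*; -0#≈0#)
  open import Algebra.Properties.AbelianGroup +-abelianGroup public using (⁻¹-∙-comm; ⁻¹-involutive)
  open import Relation.Binary.Reasoning.Setoid setoid

  ·-zero : ∀ n → n · 0# ≈ 0#
  ·-zero zero    = ≈-refl
  ·-zero (suc n) = ≈-trans (+-identityˡ _) (·-zero n)

  sum-multiple : ∀ {ℓ′} (Q : Carrier → Set ℓ′) → Q 0# → (∀ {x y} → Q x → Q y → Q (x ⊞ y)) →
    ∀ p {n} (t : Fin n → Carrier) → (∀ i → ∃[ x ] (Q x × t i ≈ p · x)) → ∃[ x ] (Q x × sum t ≈ p · x)
  sum-multiple Q Q0 Q+ p {zero}  t h = 0# , Q0 , ≈-sym (·-zero p)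
  sum-multiple Q Q0 Q+ p {suc n} t h =
    let x , Qx , ex = h zero
        y , Qy , ey = sum-multiple Q Q0 Q+ p (λ i → t (suc i)) (λ i → h (suc i))
    in x ⊞ y , Q+ Qx Qy , ≈-trans (+-cong ex ey) (≈-sym (·-distrib x y p))

  -- The correction term comes with a proof of an additive predicate `Q`, because it has to be
  -- tracked later: trivially in F, inside a power of an ideal, and with a degree bound in a ring of
  -- functions. Only the mixed products aⁱ bʲ with i + j = p have to satisfy `Q`; their binomial
  -- coefficients are divisible by p.
  frobenius-expansion : ∀ {ℓ′} (Q : Carrier → Set ℓ′) → Q 0# → (∀ {x y} → Q x → Q y → Q (x ⊞ y)) →
    ∀ {p} → Prime p → ∀ a b → (∀ i j → suc i + suc j ≡ p → Q (a ↑ suc i ⊠ b ↑ suc j)) →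
    ∃[ x ] (Q x × (a ⊞ b) ↑ p ≈ (a ↑ p ⊞ b ↑ p) ⊞ p · x)
  frobenius-expansion Q Q0 Q+ {zero} pr a b h = contradiction (prime⇒nonTrivial pr) λ ()
  frobenius-expansion Q Q0 Q+ {suc n} pr a b h = x , Qx , (begin
    (a ⊞ b) ↑ suc n  ≈⟨ theorem (suc n) a b ⟩
    t zero ⊞ sum (λ i → t (suc i))  ≈⟨ +-cong first (≈-trans (sum-init-last (λ i → t (suc i))) (+-cong eq final)) ⟩
    b ↑ suc n ⊞ (suc n · x ⊞ a ↑ suc n)  ≈⟨ +-congˡ (+-comm _ _) ⟩
    b ↑ suc n ⊞ (a ↑ suc n ⊞ suc n · x)  ≈⟨ +-assoc _ _ _ ⟨
    (b ↑ suc n ⊞ a ↑ suc n) ⊞ suc n · x  ≈⟨ +-congʳ (+-comm _ _) ⟩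
    (a ↑ suc n ⊞ b ↑ suc n) ⊞ suc n · x ∎)
    where
    t : Fin (suc (suc n)) → Carrier
    t = binomialTerm a b (suc n)
    Q· : ∀ m {x} → Q x → Q (m · x)
    Q· zero    q = Q0
    Q· (suc m) q = Q+ q (Q· m q)
    mid : ∀ i → ∃[ x ] (Q x × t (suc (inject₁ i)) ≈ suc n · x)
    mid i with prime∣binomial pr (toℕ i) (Fin.toℕ<n i)
    ... | divides m eq = m · y , Q· m (h (toℕ i) (n ∸ suc (toℕ i)) lem) , (begin
      (suc n C suc (toℕ (inject₁ i))) · (a ↑ suc (toℕ (inject₁ i)) ⊠ b ↑ (n ∸ toℕ (inject₁ i)))
        ≡⟨ cong (λ k → (suc n C suc k) · (a ↑ suc k ⊠ b ↑ (n ∸ k))) (Fin.toℕ-inject₁ i) ⟩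
      (suc n C suc (toℕ i)) · (a ↑ suc (toℕ i) ⊠ b ↑ (n ∸ toℕ i))
        ≡⟨ cong₂ (λ k l → k · (a ↑ suc (toℕ i) ⊠ b ↑ l)) (trans eq (ℕ.*-comm m (suc n))) (sym lem′) ⟩
      (suc n * m) · y  ≈⟨ ×-assocˡ y (suc n) m ⟨
      suc n · (m · y)  ∎)
      where
      lem′ : suc (n ∸ suc (toℕ i)) ≡ n ∸ toℕ i
      lem′ = sym (ℕ.+-∸-assoc 1 (Fin.toℕ<n i))
      y = a ↑ suc (toℕ i) ⊠ b ↑ suc (n ∸ suc (toℕ i))
      lem : suc (toℕ i) + suc (n ∸ suc (toℕ i)) ≡ suc n
      lem = cong suc (trans (cong (toℕ i +_) lem′) (ℕ.m+[n∸m]≡n (ℕ.<⇒≤ (Fin.toℕ<n i))))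
    first : t zero ≈ b ↑ suc n
    first = ≈-trans (+-identityʳ _) (*-identityˡ _)
    final : t (suc (fromℕ n)) ≈ a ↑ suc n
    final = begin
      (suc n C suc (toℕ (fromℕ n))) · (a ↑ suc (toℕ (fromℕ n)) ⊠ b ↑ (n ∸ toℕ (fromℕ n)))
        ≡⟨ cong (λ k → (suc n C suc k) · (a ↑ suc k ⊠ b ↑ (n ∸ k))) (Fin.toℕ-fromℕ n) ⟩
      (suc n C suc n) · (a ↑ suc n ⊠ b ↑ (n ∸ n))
        ≡⟨ cong₂ (λ k l → k · (a ↑ suc n ⊠ b ↑ l)) (nCn≡1 (suc n)) (ℕ.n∸n≡0 n) ⟩
      a ↑ suc n ⊠ 1# ⊞ 0#  ≈⟨ ≈-trans (+-identityʳ _) (*-identityʳ _) ⟩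
      a ↑ suc n ∎
    middle = sum-multiple Q Q0 Q+ (suc n) (λ i → t (suc (inject₁ i))) mid
    x  = proj₁ middle
    Qx = proj₁ (proj₂ middle)
    eq = proj₂ (proj₂ middle)

  ι : ℤ → Carrier
  ι (pos n)    = n · 1#
  ι -[1+ n ] = ⊟ (suc n · 1#)

  ι-⊖ : ∀ m n → ι (m ℤ.⊖ n) ≈ m · 1# ⊞ ⊟ (n · 1#)
  ι-⊖ m zero = ≈-sym (≈-trans (+-congˡ -0#≈0#) (+-identityʳ _))
  ι-⊖ zero (suc n) = ≈-sym (+-identityˡ _)
  ι-⊖ (suc m) (suc n) = begin
    ι (suc m ℤ.⊖ suc n)  ≡⟨ cong ι (ℤ.[1+m]⊖[1+n]≡m⊖n m n) ⟩
    ι (m ℤ.⊖ n)  ≈⟨ ι-⊖ m n ⟩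
    m · 1# ⊞ ⊟ (n · 1#)  ≈⟨ +-identityˡ _ ⟨
    0# ⊞ (m · 1# ⊞ ⊟ (n · 1#))  ≈⟨ +-congʳ (-‿inverseʳ 1#) ⟨
    (1# ⊞ ⊟ 1#) ⊞ (m · 1# ⊞ ⊟ (n · 1#))  ≈⟨ interchange 1# (⊟ 1#) _ _ ⟩
    (1# ⊞ m · 1#) ⊞ (⊟ 1# ⊞ ⊟ (n · 1#))  ≈⟨ +-congˡ (⁻¹-∙-comm _ _) ⟩
    (1# ⊞ m · 1#) ⊞ ⊟ (1# ⊞ n · 1#) ∎
    where open import Algebra.Properties.CommutativeSemigroup +-commutativeSemigroup using (interchange)

  ι-neg : ∀ m → ι (ℤ.- m) ≈ ⊟ ι m
  ι-neg (pos zero)  = ≈-sym -0#≈0#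
  ι-neg (pos (suc n)) = ≈-refl
  ι-neg -[1+ n ]  = ≈-sym (⁻¹-involutive _)

  ι-+ : ∀ m n → ι (m ℤ.+ n) ≈ ι m ⊞ ι n
  ι-+ (pos m)    (pos n)    = ×-homo-+ 1# m n
  ι-+ (pos m)    -[1+ n ] = ι-⊖ m (suc n)
  ι-+ -[1+ m ] (pos n)    = ≈-trans (ι-⊖ n (suc m)) (+-comm _ _)
  ι-+ -[1+ m ] -[1+ n ] = begin
    ⊟ (suc (suc (m + n)) · 1#)  ≡⟨ cong (λ k → ⊟ (suc k · 1#)) (ℕ.+-suc m n) ⟨
    ⊟ ((suc m + suc n) · 1#)  ≈⟨ -‿cong (×-homo-+ 1# (suc m) (suc n)) ⟩
    ⊟ (suc m · 1# ⊞ suc n · 1#)  ≈⟨ ⁻¹-∙-comm _ _ ⟨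
    ⊟ (suc m · 1#) ⊞ ⊟ (suc n · 1#) ∎

  private
    ι-*⁺ : ∀ m n → ι (m ℤ.* pos n) ≈ ι m ⊠ ι (pos n)
    ι-*⁺ m zero    = ≈-trans (reflexive (cong ι (ℤ.*-zeroʳ m))) (≈-sym (zeroʳ _))
    ι-*⁺ m (suc n) = begin
      ι (m ℤ.* (pos (suc n)))  ≡⟨ cong ι (ℤ.*-distribˡ-+ m (pos 1) (pos n)) ⟩
      ι (m ℤ.* pos 1 ℤ.+ m ℤ.* pos n)  ≈⟨ ι-+ (m ℤ.* pos 1) (m ℤ.* pos n) ⟩
      ι (m ℤ.* pos 1) ⊞ ι (m ℤ.* pos n)  ≈⟨ +-cong (≈-trans (reflexive (cong ι (ℤ.*-identityʳ m))) (≈-sym (*-identityʳ _))) (ι-*⁺ m n) ⟩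
      ι m ⊠ 1# ⊞ ι m ⊠ (n · 1#)  ≈⟨ distribˡ _ _ _ ⟨
      ι m ⊠ (1# ⊞ n · 1#) ∎

  ι-* : ∀ m n → ι (m ℤ.* n) ≈ ι m ⊠ ι n
  ι-* m (pos n)    = ι-*⁺ m n
  ι-* m -[1+ n ] = begin
    ι (m ℤ.* ℤ.- (pos (suc n)))  ≡⟨ cong ι (ℤ.neg-distribʳ-* m (pos (suc n))) ⟨
    ι (ℤ.- (m ℤ.* pos (suc n)))  ≈⟨ ι-neg (m ℤ.* pos (suc n)) ⟩
    ⊟ ι (m ℤ.* pos (suc n))  ≈⟨ -‿cong (ι-*⁺ m (suc n)) ⟩
    ⊟ (ι m ⊠ ι (pos (suc n)))  ≈⟨ -‿distribʳ-* _ _ ⟩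
    ι m ⊠ ⊟ ι (pos (suc n)) ∎

  open import Algebra.Solver.Ring.AlmostCommutativeRing using (fromCommutativeRing; _-Raw-AlmostCommutative⟶_)

  ι-morphism : ℤ.+-*-rawRing -Raw-AlmostCommutative⟶ fromCommutativeRing R
  ι-morphism = record
    { ⟦_⟧    = ι
    ; +-homo = ι-+
    ; *-homo = ι-*
    ; -‿homo = ι-neg
    ; 0-homo = ≈-refl
    ; 1-homo = +-identityʳ 1#
    }

  private
    ι-≟ : ∀ m n → Maybe (ι m ≈ ι n)
    ι-≟ m n with m ℤ.≟ n
    ... | yes eq = just (reflexive (cong ι eq))
    ... | no  _  = nothing

  module Solver where
    open import Algebra.Solver.Ring ℤ.+-*-rawRing (fromCommutativeRing R) ι-morphism ι-≟ public
      using (solve; _:=_; _:+_; _:*_; _:-_; :-_; con)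

-- Finite sums and the arithmetic of a finite field.

indicator : ∀ {a} {P : Set a} → Dec P → ℕ
indicator (yes _) = 1
indicator (no _)  = 0

indicator-yes : ∀ {a} {P : Set a} (d : Dec P) → P → indicator d ≡ 1
indicator-yes (yes _) _ = refl
indicator-yes (no ¬p) p = contradiction p ¬p

indicator-no : ∀ {a} {P : Set a} (d : Dec P) → ¬ P → indicator d ≡ 0
indicator-no (yes p) ¬p = contradiction p ¬p
indicator-no (no _)  _  = refl

indicator≤1 : ∀ {a} {P : Set a} (d : Dec P) → indicator d ≤ 1
indicator≤1 (yes _) = ℕ.≤-refl
indicator≤1 (no _)  = z≤n

module FinSum {c ℓ} (M : CommutativeMonoid c ℓ) where
  open CommutativeMonoid M using (_≈_; _∙_; ε; ∙-congˡ; identityʳ) renaming (Carrier to A; trans to ≈-trans; refl to ≈-refl)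
  open import Algebra.Properties.CommutativeMonoid.Sum M public
    using (sum; sum-remove; sum-permute; ∑-comm; ∑-distrib-+; sum-replicate; sum-replicate-zero; sum-cong-≋)

  sum-single : ∀ {n} (t : Fin n → A) i → (∀ j → j ≢ i → t j ≈ ε) → sum t ≈ t i
  sum-single {suc n} t i h = ≈-trans (sum-remove {i = i} t)
    (≈-trans (∙-congˡ (≈-trans (sum-cong-≋ (λ j → h (punchIn i j) (Fin.punchInᵢ≢i i j))) (sum-replicate-zero n))) (identityʳ _))

module FieldTheory {q} (F : FiniteField q) where
  open FiniteField F public using (0≢1; enum; _≟_) renaming (Carrier to K; inverse to invertible)

  FR : CommutativeRing 0ℓ 0ℓ
  FR = record { isCommutativeRing = FiniteField.isCommutativeRing F }

  open CommRing FR public using (_⊞_; _⊠_; ⊟_; 0#; 1#; _·_; _↑_; ^-homo-*; ^-assocʳ; ^-distrib-*; ×-homo-+; ×-assocˡ; ×1-homo-*; ×-comm-*; ×-assoc-*;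
    *-assoc; *-comm; *-identityˡ; *-identityʳ; zeroˡ; zeroʳ; +-assoc; +-comm; +-identityˡ; +-identityʳ; -‿inverseˡ; -‿inverseʳ; distribˡ; distribʳ;
    *-commutativeMonoid; +-commutativeMonoid)
  module FS = CommRing.Solver FR
  open FS
  open Inverse enum public using (to; from; strictlyInverseˡ; strictlyInverseʳ)

  1≢0 : 1# ≢ 0#
  1≢0 eq = 0≢1 (sym eq)

  from-injective : ∀ {i j} → from i ≡ from j → i ≡ j
  from-injective {i} {j} eq = trans (sym (strictlyInverseˡ i)) (trans (cong to eq) (strictlyInverseˡ j))

  *-cancelˡ : ∀ {x y z} → x ≢ 0# → x ⊠ y ≡ x ⊠ z → y ≡ z
  *-cancelˡ {x} {y} {z} x≢0 eq with invertible x x≢0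
  ... | w , xw≡1 = trans (sym (lem y)) (trans (cong (w ⊠_) eq) (lem z))
    where
    lem : ∀ y → w ⊠ (x ⊠ y) ≡ y
    lem y = trans (sym (*-assoc w x y)) (trans (cong (_⊠ y) (trans (*-comm w x) xw≡1)) (*-identityˡ y))

  *-nonZero : ∀ {x y} → x ≢ 0# → y ≢ 0# → x ⊠ y ≢ 0#
  *-nonZero {x} x≢0 y≢0 eq = y≢0 (*-cancelˡ x≢0 (trans eq (sym (zeroʳ x))))

  x-y≡0⇒x≡y : ∀ x y → x ⊞ ⊟ y ≡ 0# → x ≡ y
  x-y≡0⇒x≡y x y eq = trans (solve 2 (λ x y → x := (x :+ :- y) :+ y) refl x y) (trans (cong (_⊞ y) eq) (+-identityˡ y))

  search : ∀ {a} {P : K → Set a} → Decidable P → Dec (∃ P)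
  search {P = P} P? = map′ (λ (i , p) → from i , p) (λ (x , p) → to x , subst P (sym (strictlyInverseʳ x)) p) (Fin.any? (P? ∘ from))

  searchᵛ : ∀ n {a} {P : Vec K n → Set a} → Decidable P → Dec (∃ P)
  searchᵛ zero    P? = map′ (λ p → [] , p) (λ { ([] , p) → p }) (P? [])
  searchᵛ (suc n) P? = map′ (λ (x , xs , p) → x ∷ xs , p) (λ { (x ∷ xs , p) → x , xs , p })
    (search (λ x → searchᵛ n (λ xs → P? (x ∷ xs))))

  module Sum {c ℓ} (M : CommutativeMonoid c ℓ) where
    open CommutativeMonoid M using (_≈_; _∙_; ε) renaming (Carrier to A; trans to ≈-trans; refl to ≈-refl; sym to ≈-sym; reflexive to ≈-reflexive)
    open import Algebra.Properties.Monoid.Mult (CommutativeMonoid.monoid M) using () renaming (_×_ to _×ₘ_)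
    open FinSum M

    ∑ : (K → A) → A
    ∑ f = sum (λ i → f (from i))

    ∑-cong : ∀ {f g} → (∀ x → f x ≈ g x) → ∑ f ≈ ∑ g
    ∑-cong h = sum-cong-≋ (λ i → h (from i))

    ∑-+ : ∀ f g → ∑ (λ x → f x ∙ g x) ≈ ∑ f ∙ ∑ g
    ∑-+ f g = ∑-distrib-+ (f ∘ from) (g ∘ from)

    ∑-swap : ∀ (f : K → K → A) → ∑ (λ x → ∑ (f x)) ≈ ∑ (λ y → ∑ (λ x → f x y))
    ∑-swap f = ∑-comm (λ i j → f (from i) (from j))

    ∑-constant : ∀ a → ∑ (λ _ → a) ≈ q ×ₘ a
    ∑-constant a = sum-replicate q

    ∑-single : ∀ f x → (∀ y → y ≢ x → f y ≈ ε) → ∑ f ≈ f x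
    ∑-single f x h = ≈-trans
      (sum-single (f ∘ from) (to x) (λ j j≢x → h (from j) (λ eq → j≢x (trans (sym (strictlyInverseˡ j)) (cong to eq)))))
      (≈-reflexive (cong f (strictlyInverseʳ x)))

    ∑-bijection : ∀ (σ τ : K → K) → (∀ x → σ (τ x) ≡ x) → (∀ x → τ (σ x) ≡ x) → ∀ f → ∑ (f ∘ σ) ≈ ∑ f
    ∑-bijection σ τ στ τσ f = ≈-sym (≈-trans (sum-permute (f ∘ from) π)
      (sum-cong-≋ λ i → ≈-reflexive (cong f (strictlyInverseʳ (σ (from i))))))
      where
      π = permutation (to ∘ σ ∘ from) (to ∘ τ ∘ from)
        (λ i → trans (cong (to ∘ σ) (strictlyInverseʳ _)) (trans (cong to (στ (from i))) (strictlyInverseˡ i)))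
        (λ i → trans (cong (to ∘ τ) (strictlyInverseʳ _)) (trans (cong to (τσ (from i))) (strictlyInverseˡ i)))

    ∑-translate : ∀ a f → ∑ (λ x → f (a ⊞ x)) ≈ ∑ f
    ∑-translate a = ∑-bijection (a ⊞_) (⊟ a ⊞_)
      (λ x → solve 2 (λ a x → a :+ (:- a :+ x) := x) refl a x)
      (λ x → solve 2 (λ a x → :- a :+ (a :+ x) := x) refl a x)

    ∑-dilate : ∀ {c} → c ≢ 0# → ∀ f → ∑ (λ x → f (c ⊠ x)) ≈ ∑ f
    ∑-dilate {c} c≢0 with invertible c c≢0
    ... | w , cw≡1 = ∑-bijection (c ⊠_) (w ⊠_)
      (λ x → trans (sym (*-assoc c w x)) (trans (cong (_⊠ x) cw≡1) (*-identityˡ x)))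
      (λ x → trans (sym (*-assoc w c x)) (trans (cong (_⊠ x) (trans (*-comm w c) cw≡1)) (*-identityˡ x)))

    ∑ᵛ : ∀ n → (Vec K n → A) → A
    ∑ᵛ zero    f = f []
    ∑ᵛ (suc n) f = ∑ (λ x → ∑ᵛ n (λ xs → f (x ∷ xs)))

    ∑ᵛ-cong : ∀ n {f g} → (∀ x → f x ≈ g x) → ∑ᵛ n f ≈ ∑ᵛ n g
    ∑ᵛ-cong zero    h = h []
    ∑ᵛ-cong (suc n) h = ∑-cong (λ x → ∑ᵛ-cong n (λ xs → h (x ∷ xs)))

    ∑ᵛ-+ : ∀ n f g → ∑ᵛ n (λ x → f x ∙ g x) ≈ ∑ᵛ n f ∙ ∑ᵛ n g
    ∑ᵛ-+ zero    f g = ≈-refl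
    ∑ᵛ-+ (suc n) f g = ≈-trans (∑-cong (λ x → ∑ᵛ-+ n (λ xs → f (x ∷ xs)) (λ xs → g (x ∷ xs)))) (∑-+ (λ x → ∑ᵛ n (λ xs → f (x ∷ xs))) (λ x → ∑ᵛ n (λ xs → g (x ∷ xs))))

    ∑-∑ᵛ-swap : ∀ n (f : K → Vec K n → A) → ∑ (λ x → ∑ᵛ n (f x)) ≈ ∑ᵛ n (λ v → ∑ (λ x → f x v))
    ∑-∑ᵛ-swap zero    f = ≈-refl
    ∑-∑ᵛ-swap (suc n) f = ≈-trans (∑-swap (λ x y → ∑ᵛ n (λ ys → f x (y ∷ ys))))
      (∑-cong (λ y → ∑-∑ᵛ-swap n (λ x ys → f x (y ∷ ys))))

    ∑ᵛ-swap : ∀ m n (f : Vec K m → Vec K n → A) → ∑ᵛ m (λ u → ∑ᵛ n (f u)) ≈ ∑ᵛ n (λ v → ∑ᵛ m (λ u → f u v))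
    ∑ᵛ-swap zero    n f = ≈-refl
    ∑ᵛ-swap (suc m) n f = ≈-trans (∑-cong (λ x → ∑ᵛ-swap m n (λ xs → f (x ∷ xs))))
      (∑-∑ᵛ-swap n (λ x v → ∑ᵛ m (λ xs → f (x ∷ xs) v)))

    ∑ᵛ-single : ∀ n f x → (∀ y → y ≢ x → f y ≈ ε) → ∑ᵛ n f ≈ f x
    ∑ᵛ-single zero    f []       h = ≈-refl
    ∑ᵛ-single (suc n) f (x ∷ xs) h = ≈-trans
      (∑-single _ x (λ y y≢x → ≈-trans (∑ᵛ-cong n (λ ys → h (y ∷ ys) (λ { refl → y≢x refl }))) (∑ᵛ-ε n)))
      (∑ᵛ-single n (λ ys → f (x ∷ ys)) xs (λ ys ys≢xs → h (x ∷ ys) (λ { refl → ys≢xs refl })))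
      where
      ∑ᵛ-ε : ∀ n → ∑ᵛ n (λ _ → ε) ≈ ε
      ∑ᵛ-ε zero    = ≈-refl
      ∑ᵛ-ε (suc n) = ≈-trans (∑-cong (λ _ → ∑ᵛ-ε n)) (sum-replicate-zero q)

    ∑ᵛ-bijection : ∀ n (σ τ : K → K) → (∀ x → σ (τ x) ≡ x) → (∀ x → τ (σ x) ≡ x) → ∀ f → ∑ᵛ n (f ∘ map σ) ≈ ∑ᵛ n f
    ∑ᵛ-bijection zero    σ τ στ τσ f = ≈-refl
    ∑ᵛ-bijection (suc n) σ τ στ τσ f = ≈-trans
      (∑-bijection σ τ στ τσ (λ x → ∑ᵛ n (λ xs → f (x ∷ map σ xs))))
      (∑-cong (λ x → ∑ᵛ-bijection n σ τ στ τσ (λ xs → f (x ∷ xs))))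

  module ΣF = Sum ℕ.+-0-commutativeMonoid

  ∑-mono : ∀ {f g} → (∀ x → f x ≤ g x) → ΣF.∑ f ≤ ΣF.∑ g
  ∑-mono {f} {g} h = go (f ∘ from) (g ∘ from) (h ∘ from)
    where
    go : ∀ {n} (s t : Fin n → ℕ) → (∀ i → s i ≤ t i) → FinSum.sum ℕ.+-0-commutativeMonoid s ≤ FinSum.sum ℕ.+-0-commutativeMonoid t
    go {zero}  s t h = z≤n
    go {suc n} s t h = ℕ.+-mono-≤ (h zero) (go (s ∘ suc) (t ∘ suc) (h ∘ suc))

  ∑-* : ∀ c f → ΣF.∑ (λ x → c * f x) ≡ c * ΣF.∑ f
  ∑-* c f = sym (*-distribˡ-sum c (f ∘ from))
    where open import Algebra.Properties.Semiring.Sum ℕ.+-*-semiring using (*-distribˡ-sum)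

  ∑-const : ∀ c → ΣF.∑ (λ _ → c) ≡ q * c
  ∑-const c = trans (ΣF.∑-constant c) (go q)
    where
    open import Algebra.Properties.Monoid.Mult ℕ.+-0-monoid using () renaming (_×_ to _×ₘ_)
    go : ∀ n → n ×ₘ c ≡ n * c
    go zero    = refl
    go (suc n) = cong (c +_) (go n)

  ↑-zero : ∀ {n} → 0 < n → 0# ↑ n ≡ 0#
  ↑-zero {suc n} _ = zeroˡ _

  1↑ : ∀ n → 1# ↑ n ≡ 1#
  1↑ zero    = refl
  1↑ (suc n) = trans (*-identityˡ _) (1↑ n)

  0<q : 0 < q
  0<q = ℕ.≤-trans (s≤s z≤n) (Fin.toℕ<n (to 0#))

  module _ {x : K} (x≢0 : x ≢ 0#) where
    open Sum *-commutativeMonoid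
    open ≡-Reasoning

    private
      pick : ∀ {y} → Dec (y ≡ 0#) → K → K → K
      pick (yes _) a b = a
      pick (no _)  a b = b

      h : K → K
      h y = pick (y ≟ 0#) 1# y

      g : K → K
      g y = pick (y ≟ 0#) 1# x

      e : K → K
      e y = pick (y ≟ 0#) x 1#

      h≢0 : ∀ y → h y ≢ 0#
      h≢0 y with y ≟ 0#
      ... | yes _   = λ eq → 0≢1 (sym eq)
      ... | no  y≢0 = y≢0

      product≢0 : ∀ {n} (t : Fin n → K) → (∀ i → t i ≢ 0#) → FinSum.sum *-commutativeMonoid t ≢ 0#
      product≢0 {zero}  t nz eq = 0≢1 (sym eq)
      product≢0 {suc n} t nz    = *-nonZero (nz zero) (product≢0 (t ∘ suc) (nz ∘ suc))

      hx : ∀ y → h (x ⊠ y) ≡ g y ⊠ h y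
      hx y with y ≟ 0# | (x ⊠ y) ≟ 0#
      ... | yes y≡0 | yes _   = sym (*-identityˡ 1#)
      ... | yes y≡0 | no xy≢0 = contradiction (trans (cong (x ⊠_) y≡0) (zeroʳ x)) xy≢0
      ... | no y≢0  | yes xy≡0 = contradiction xy≡0 (*-nonZero x≢0 y≢0)
      ... | no _    | no _    = refl

      ge : ∀ y → x ≡ g y ⊠ e y
      ge y with y ≟ 0#
      ... | yes _ = sym (*-identityˡ x)
      ... | no  _ = sym (*-identityʳ x)

      ∏g≡1 : ∑ g ≡ 1#
      ∏g≡1 = *-cancelˡ (product≢0 (h ∘ from) (h≢0 ∘ from)) (begin
        ∑ h ⊠ ∑ g  ≡⟨ *-comm _ _ ⟩
        ∑ g ⊠ ∑ h  ≡⟨ ∑-+ g h ⟨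
        ∑ (λ y → g y ⊠ h y)  ≡⟨ ∑-cong hx ⟨
        ∑ (λ y → h (x ⊠ y))  ≡⟨ ∑-dilate x≢0 h ⟩
        ∑ h  ≡⟨ *-identityʳ _ ⟨
        ∑ h ⊠ 1# ∎)

      e0 : e 0# ≡ x
      e0 with 0# ≟ 0#
      ... | yes _ = refl
      ... | no n  = contradiction refl n

      e1 : ∀ y → y ≢ 0# → e y ≡ 1#
      e1 y y≢0 with y ≟ 0#
      ... | yes y≡0 = contradiction y≡0 y≢0
      ... | no _    = refl

    -- Let h be the identity except that h 0 = 1. Replacing y by x y permutes F and multiplies each
    -- factor of ∏ h with y ≠ 0 by x, so ∏ g = 1; this is x^(q-1) = 1 without an enumeration of the
    -- nonzero elements. The factor e restores the missing x at y = 0.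
    fermat-nonZero : x ↑ q ≡ x
    fermat-nonZero = begin
      x ↑ q  ≡⟨ ∑-constant x ⟨
      ∑ (λ _ → x)  ≡⟨ ∑-cong ge ⟩
      ∑ (λ y → g y ⊠ e y)  ≡⟨ ∑-+ g e ⟩
      ∑ g ⊠ ∑ e  ≡⟨ cong₂ _⊠_ ∏g≡1 (trans (∑-single e 0# e1) e0) ⟩
      1# ⊠ x  ≡⟨ *-identityˡ x ⟩
      x ∎

    fermat-unit : x ↑ (q ∸ 1) ≡ 1#
    fermat-unit = *-cancelˡ x≢0 (trans (cong (x ↑_) (ℕ.m+[n∸m]≡n 0<q)) (trans fermat-nonZero (sym (*-identityʳ x))))

  fermat : ∀ x → x ↑ q ≡ x
  fermat x with x ≟ 0#
  ... | yes refl = ↑-zero 0<q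
  ... | no x≢0   = fermat-nonZero x≢0

  evalH : ∀ {n} → Vec K n → K → K
  evalH []       x = 0#
  evalH (c ∷ cs) x = c ⊞ x ⊠ evalH cs x

  -- Synthetic division by X - r: the coefficients of the quotient are the intermediate values of
  -- Horner's scheme at r, with the lowest degree first.
  divideH : ∀ {n} → Vec K (suc n) → K → Vec K n
  divideH (c ∷ [])          r = []
  divideH (c ∷ cs@(_ ∷ _)) r = evalH cs r ∷ divideH cs r

  evalH-divide : ∀ {n} (cs : Vec K (suc n)) r x → evalH cs x ≡ evalH cs r ⊞ (x ⊞ ⊟ r) ⊠ evalH (divideH cs r) x
  evalH-divide (c ∷ []) r x = solve 3 (λ c r x → c :+ x :* con (pos 0) := c :+ r :* con (pos 0) :+ (x :+ :- r) :* con (pos 0)) refl c r x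
  evalH-divide (c ∷ cs@(_ ∷ _)) r x = trans (cong (λ z → c ⊞ x ⊠ z) (evalH-divide cs r x))
    (solve 5 (λ c r x a b → c :+ x :* (a :+ (x :+ :- r) :* b) := (c :+ r :* a) :+ (x :+ :- r) :* (a :+ x :* b)) refl c r x (evalH cs r) _)

  last-divideH : ∀ {n} (cs : Vec K (suc (suc n))) r → last (divideH cs r) ≡ last cs
  last-divideH (c ∷ b ∷ [])            r = trans (cong (b ⊞_) (zeroʳ r)) (+-identityʳ b)
  last-divideH (c ∷ cs@(_ ∷ _ ∷ _)) r = last-divideH cs r

  -- Division by X - r₀ keeps the leading coefficient, and as F is a domain the other roots are
  -- roots of the quotient.
  roots-bounded : ∀ n (cs : Vec K (suc n)) → last cs ≢ 0# → (r : Fin (suc n) → K) → Injective _≡_ _≡_ r → ¬ (∀ i → evalH cs (r i) ≡ 0#)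
  roots-bounded zero    (c ∷ []) c≢0 r inj root = c≢0 (trans (sym (trans (cong (c ⊞_) (zeroʳ _)) (+-identityʳ c))) (root zero))
  roots-bounded (suc n) cs c≢0 r inj root =
    roots-bounded n (divideH cs (r zero)) (λ eq → c≢0 (trans (sym (last-divideH cs (r zero))) eq)) (r ∘ suc) (λ eq → Fin.suc-injective (inj eq)) root′
    where
    root′ : ∀ i → evalH (divideH cs (r zero)) (r (suc i)) ≡ 0#
    root′ i = *-cancelˡ {r (suc i) ⊞ ⊟ r zero} (λ eq → Fin.0≢1+n (inj (sym (x-y≡0⇒x≡y _ _ eq)))) (begin
      (x ⊞ ⊟ r zero) ⊠ evalH (divideH cs (r zero)) x  ≡⟨ +-identityˡ _ ⟨
      0# ⊞ (x ⊞ ⊟ r zero) ⊠ evalH (divideH cs (r zero)) x  ≡⟨ cong (_⊞ (x ⊞ ⊟ r zero) ⊠ evalH (divideH cs (r zero)) x) (root zero) ⟨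
      evalH cs (r zero) ⊞ (x ⊞ ⊟ r zero) ⊠ evalH (divideH cs (r zero)) x  ≡⟨ evalH-divide cs (r zero) x ⟨
      evalH cs x  ≡⟨ root (suc i) ⟩
      0#  ≡⟨ zeroʳ _ ⟨
      (x ⊞ ⊟ r zero) ⊠ 0# ∎)
      where
      open ≡-Reasoning
      x = r (suc i)

  monomialH : ∀ n → Vec K (suc n)
  monomialH zero    = 1# ∷ []
  monomialH (suc n) = 0# ∷ monomialH n

  evalH-monomial : ∀ n x → evalH (monomialH n) x ≡ x ↑ n
  evalH-monomial zero    x = trans (cong (1# ⊞_) (zeroʳ x)) (+-identityʳ 1#)
  evalH-monomial (suc n) x = trans (+-identityˡ _) (cong (x ⊠_) (evalH-monomial n x))

  last-monomialH : ∀ n → last (monomialH n) ≡ 1#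
  last-monomialH zero          = refl
  last-monomialH (suc zero)    = refl
  last-monomialH (suc (suc n)) = last-monomialH (suc n)

  ∃-nontrivial-power : ∀ u → 0 < u → suc u < q → ∃[ x ] (x ≢ 0# × x ↑ u ≢ 1#)
  ∃-nontrivial-power u@(suc u′) 0<u u<q with search (λ x → ¬? ((x ↑ suc u) ≟ x))
  ... | yes (x , h) = x , (λ { refl → h (zeroˡ _) }) , (λ eq → h (trans (cong (x ⊠_) eq) (*-identityʳ x)))
  ... | no ¬h = contradiction (λ i → root (r i)) (roots-bounded (suc u) cs last≢0 r inj)
    where
    cs : Vec K (suc (suc u))
    -- Coefficients of Xᵘ⁺¹ - X. If it vanished on all of F it would have at least u + 2 roots,
    -- because u + 1 < q.
    cs = 0# ∷ ⊟ 1# ∷ monomialH u′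
    last≡ : ∀ {n} a b (v : Vec K (suc n)) → last (a ∷ b ∷ v) ≡ last v
    last≡ a b (x ∷ v) = refl
    last≢0 : last cs ≢ 0#
    last≢0 eq = 0≢1 (trans (sym eq) (trans (last≡ 0# (⊟ 1#) (monomialH u′)) (last-monomialH u′)))
    r : Fin (suc (suc u)) → K
    r i = from (inject≤ i u<q)
    inj : Injective _≡_ _≡_ r
    inj eq = Fin.inject≤-injective u<q u<q _ _ (from-injective eq)
    fix : ∀ x → x ↑ suc u ≡ x
    fix x with (x ↑ suc u) ≟ x
    ... | yes eq = eq
    ... | no neq = contradiction (x , neq) ¬h
    root : ∀ x → evalH cs x ≡ 0#
    root x = begin
      0# ⊞ x ⊠ (⊟ 1# ⊞ x ⊠ evalH (monomialH u′) x)  ≡⟨ cong (λ z → 0# ⊞ x ⊠ (⊟ 1# ⊞ x ⊠ z)) (evalH-monomial u′ x) ⟩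
      0# ⊞ x ⊠ (⊟ 1# ⊞ x ↑ u)  ≡⟨ +-identityˡ _ ⟩
      x ⊠ (⊟ 1# ⊞ x ↑ u)  ≡⟨ distribˡ _ _ _ ⟩
      x ⊠ ⊟ 1# ⊞ x ↑ suc u  ≡⟨ cong₂ _⊞_ (trans (sym (CommRing.-‿distribʳ-* FR x 1#)) (cong ⊟_ (*-identityʳ x))) (fix x) ⟩
      ⊟ x ⊞ x  ≡⟨ -‿inverseˡ x ⟩
      0# ∎
      where open ≡-Reasoning

  -- Translation by 1 permutes F, so the sum of all elements equals itself plus q · 1.
  q·1≡0 : q · 1# ≡ 0#
  q·1≡0 = begin
    q · 1#  ≡⟨ solve 2 (λ a b → a := :- b :+ (b :+ a)) refl (q · 1#) (∑ id) ⟩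
    ⊟ ∑ id ⊞ (∑ id ⊞ q · 1#)  ≡⟨ cong (λ z → ⊟ ∑ id ⊞ (∑ id ⊞ z)) (∑-constant 1#) ⟨
    ⊟ ∑ id ⊞ (∑ id ⊞ ∑ (λ _ → 1#)) ≡⟨ cong (⊟ ∑ id ⊞_) (∑-+ id (λ _ → 1#)) ⟨
    ⊟ ∑ id ⊞ ∑ (λ x → x ⊞ 1#)  ≡⟨ cong (⊟ ∑ id ⊞_) (trans (∑-cong (λ x → +-comm x 1#)) (∑-translate 1# id)) ⟩
    ⊟ ∑ id ⊞ ∑ id  ≡⟨ -‿inverseˡ _ ⟩
    0# ∎
    where
    open ≡-Reasoning
    open Sum +-commutativeMonoid
    open FS

  -- F is a domain, so one of the prime factors of q already annihilates 1.
  characteristic : ∃[ p ] (Prime p × p · 1# ≡ 0#)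
  characteristic = go (factors fs) (factorsPrime fs) (trans (cong (_· 1#) (sym (isFactorisation fs))) q·1≡0)
    where
    open PrimeFactorisation
    fs = factorise q {{ℕ.>-nonZero 0<q}}
    go : ∀ ps → All Prime ps → product ps · 1# ≡ 0# → ∃[ p ] (Prime p × p · 1# ≡ 0#)
    go [] [] eq = contradiction (trans (sym eq) (+-identityʳ 1#)) 0≢1
    go (p ∷ ps) (pr ∷ prs) eq with (p · 1#) ≟ 0#
    ... | yes p≡0 = p , pr , p≡0
    ... | no p≢0  = go ps prs (*-cancelˡ p≢0 (trans (sym (×1-homo-* p (product ps))) (trans eq (sym (zeroʳ _)))))

  module Characteristic (p : ℕ) (pr : Prime p) (p·1≡0 : p · 1# ≡ 0#) where
    private instance
      p-nonTrivial = prime⇒nonTrivial pr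
      p-nonZero = ℕ.nonTrivial⇒nonZero p

    1<p : 1 < p
    1<p = ℕ.nonTrivial⇒n>1 p

    p·≡0 : ∀ x → p · x ≡ 0#
    p·≡0 x = begin
      p · x  ≡⟨ cong (p ·_) (*-identityˡ x) ⟨
      p · (1# ⊠ x)  ≡⟨ ×-assoc-* p 1# x ⟨
      (p · 1#) ⊠ x  ≡⟨ cong (_⊠ x) p·1≡0 ⟩
      0# ⊠ x  ≡⟨ zeroˡ x ⟩
      0# ∎
      where open ≡-Reasoning

    frobenius-+ : ∀ x y → (x ⊞ y) ↑ p ≡ x ↑ p ⊞ y ↑ p
    frobenius-+ x y with CommRing.frobenius-expansion FR (λ _ → ⊤) tt (λ _ _ → tt) pr x y (λ _ _ _ → tt)
    ... | z , _ , eq = trans eq (trans (cong (x ↑ p ⊞ y ↑ p ⊞_) (p·≡0 z)) (+-identityʳ _))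

    multiple-*p : ∀ m x → (m * p) · x ≡ 0#
    multiple-*p m x = trans (cong (_· x) (ℕ.*-comm m p)) (trans (sym (×-assocˡ x p m)) (p·≡0 (m · x)))

    ·-% : ∀ m x → m · x ≡ (m % p) · x
    ·-% m x = begin
      m · x  ≡⟨ cong (_· x) (m≡m%n+[m/n]*n m p) ⟩
      (m % p + m ℕ./ p * p) · x  ≡⟨ ×-homo-+ x (m % p) (m ℕ./ p * p) ⟩
      (m % p) · x ⊞ (m ℕ./ p * p) · x  ≡⟨ cong ((m % p) · x ⊞_) (multiple-*p (m ℕ./ p) x) ⟩
      (m % p) · x ⊞ 0#  ≡⟨ +-identityʳ _ ⟩
      (m % p) · x ∎
      where open ≡-Reasoning

    open ΣF using (∑; ∑-cong; ∑-single; ∑-translate)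

    n<p^n : ∀ n → n < p ^ n
    n<p^n zero    = s≤s z≤n
    n<p^n (suc n) = ℕ.<-≤-trans (s≤s (n<p^n n)) (subst (p ^ n <_) (ℕ.*-comm (p ^ n) p) (ℕ.m<m*n (p ^ n) p {{ℕ.>-nonZero (ℕ.≤-trans (s≤s z≤n) (n<p^n n))}} 1<p))

    module Subgroup (S : K → Set) (S? : Decidable S) (S0 : S 0#) (S+ : ∀ {x y} → S x → S y → S (x ⊞ y)) where
      S· : ∀ m {x} → S x → S (m · x)
      S· zero    s = S0
      S· (suc m) s = S+ s (S· m s)

      S- : ∀ {x} → S x → S (⊟ x)
      S- {x} s = subst S eq (S· (p ∸ 1) s)
        where
        open ≡-Reasoning
        eq : (p ∸ 1) · x ≡ ⊟ x
        eq = begin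
          (p ∸ 1) · x  ≡⟨ solve 2 (λ x y → y := :- x :+ (x :+ y)) refl x _ ⟩
          ⊟ x ⊞ (suc (p ∸ 1) · x)  ≡⟨ cong (λ m → ⊟ x ⊞ m · x) (ℕ.m+[n∸m]≡n (ℕ.<⇒≤ 1<p)) ⟩
          ⊟ x ⊞ p · x  ≡⟨ cong (⊟ x ⊞_) (p·≡0 x) ⟩
          ⊟ x ⊞ 0#  ≡⟨ +-identityʳ _ ⟩
          ⊟ x ∎

      -- Bézout gives y with y m ≡ 1 or y m ≡ -1 modulo p, so w is a multiple of m · w up to sign.
      divide : ∀ {m w} → 0 < m → m < p → S (m · w) → S w
      divide {m} {w} 0<m m<p s with coprime-Bézout (prime⇒coprime pr {{ℕ.>-nonZero 0<m}} m<p)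
      ... | Bézout.-+ x y eq = subst S (begin
        y · (m · w)  ≡⟨ ×-assocˡ w y m ⟩
        (y * m) · w  ≡⟨ cong (_· w) eq ⟨
        (1 + x * p) · w  ≡⟨⟩
        w ⊞ (x * p) · w  ≡⟨ cong (w ⊞_) (multiple-*p x w) ⟩
        w ⊞ 0#  ≡⟨ +-identityʳ w ⟩
        w ∎) (S· y s)
        where open ≡-Reasoning
      ... | Bézout.+- x y eq = subst S (begin
        ⊟ (y · (m · w))  ≡⟨ cong ⊟_ (×-assocˡ w y m) ⟩
        ⊟ ((y * m) · w)  ≡⟨ solve 2 (λ w z → :- z := w :+ :- (w :+ z)) refl w _ ⟩
        w ⊞ ⊟ ((1 + y * m) · w)  ≡⟨ cong (λ k → w ⊞ ⊟ (k · w)) eq ⟩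
        w ⊞ ⊟ ((x * p) · w)  ≡⟨ cong (λ z → w ⊞ ⊟ z) (multiple-*p x w) ⟩
        w ⊞ ⊟ 0#  ≡⟨ solve 1 (λ w → w :+ :- con (pos 0) := w) refl w ⟩
        w ∎) (S- (S· y s))
        where open ≡-Reasoning

      module Extend {w : K} (w∉S : ¬ S w) where
        S′ : K → Set
        S′ x = ∃[ i ] S (x ⊞ toℕ {p} i · w)

        S′? : Decidable S′
        S′? x = Fin.any? (λ i → S? (x ⊞ toℕ i · w))

        S′0 : S′ 0#
        S′0 = fromℕ< (ℕ.<⇒≤ 1<p) , subst (λ k → S (0# ⊞ k · w)) (sym (Fin.toℕ-fromℕ< (ℕ.<⇒≤ 1<p))) (subst S (sym (+-identityʳ 0#)) S0)

        S′+ : ∀ {x y} → S′ x → S′ y → S′ (x ⊞ y)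
        S′+ {x} {y} (i , s) (j , t) = fromℕ< k<p , subst (λ k → S (x ⊞ y ⊞ k · w)) (sym (Fin.toℕ-fromℕ< k<p)) (subst S eq (S+ s t))
          where
          open ≡-Reasoning
          k = toℕ i + toℕ j
          k<p : k % p < p
          k<p = m%n<n k p
          eq : (x ⊞ toℕ i · w) ⊞ (y ⊞ toℕ j · w) ≡ x ⊞ y ⊞ (k % p) · w
          eq = begin
            (x ⊞ toℕ i · w) ⊞ (y ⊞ toℕ j · w)  ≡⟨ solve 4 (λ a b c d → (a :+ b) :+ (c :+ d) := (a :+ c) :+ (b :+ d)) refl x (toℕ i · w) y (toℕ j · w) ⟩
            (x ⊞ y) ⊞ (toℕ i · w ⊞ toℕ j · w)  ≡⟨ cong (x ⊞ y ⊞_) (×-homo-+ w (toℕ i) (toℕ j)) ⟨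
            (x ⊞ y) ⊞ k · w  ≡⟨ cong (x ⊞ y ⊞_) (·-% k w) ⟩
            x ⊞ y ⊞ (k % p) · w ∎

        distinct : ∀ {x} (i j : Fin p) → S (x ⊞ toℕ i · w) → S (x ⊞ toℕ j · w) → ¬ toℕ i < toℕ j
        distinct {x} i j s t i<j = w∉S (divide (ℕ.m<n⇒0<n∸m i<j) (ℕ.≤-<-trans (ℕ.m∸n≤m (toℕ j) (toℕ i)) (Fin.toℕ<n j)) (subst S eq (S+ (S- s) t)))
          where
          open ≡-Reasoning
          a = toℕ i
          b = toℕ j
          eq : ⊟ (x ⊞ a · w) ⊞ (x ⊞ b · w) ≡ (b ∸ a) · w
          eq = begin
            ⊟ (x ⊞ a · w) ⊞ (x ⊞ b · w)  ≡⟨ cong (λ k → ⊟ (x ⊞ a · w) ⊞ (x ⊞ k · w)) (ℕ.m+[n∸m]≡n (ℕ.<⇒≤ i<j)) ⟨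
            ⊟ (x ⊞ a · w) ⊞ (x ⊞ (a + (b ∸ a)) · w)  ≡⟨ cong (λ z → ⊟ (x ⊞ a · w) ⊞ (x ⊞ z)) (×-homo-+ w a (b ∸ a)) ⟩
            ⊟ (x ⊞ a · w) ⊞ (x ⊞ (a · w ⊞ (b ∸ a) · w))  ≡⟨ solve 3 (λ x y z → :- (x :+ y) :+ (x :+ (y :+ z)) := z) refl x (a · w) ((b ∸ a) · w) ⟩
            (b ∸ a) · w ∎

        unique : ∀ {x} (i j : Fin p) → S (x ⊞ toℕ i · w) → S (x ⊞ toℕ j · w) → i ≡ j
        unique i j s t with ℕ.<-cmp (toℕ i) (toℕ j)
        ... | tri< i<j _ _ = contradiction i<j (distinct i j s t)
        ... | tri≈ _ eq _  = Fin.toℕ-injective eq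
        ... | tri> _ _ j<i = contradiction j<i (distinct j i t s)

        open FinSum ℕ.+-0-commutativeMonoid

        -- The translates S - i w are disjoint for i < p, so membership in their union is the sum of
        -- the p memberships; this yields the factor p in `size-S′`.
        indicator-S′ : ∀ x → indicator (S′? x) ≡ sum {p} (λ i → indicator (S? (x ⊞ toℕ i · w)))
        indicator-S′ x with S′? x
        ... | yes (i , s) = sym (trans (sum-single _ i (λ j j≢i → indicator-no (S? _) (λ t → j≢i (unique j i t s)))) (indicator-yes (S? _) s))
        ... | no ¬s = sym (trans (sum-cong-≋ {p} (λ i → indicator-no (S? _) (λ s → ¬s (i , s)))) (sum-replicate-zero p))

        size-S′ : ∑ (indicator ∘ S′?) ≡ p * ∑ (indicator ∘ S?)
        size-S′ = begin
          ∑ (indicator ∘ S′?)  ≡⟨ ∑-cong indicator-S′ ⟩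
          ∑ (λ x → sum {p} (λ i → indicator (S? (x ⊞ toℕ i · w))))  ≡⟨ ∑-comm {q} {p} (λ j i → indicator (S? (from j ⊞ toℕ i · w))) ⟩
          sum {p} (λ i → ∑ (λ x → indicator (S? (x ⊞ toℕ i · w))))  ≡⟨ sum-cong-≋ {p} (λ i → trans (∑-cong (λ x → cong (indicator ∘ S?) (+-comm x (toℕ i · w)))) (∑-translate (toℕ i · w) (indicator ∘ S?))) ⟩
          sum {p} (λ i → ∑ (indicator ∘ S?))  ≡⟨ sum-const p ⟩
          p * ∑ (indicator ∘ S?) ∎
          where
          open ≡-Reasoning
          sum-const : ∀ n {a} → sum {n} (λ _ → a) ≡ n * a
          sum-const zero    = refl
          sum-const (suc n) = cong (_ +_) (sum-const n)

    private
      -- Additive subgroups grow from {0} to F: adjoining w ∉ S replaces S by S + ⟨w⟩, which is p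
      -- times as large because w has order p modulo S. The size pʲ exceeds j and cannot exceed q,
      -- so the fuel never runs out.
      grow : ∀ fuel j (S : K → Set) (S? : Decidable S) → S 0# → (∀ {x y} → S x → S y → S (x ⊞ y)) →
        ∑ (indicator ∘ S?) ≡ p ^ j → q < fuel + j → ∃[ k ] q ≡ p ^ k
      grow fuel j S S? S0 S+ size q<f with search (¬? ∘ S?)
      ... | no all = j , trans (sym (trans (∑-const 1) (ℕ.*-identityʳ q))) (trans (∑-cong (λ x → sym (indicator-yes (S? x) (dec x)))) size)
        where
        dec : ∀ x → S x
        dec x with S? x
        ... | yes s = s
        ... | no ¬s = contradiction (x , ¬s) all
      grow zero j S S? S0 S+ size q<f | yes _ = contradiction
        (ℕ.≤-trans (ℕ.<⇒≤ (n<p^n j)) (subst (_≤ q) size (subst (∑ (indicator ∘ S?) ≤_) (trans (∑-const 1) (ℕ.*-identityʳ q)) (∑-mono (λ x → indicator≤1 (S? x)))))) (ℕ.<⇒≱ q<f)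
      grow (suc f) j S S? S0 S+ size q<f | yes (w , w∉S) =
        grow f (suc j) S′ S′? S′0 S′+ (trans size-S′ (cong (p *_) size)) (subst (q <_) (sym (ℕ.+-suc f j)) q<f)
        where open Subgroup.Extend S S? S0 S+ w∉S

    prime-power : ∃[ k ] q ≡ p ^ k
    prime-power = grow (suc q) 0 (_≡ 0#) (_≟ 0#) refl (λ { refl refl → +-identityʳ 0# })
      (trans (∑-single _ 0# (λ y y≢0 → indicator-no (y ≟ 0#) y≢0)) (indicator-yes (0# ≟ 0#) refl))
      (ℕ.≤-trans (ℕ.n<1+n q) (ℕ.m≤m+n (suc q) 0))

-- The monoid ring of (F, ·) over the integers.

-- Properties of ℤ[F] separated from its representation by lists. `φ n` is induced by x ↦ xⁿ,
-- `generated` replaces induction on formal sums, and `torsion-free` allows division by p.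
record MultiplicativeLift {q} (F : FiniteField q) : Set₁ where
  open FieldTheory F using (K) renaming (_⊞_ to _⊞ᶠ_; _⊠_ to _⊠ᶠ_; _↑_ to _↑ᶠ_; 1# to 1ᶠ)
  field R : CommutativeRing 0ℓ 0ℓ
  open CommRing R
  field
    ε      : Carrier → K
    ε-cong : ∀ {a b} → a ≈ b → ε a ≡ ε b
    ε-⊞    : ∀ a b → ε (a ⊞ b) ≡ ε a ⊞ᶠ ε b
    ε-⊠    : ∀ a b → ε (a ⊠ b) ≡ ε a ⊠ᶠ ε b
    T      : K → Carrier
    T-*    : ∀ x y → T (x ⊠ᶠ y) ≈ T x ⊠ T y
    T-1    : T 1ᶠ ≈ 1#
    ε-T    : ∀ x → ε (T x) ≡ x
    φ      : ℕ → Carrier → Carrier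
    φ-cong : ∀ n {a b} → a ≈ b → φ n a ≈ φ n b
    φ-⊞    : ∀ n a b → φ n (a ⊞ b) ≈ φ n a ⊞ φ n b
    φ-⊠    : ∀ n a b → φ n (a ⊠ b) ≈ φ n a ⊠ φ n b
    φ-⊟    : ∀ n a → φ n (⊟ a) ≈ ⊟ φ n a
    φ-T    : ∀ n x → φ n (T x) ≈ T (x ↑ᶠ n)
    generated    : (Q : Carrier → Set) → (∀ {a b} → a ≈ b → Q a → Q b) → Q 0# → (∀ {a b} → Q a → Q b → Q (a ⊞ b)) →
                   (∀ {a} → Q a → Q (⊟ a)) → (∀ x → Q (T x)) → ∀ a → Q a
    torsion-free : ∀ n {a b} → 0 < n → n · a ≈ n · b → a ≈ b
    ι-injective  : ∀ {m n} → ι m ≈ ι n → m ≡ n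

module MonoidRing {q} (F : FiniteField q) where
  module F = FieldTheory F
  open F using (K)
  open CommRing F.FR using (ι; ι-+; ι-*; ι-neg)
  open ≡-Reasoning

  ⟪_,_⟫ : List (ℤ × K) → (K → ℤ) → ℤ
  ⟪ [] , h ⟫          = pos 0
  ⟪ (m , x) ∷ a , h ⟫ = m ℤ.* h x ℤ.+ ⟪ a , h ⟫

  -- Lists stand for formal sums Σ m [x]; they are compared through all functionals h : F → ℤ extended ℤ-linearly.
  infix 4 _≃_
  record _≃_ (a b : List (ℤ × K)) : Set where
    constructor mk≃
    field at : ∀ h → ⟪ a , h ⟫ ≡ ⟪ b , h ⟫
  open _≃_ public

  ⟪⟫-cong : ∀ a {h g} → (∀ x → h x ≡ g x) → ⟪ a , h ⟫ ≡ ⟪ a , g ⟫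
  ⟪⟫-cong []            eq = refl
  ⟪⟫-cong ((m , x) ∷ a) eq = cong₂ (λ u v → m ℤ.* u ℤ.+ v) (eq x) (⟪⟫-cong a eq)

  ⟪⟫-+ : ∀ a h g → ⟪ a , (λ x → h x ℤ.+ g x) ⟫ ≡ ⟪ a , h ⟫ ℤ.+ ⟪ a , g ⟫
  ⟪⟫-+ []            h g = refl
  ⟪⟫-+ ((m , x) ∷ a) h g = trans (cong (λ z → m ℤ.* (h x ℤ.+ g x) ℤ.+ z) (⟪⟫-+ a h g)) (lem m (h x) (g x) ⟪ a , h ⟫ ⟪ a , g ⟫)
    where
    lem : ∀ m x y u v → m ℤ.* (x ℤ.+ y) ℤ.+ (u ℤ.+ v) ≡ (m ℤ.* x ℤ.+ u) ℤ.+ (m ℤ.* y ℤ.+ v)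
    lem = solveℤ

  ⟪⟫-* : ∀ a n h → ⟪ a , (λ x → n ℤ.* h x) ⟫ ≡ n ℤ.* ⟪ a , h ⟫
  ⟪⟫-* []            n h = sym (ℤ.*-zeroʳ n)
  ⟪⟫-* ((m , x) ∷ a) n h = trans (cong (λ z → m ℤ.* (n ℤ.* h x) ℤ.+ z) (⟪⟫-* a n h)) (lem m n (h x) ⟪ a , h ⟫)
    where
    lem : ∀ m n x u → m ℤ.* (n ℤ.* x) ℤ.+ n ℤ.* u ≡ n ℤ.* (m ℤ.* x ℤ.+ u)
    lem = solveℤ

  ⟪⟫-0 : ∀ a → ⟪ a , (λ _ → pos 0) ⟫ ≡ pos 0
  ⟪⟫-0 []            = refl
  ⟪⟫-0 ((m , x) ∷ a) = cong₂ ℤ._+_ (ℤ.*-zeroʳ m) (⟪⟫-0 a)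

  ⟪⟫-++ : ∀ a b h → ⟪ a ++ b , h ⟫ ≡ ⟪ a , h ⟫ ℤ.+ ⟪ b , h ⟫
  ⟪⟫-++ []            b h = sym (ℤ.+-identityˡ _)
  ⟪⟫-++ ((m , x) ∷ a) b h = trans (cong (λ z → m ℤ.* h x ℤ.+ z) (⟪⟫-++ a b h)) (sym (ℤ.+-assoc (m ℤ.* h x) ⟪ a , h ⟫ ⟪ b , h ⟫))

  ⟪⟫-swap : ∀ a b (H : K → K → ℤ) → ⟪ a , (λ x → ⟪ b , H x ⟫) ⟫ ≡ ⟪ b , (λ y → ⟪ a , (λ x → H x y) ⟫) ⟫
  ⟪⟫-swap []            b H = sym (⟪⟫-0 b)
  ⟪⟫-swap ((m , x) ∷ a) b H = begin
    m ℤ.* ⟪ b , H x ⟫ ℤ.+ ⟪ a , (λ x → ⟪ b , H x ⟫) ⟫  ≡⟨ cong₂ ℤ._+_ (sym (⟪⟫-* b m (H x))) (⟪⟫-swap a b H) ⟩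
    ⟪ b , (λ y → m ℤ.* H x y) ⟫ ℤ.+ ⟪ b , (λ y → ⟪ a , (λ x → H x y) ⟫) ⟫  ≡⟨ ⟪⟫-+ b _ _ ⟨
    ⟪ b , (λ y → m ℤ.* H x y ℤ.+ ⟪ a , (λ x → H x y) ⟫) ⟫ ∎

  neg : List (ℤ × K) → List (ℤ × K)
  neg = List.map (λ (m , x) → ℤ.- m , x)

  ⟪⟫-neg : ∀ a h → ⟪ neg a , h ⟫ ≡ ℤ.- ⟪ a , h ⟫
  ⟪⟫-neg []            h = refl
  ⟪⟫-neg ((m , x) ∷ a) h = trans (cong (λ z → ℤ.- m ℤ.* h x ℤ.+ z) (⟪⟫-neg a h)) (lem m (h x) ⟪ a , h ⟫)
    where
    lem : ∀ m x u → ℤ.- m ℤ.* x ℤ.+ ℤ.- u ≡ ℤ.- (m ℤ.* x ℤ.+ u)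
    lem = solveℤ

  scale : ℤ → K → List (ℤ × K) → List (ℤ × K)
  scale m x = List.map (λ (n , y) → m ℤ.* n , x F.⊠ y)

  _⊛_ : List (ℤ × K) → List (ℤ × K) → List (ℤ × K)
  []            ⊛ b = []
  ((m , x) ∷ a) ⊛ b = scale m x b ++ a ⊛ b

  ⟪⟫-scale : ∀ m x b h → ⟪ scale m x b , h ⟫ ≡ m ℤ.* ⟪ b , (λ y → h (x F.⊠ y)) ⟫
  ⟪⟫-scale m x []            h = sym (ℤ.*-zeroʳ m)
  ⟪⟫-scale m x ((n , y) ∷ b) h = trans (cong (λ z → m ℤ.* n ℤ.* h (x F.⊠ y) ℤ.+ z) (⟪⟫-scale m x b h)) (lem m n (h (x F.⊠ y)) _)
    where
    lem : ∀ m n u v → m ℤ.* n ℤ.* u ℤ.+ m ℤ.* v ≡ m ℤ.* (n ℤ.* u ℤ.+ v)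
    lem = solveℤ

  -- Turns a product into an iterated pairing, so that the ring laws of `⊛` become laws of F under
  -- h, together with the exchange of two pairings.
  ⟪⟫-⊛ : ∀ a b h → ⟪ a ⊛ b , h ⟫ ≡ ⟪ a , (λ x → ⟪ b , (λ y → h (x F.⊠ y)) ⟫) ⟫
  ⟪⟫-⊛ []            b h = refl
  ⟪⟫-⊛ ((m , x) ∷ a) b h = trans (⟪⟫-++ (scale m x b) (a ⊛ b) h) (cong₂ ℤ._+_ (⟪⟫-scale m x b h) (⟪⟫-⊛ a b h))

  one : List (ℤ × K)
  one = (pos 1 , F.1#) ∷ []

  ≃-isEquivalence : IsEquivalence _≃_
  ≃-isEquivalence = record
    { refl  = mk≃ (λ h → refl)
    ; sym   = λ e → mk≃ (λ h → sym (at e h))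
    ; trans = λ e f → mk≃ (λ h → trans (at e h) (at f h))
    }

  ++-cong : ∀ {a a′ b b′} → a ≃ a′ → b ≃ b′ → a ++ b ≃ a′ ++ b′
  ++-cong {a} {a′} {b} {b′} e f = mk≃ λ h → trans (⟪⟫-++ a b h) (trans (cong₂ ℤ._+_ (at e h) (at f h)) (sym (⟪⟫-++ a′ b′ h)))

  ⊛-cong : ∀ {a a′ b b′} → a ≃ a′ → b ≃ b′ → a ⊛ b ≃ a′ ⊛ b′
  ⊛-cong {a} {a′} {b} {b′} e f = mk≃ λ h → begin
    ⟪ a ⊛ b , h ⟫  ≡⟨ ⟪⟫-⊛ a b h ⟩
    ⟪ a , (λ x → ⟪ b , (λ y → h (x F.⊠ y)) ⟫) ⟫  ≡⟨ at e _ ⟩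
    ⟪ a′ , (λ x → ⟪ b , (λ y → h (x F.⊠ y)) ⟫) ⟫  ≡⟨ ⟪⟫-cong a′ (λ x → at f _) ⟩
    ⟪ a′ , (λ x → ⟪ b′ , (λ y → h (x F.⊠ y)) ⟫) ⟫  ≡⟨ ⟪⟫-⊛ a′ b′ h ⟨
    ⟪ a′ ⊛ b′ , h ⟫ ∎

  ⊛-comm : ∀ a b → a ⊛ b ≃ b ⊛ a
  ⊛-comm a b = mk≃ λ h → begin
    ⟪ a ⊛ b , h ⟫  ≡⟨ ⟪⟫-⊛ a b h ⟩
    ⟪ a , (λ x → ⟪ b , (λ y → h (x F.⊠ y)) ⟫) ⟫  ≡⟨ ⟪⟫-swap a b _ ⟩
    ⟪ b , (λ y → ⟪ a , (λ x → h (x F.⊠ y)) ⟫) ⟫  ≡⟨ ⟪⟫-cong b (λ y → ⟪⟫-cong a (λ x → cong h (F.*-comm x y))) ⟩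
    ⟪ b , (λ y → ⟪ a , (λ x → h (y F.⊠ x)) ⟫) ⟫  ≡⟨ ⟪⟫-⊛ b a h ⟨
    ⟪ b ⊛ a , h ⟫ ∎

  ⊛-assoc : ∀ a b c → (a ⊛ b) ⊛ c ≃ a ⊛ (b ⊛ c)
  ⊛-assoc a b c = mk≃ λ h → begin
    ⟪ (a ⊛ b) ⊛ c , h ⟫  ≡⟨ trans (⟪⟫-⊛ (a ⊛ b) c h) (⟪⟫-⊛ a b _) ⟩
    ⟪ a , (λ x → ⟪ b , (λ y → ⟪ c , (λ z → h ((x F.⊠ y) F.⊠ z)) ⟫) ⟫) ⟫  ≡⟨ ⟪⟫-cong a (λ x → ⟪⟫-cong b (λ y → ⟪⟫-cong c (λ z → cong h (F.*-assoc x y z)))) ⟩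
    ⟪ a , (λ x → ⟪ b , (λ y → ⟪ c , (λ z → h (x F.⊠ (y F.⊠ z))) ⟫) ⟫) ⟫  ≡⟨ ⟪⟫-cong a (λ x → ⟪⟫-⊛ b c _) ⟨
    ⟪ a , (λ x → ⟪ b ⊛ c , (λ y → h (x F.⊠ y)) ⟫) ⟫  ≡⟨ ⟪⟫-⊛ a (b ⊛ c) h ⟨
    ⟪ a ⊛ (b ⊛ c) , h ⟫ ∎

  ⊛-identityˡ : ∀ a → one ⊛ a ≃ a
  ⊛-identityˡ a = mk≃ λ h → begin
    ⟪ one ⊛ a , h ⟫  ≡⟨ ⟪⟫-⊛ one a h ⟩
    pos 1 ℤ.* ⟪ a , (λ y → h (F.1# F.⊠ y)) ⟫ ℤ.+ pos 0  ≡⟨ trans (ℤ.+-identityʳ _) (ℤ.*-identityˡ _) ⟩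
    ⟪ a , (λ y → h (F.1# F.⊠ y)) ⟫  ≡⟨ ⟪⟫-cong a (λ y → cong h (F.*-identityˡ y)) ⟩
    ⟪ a , h ⟫ ∎

  ⊛-distribʳ : ∀ c a b → (a ++ b) ⊛ c ≃ a ⊛ c ++ b ⊛ c
  ⊛-distribʳ c a b = mk≃ λ h → begin
    ⟪ (a ++ b) ⊛ c , h ⟫  ≡⟨ trans (⟪⟫-⊛ (a ++ b) c h) (⟪⟫-++ a b _) ⟩
    ⟪ a , _ ⟫ ℤ.+ ⟪ b , _ ⟫  ≡⟨ cong₂ ℤ._+_ (⟪⟫-⊛ a c h) (⟪⟫-⊛ b c h) ⟨
    ⟪ a ⊛ c , h ⟫ ℤ.+ ⟪ b ⊛ c , h ⟫  ≡⟨ ⟪⟫-++ (a ⊛ c) (b ⊛ c) h ⟨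
    ⟪ a ⊛ c ++ b ⊛ c , h ⟫ ∎

  open IsEquivalence ≃-isEquivalence using () renaming (trans to ≃-trans; refl to ≃-refl)

  monoidRing : CommutativeRing 0ℓ 0ℓ
  monoidRing = record
    { Carrier = List (ℤ × K) ; _≈_ = _≃_ ; _+_ = _++_ ; _*_ = _⊛_ ; -_ = neg ; 0# = [] ; 1# = one
    ; isCommutativeRing = record
      { isRing = record
        { +-isAbelianGroup = record
          { isGroup = record
            { isMonoid = record
              { isSemigroup = record
                { isMagma = record { isEquivalence = ≃-isEquivalence ; ∙-cong = ++-cong }
                ; assoc = λ a b c → mk≃ λ h → trans (trans (⟪⟫-++ (a ++ b) c h) (cong (λ z → z ℤ.+ _) (⟪⟫-++ a b h)))
                    (trans (ℤ.+-assoc ⟪ a , h ⟫ ⟪ b , h ⟫ ⟪ c , h ⟫) (sym (trans (⟪⟫-++ a (b ++ c) h) (cong (λ z → ⟪ a , h ⟫ ℤ.+ z) (⟪⟫-++ b c h)))))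
                }
              ; identity = (λ a → mk≃ λ h → refl) , (λ a → mk≃ λ h → trans (⟪⟫-++ a [] h) (ℤ.+-identityʳ _))
              }
            ; inverse = (λ a → mk≃ λ h → trans (⟪⟫-++ (neg a) a h) (trans (cong (λ z → z ℤ.+ ⟪ a , h ⟫) (⟪⟫-neg a h)) (ℤ.+-inverseˡ ⟪ a , h ⟫)))
                      , (λ a → mk≃ λ h → trans (⟪⟫-++ a (neg a) h) (trans (cong (λ z → ⟪ a , h ⟫ ℤ.+ z) (⟪⟫-neg a h)) (ℤ.+-inverseʳ ⟪ a , h ⟫)))
            ; ⁻¹-cong = λ {a} {b} e → mk≃ λ h → trans (⟪⟫-neg a h) (trans (cong ℤ.-_ (at e h)) (sym (⟪⟫-neg b h)))
            }
          ; comm = λ a b → mk≃ λ h → trans (⟪⟫-++ a b h) (trans (ℤ.+-comm ⟪ a , h ⟫ ⟪ b , h ⟫) (sym (⟪⟫-++ b a h)))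
          }
        ; *-cong = ⊛-cong
        ; *-assoc = ⊛-assoc
        ; *-identity = ⊛-identityˡ , (λ a → ≃-trans (⊛-comm a one) (⊛-identityˡ a))
        ; distrib = (λ c a b → ≃-trans (⊛-comm c (a ++ b)) (≃-trans (⊛-distribʳ c a b) (++-cong (⊛-comm a c) (⊛-comm b c)))) , ⊛-distribʳ
        }
      ; *-comm = ⊛-comm
      }
    }

  ε : List (ℤ × K) → K
  ε []            = F.0#
  ε ((m , x) ∷ a) = ι m F.⊠ x F.⊞ ε a

  ε-++ : ∀ a b → ε (a ++ b) ≡ ε a F.⊞ ε b
  ε-++ []            b = sym (F.+-identityˡ _)
  ε-++ ((m , x) ∷ a) b = trans (cong (ι m F.⊠ x F.⊞_) (ε-++ a b)) (sym (F.+-assoc _ _ _))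

  ε-scale : ∀ m x b → ε (scale m x b) ≡ (ι m F.⊠ x) F.⊠ ε b
  ε-scale m x []            = sym (F.zeroʳ _)
  ε-scale m x ((n , y) ∷ b) = trans (cong₂ (λ u v → u F.⊠ (x F.⊠ y) F.⊞ v) (ι-* m n) (ε-scale m x b))
    (F.FS.solve 5 (λ m n x y e → (m F.FS.:* n) F.FS.:* (x F.FS.:* y) F.FS.:+ (m F.FS.:* x) F.FS.:* e F.FS.:= (m F.FS.:* x) F.FS.:* (n F.FS.:* y F.FS.:+ e))
      refl (ι m) (ι n) x y (ε b))

  ε-⊛ : ∀ a b → ε (a ⊛ b) ≡ ε a F.⊠ ε b
  ε-⊛ []            b = sym (F.zeroˡ _)
  ε-⊛ ((m , x) ∷ a) b = trans (ε-++ (scale m x b) (a ⊛ b)) (trans (cong₂ F._⊞_ (ε-scale m x b) (ε-⊛ a b)) (sym (F.distribʳ _ _ _)))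

  private
    module ΣK = F.Sum F.+-commutativeMonoid

    δ : K → K → ℤ
    δ z x = pos (indicator (x F.≟ z))

    -- The relation `≃` speaks of functionals with values in ℤ, whereas `ε` takes values in F. The
    -- coefficients ⟪ a , δ z ⟫ bridge the gap: `ε` depends on a only through them.
    ε-coefficients : ∀ a → ε a ≡ ΣK.∑ (λ z → ι ⟪ a , δ z ⟫ F.⊠ z)
    ε-coefficients [] = sym (trans (ΣK.∑-cong (λ z → F.zeroˡ z)) (trans (ΣK.∑-single (λ _ → F.0#) F.0# (λ _ _ → refl)) refl))
    ε-coefficients ((m , x) ∷ a) = begin
      ι m F.⊠ x F.⊞ ε a  ≡⟨ cong₂ F._⊞_ (sym single) (ε-coefficients a) ⟩
      ΣK.∑ (λ z → ι (m ℤ.* δ z x) F.⊠ z) F.⊞ ΣK.∑ (λ z → ι ⟪ a , δ z ⟫ F.⊠ z)  ≡⟨ ΣK.∑-+ (λ z → ι (m ℤ.* δ z x) F.⊠ z) (λ z → ι ⟪ a , δ z ⟫ F.⊠ z) ⟨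
      ΣK.∑ (λ z → ι (m ℤ.* δ z x) F.⊠ z F.⊞ ι ⟪ a , δ z ⟫ F.⊠ z)  ≡⟨ ΣK.∑-cong (λ z → trans (cong (F._⊠ z) (ι-+ (m ℤ.* δ z x) ⟪ a , δ z ⟫)) (F.distribʳ z (ι (m ℤ.* δ z x)) (ι ⟪ a , δ z ⟫))) ⟨
      ΣK.∑ (λ z → ι ⟪ (m , x) ∷ a , δ z ⟫ F.⊠ z) ∎
      where
      off : ∀ z → z ≢ x → ι (m ℤ.* δ z x) F.⊠ z ≡ F.0#
      off z z≢x = trans (cong (λ k → ι (m ℤ.* pos k) F.⊠ z) (indicator-no (x F.≟ z) (z≢x ∘ sym)))
        (trans (cong (λ k → ι k F.⊠ z) (ℤ.*-zeroʳ m)) (F.zeroˡ z))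
      single : ΣK.∑ (λ z → ι (m ℤ.* δ z x) F.⊠ z) ≡ ι m F.⊠ x
      single = trans (ΣK.∑-single _ x off) (trans (cong (λ k → ι (m ℤ.* pos k) F.⊠ x) (indicator-yes (x F.≟ x) refl))
        (cong (λ k → ι k F.⊠ x) (ℤ.*-identityʳ m)))

  ε-cong : ∀ {a b} → a ≃ b → ε a ≡ ε b
  ε-cong {a} {b} e = trans (ε-coefficients a) (trans (ΣK.∑-cong (λ z → cong (λ k → ι k F.⊠ z) (at e (δ z)))) (sym (ε-coefficients b)))


  T : K → List (ℤ × K)
  T x = (pos 1 , x) ∷ []

  T-* : ∀ x y → T (x F.⊠ y) ≃ T x ⊛ T y
  T-* x y = ≃-refl

  ε-T : ∀ x → ε (T x) ≡ x
  ε-T x = trans (F.+-identityʳ _) (trans (cong (F._⊠ x) (F.+-identityʳ _)) (F.*-identityˡ x))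

  open CommRing monoidRing using (_·_) renaming (ι to ι′)

  ⟪⟫-· : ∀ n a h → ⟪ n · a , h ⟫ ≡ pos n ℤ.* ⟪ a , h ⟫
  ⟪⟫-· zero    a h = refl
  ⟪⟫-· (suc n) a h = trans (⟪⟫-++ a (n · a) h) (trans (cong (λ z → ⟪ a , h ⟫ ℤ.+ z) (⟪⟫-· n a h)) (lem (pos n) ⟪ a , h ⟫))
    where
    lem : ∀ n u → u ℤ.+ n ℤ.* u ≡ (pos 1 ℤ.+ n) ℤ.* u
    lem = solveℤ

  φ : ℕ → List (ℤ × K) → List (ℤ × K)
  φ n = List.map (λ (m , x) → m , x F.↑ n)

  ⟪⟫-φ : ∀ n a h → ⟪ φ n a , h ⟫ ≡ ⟪ a , (λ x → h (x F.↑ n)) ⟫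
  ⟪⟫-φ n []            h = refl
  ⟪⟫-φ n ((m , x) ∷ a) h = cong (λ z → m ℤ.* h (x F.↑ n) ℤ.+ z) (⟪⟫-φ n a h)

  φ-cong : ∀ n {a b} → a ≃ b → φ n a ≃ φ n b
  φ-cong n {a} {b} e = mk≃ λ h → trans (⟪⟫-φ n a h) (trans (at e _) (sym (⟪⟫-φ n b h)))

  φ-⊞ : ∀ n a b → φ n (a ++ b) ≃ φ n a ++ φ n b
  φ-⊞ n a b = mk≃ λ h → trans (⟪⟫-φ n (a ++ b) h) (trans (⟪⟫-++ a b _) (trans (sym (cong₂ ℤ._+_ (⟪⟫-φ n a h) (⟪⟫-φ n b h))) (sym (⟪⟫-++ (φ n a) (φ n b) h))))

  φ-⊟ : ∀ n a → φ n (neg a) ≃ neg (φ n a)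
  φ-⊟ n a = mk≃ λ h → trans (⟪⟫-φ n (neg a) h) (trans (⟪⟫-neg a _) (trans (cong ℤ.-_ (sym (⟪⟫-φ n a h))) (sym (⟪⟫-neg (φ n a) h))))

  φ-⊠ : ∀ n a b → φ n (a ⊛ b) ≃ φ n a ⊛ φ n b
  φ-⊠ n a b = mk≃ λ h → begin
    ⟪ φ n (a ⊛ b) , h ⟫  ≡⟨ trans (⟪⟫-φ n (a ⊛ b) h) (⟪⟫-⊛ a b _) ⟩
    ⟪ a , (λ x → ⟪ b , (λ y → h ((x F.⊠ y) F.↑ n)) ⟫) ⟫  ≡⟨ ⟪⟫-cong a (λ x → ⟪⟫-cong b (λ y → cong h (F.^-distrib-* x y n))) ⟩
    ⟪ a , (λ x → ⟪ b , (λ y → h (x F.↑ n F.⊠ y F.↑ n)) ⟫) ⟫  ≡⟨ ⟪⟫-cong a (λ x → ⟪⟫-φ n b _) ⟨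
    ⟪ a , (λ x → ⟪ φ n b , (λ y → h (x F.↑ n F.⊠ y)) ⟫) ⟫  ≡⟨ ⟪⟫-φ n a _ ⟨
    ⟪ φ n a , (λ x → ⟪ φ n b , (λ y → h (x F.⊠ y)) ⟫) ⟫  ≡⟨ ⟪⟫-⊛ (φ n a) (φ n b) h ⟨
    ⟪ φ n a ⊛ φ n b , h ⟫ ∎

  generated : (Q : List (ℤ × K) → Set) → (∀ {a b} → a ≃ b → Q a → Q b) → Q [] → (∀ {a b} → Q a → Q b → Q (a ++ b)) →
              (∀ {a} → Q a → Q (neg a)) → (∀ x → Q (T x)) → ∀ a → Q a
  generated Q Q-resp Q-0 Q-+ Q-neg Q-T [] = Q-0
  generated Q Q-resp Q-0 Q-+ Q-neg Q-T ((m , x) ∷ a) =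
    Q-resp (mk≃ λ h → trans (⟪⟫-++ (monomial m) a h) (cong (λ z → z ℤ.+ ⟪ a , h ⟫) (⟪⟫-monomial m h)))
      (Q-+ (Q-monomial m) (generated Q Q-resp Q-0 Q-+ Q-neg Q-T a))
    where
    -- m [x] is rebuilt from `T x` by zero, addition and negation, the operations under which `Q` is
    -- closed.
    monomial : ℤ → List (ℤ × K)
    monomial (pos n)  = n · T x
    monomial -[1+ n ] = neg (suc n · T x)
    Q-· : ∀ n → Q (n · T x)
    Q-· zero    = Q-0
    Q-· (suc n) = Q-+ (Q-T x) (Q-· n)
    Q-monomial : ∀ m → Q (monomial m)
    Q-monomial (pos n)  = Q-· n
    Q-monomial -[1+ n ] = Q-neg (Q-· (suc n))
    lem : ∀ n u → n ℤ.* (pos 1 ℤ.* u ℤ.+ pos 0) ≡ n ℤ.* u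
    lem = solveℤ
    ⟪⟫-monomial : ∀ m h → ⟪ monomial m , h ⟫ ≡ m ℤ.* h x
    ⟪⟫-monomial (pos n)  h = trans (⟪⟫-· n (T x) h) (lem (pos n) (h x))
    ⟪⟫-monomial -[1+ n ] h = trans (⟪⟫-neg (suc n · T x) h) (trans (cong ℤ.-_ (trans (⟪⟫-· (suc n) (T x) h) (lem (pos (suc n)) (h x)))) (ℤ.neg-distribˡ-* (pos (suc n)) (h x)))

  torsion-free : ∀ n {a b} → 0 < n → n · a ≃ n · b → a ≃ b
  torsion-free (suc n) {a} {b} _ e = mk≃ λ h → ℤ.*-cancelˡ-≡ (pos (suc n)) _ _ (trans (sym (⟪⟫-· (suc n) a h)) (trans (at e h) (⟪⟫-· (suc n) b h)))

  private
    ⟪⟫-ι : ∀ m → ⟪ ι′ m , (λ _ → pos 1) ⟫ ≡ m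
    ⟪⟫-ι (pos n)  = trans (⟪⟫-· n one (λ _ → pos 1)) (ℤ.*-identityʳ (pos n))
    ⟪⟫-ι -[1+ n ] = trans (⟪⟫-neg (suc n · one) (λ _ → pos 1)) (cong ℤ.-_ (trans (⟪⟫-· (suc n) one (λ _ → pos 1)) (ℤ.*-identityʳ (pos (suc n)))))

  multiplicativeLift : MultiplicativeLift F
  multiplicativeLift = record
    { R = monoidRing ; ε = ε ; ε-cong = ε-cong ; ε-⊞ = ε-++ ; ε-⊠ = ε-⊛ ; T = T ; T-* = T-* ; T-1 = ≃-refl ; ε-T = ε-T
    ; φ = φ ; φ-cong = φ-cong ; φ-⊞ = φ-⊞ ; φ-⊠ = φ-⊠ ; φ-⊟ = φ-⊟ ; φ-T = λ n x → ≃-refl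
    ; generated = generated ; torsion-free = torsion-free
    ; ι-injective = λ {m} {n} e → trans (sym (⟪⟫-ι m)) (trans (at e (λ _ → pos 1)) (⟪⟫-ι n))
    }

-- For q = pᵏ this plays the role of the Witt vectors of length k over F.
record Teichmüller {q} (F : FiniteField q) (p k : ℕ) : Set₁ where
  open FieldTheory F using (K) renaming (_⊞_ to _⊞ᶠ_; _⊠_ to _⊠ᶠ_; 0# to 0ᶠ; 1# to 1ᶠ)
  field B : CommutativeRing 0ℓ 0ℓ
  open CommRing B
  field
    T        : K → Carrier
    T-*      : ∀ x y → T (x ⊠ᶠ y) ≈ T x ⊠ T y
    T-1      : T 1ᶠ ≈ 1#
    T-0      : T 0ᶠ ≈ 0#
    ε        : Carrier → K
    ε-⊞      : ∀ a b → ε (a ⊞ b) ≡ ε a ⊞ᶠ ε b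
    ε-T      : ∀ x → ε (T x) ≡ x
    ε-approx : ∀ {a b} → ε a ≡ ε b → a ↑ (p ^ (k ∸ 1)) ≈ b ↑ (p ^ (k ∸ 1))
    p^k·     : ∀ b → (p ^ k) · b ≈ 0#
    cancel   : ∀ {x b} → x ≢ 1ᶠ → (1# ⊞ ⊟ T x) ⊠ b ≈ 0# → b ≈ 0#
    faithful : ∀ m n → m · 1# ≈ n · 1# → p ^ k ∣ ℕ.∣ m - n ∣

-- Powers of the ideal I = ker ε and the quotient by Iᵏ.

module IdealPowers {q} (F : FiniteField q) (L : MultiplicativeLift F) where
  module F = FieldTheory F
  open F using (K)
  open MultiplicativeLift L
  open CommRing R
  open ≡-Reasoning
  open import Relation.Binary.Reasoning.Setoid setoid using (step-≈-⟩; step-≈-⟨) renaming (begin_ to begin≈_; _∎ to _∎≈)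

  T-↑ : ∀ x n → T (x F.↑ n) ≈ T x ↑ n
  T-↑ x zero    = T-1
  T-↑ x (suc n) = ≈-trans (T-* x (x F.↑ n)) (*-congˡ {T x} (T-↑ x n))

  ε-0 : ε 0# ≡ F.0#
  ε-0 = begin
    ε 0#  ≡⟨ F.FS.solve 1 (λ x → x F.FS.:= (x F.FS.:+ x) F.FS.:- x) refl (ε 0#) ⟩
    (ε 0# F.⊞ ε 0#) F.⊞ F.⊟ ε 0#  ≡⟨ cong (F._⊞ F.⊟ ε 0#) (ε-⊞ 0# 0#) ⟨
    ε (0# ⊞ 0#) F.⊞ F.⊟ ε 0#  ≡⟨ cong (F._⊞ F.⊟ ε 0#) (ε-cong (+-identityʳ 0#)) ⟩
    ε 0# F.⊞ F.⊟ ε 0#  ≡⟨ F.-‿inverseʳ _ ⟩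
    F.0# ∎

  module Powers (p : ℕ) (pr : Prime p) (p·1≡0 : p F.· F.1# ≡ F.0#) where
    open F.Characteristic p pr p·1≡0

    φ-0 : φ p 0# ≈ 0#
    φ-0 = begin≈
      φ p 0#  ≈⟨ φ-cong p (-‿inverseʳ 0#) ⟨
      φ p (0# ⊞ ⊟ 0#)  ≈⟨ φ-⊞ p 0# (⊟ 0#) ⟩
      φ p 0# ⊞ φ p (⊟ 0#)  ≈⟨ +-congˡ (φ-⊟ p 0#) ⟩
      φ p 0# ⊞ ⊟ φ p 0#  ≈⟨ -‿inverseʳ _ ⟩
      0# ∎≈

    data IPow : ℕ → Carrier → Set where
      all  : ∀ {a} → IPow 0 a
      prod : ∀ {j a b c} → ε a ≡ F.0# → IPow j b → c ≈ a ⊠ b → IPow (suc j) c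
      add  : ∀ {j a b c} → IPow (suc j) a → IPow (suc j) b → c ≈ a ⊞ b → IPow (suc j) c

    IPow-resp : ∀ {j a b} → a ≈ b → IPow j a → IPow j b
    IPow-resp e all           = all
    IPow-resp e (prod z i e′) = prod z i (≈-trans (≈-sym e) e′)
    IPow-resp e (add i i′ e′) = add i i′ (≈-trans (≈-sym e) e′)

    IPow-0 : ∀ j → IPow j 0#
    IPow-0 zero    = all
    IPow-0 (suc j) = prod {a = 0#} {b = 0#} ε-0 (IPow-0 j) (≈-sym (zeroˡ 0#))

    IPow-+ : ∀ {j a b} → IPow j a → IPow j b → IPow j (a ⊞ b)
    IPow-+ {zero}  i i′ = all
    IPow-+ {suc j} i i′ = add i i′ ≈-refl

    IPow-* : ∀ {j a} b → IPow j a → IPow j (b ⊠ a)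
    IPow-* b all = all
    IPow-* b (prod {a = x} {b = y} z i e) = prod {a = b ⊠ x} (trans (ε-⊠ b x) (trans (cong (ε b F.⊠_) z) (F.zeroʳ _))) i
      (≈-trans (*-congˡ {b} e) (≈-sym (*-assoc b x y)))
    IPow-* b (add {a = x} {b = y} i i′ e) = add (IPow-* b i) (IPow-* b i′) (≈-trans (*-congˡ {b} e) (distribˡ b x y))

    IPow-neg : ∀ {j a} → IPow j a → IPow j (⊟ a)
    IPow-neg {a = a} i = IPow-resp (solve 1 (λ a → (:- con (pos 1)) :* a := :- a) ≈-refl a) (IPow-* (⊟ (1 · 1#)) i)
      where open Solver

    IPow-ε : ∀ {a} → ε a ≡ F.0# → IPow 1 a
    IPow-ε {a} z = prod {b = 1#} z all (≈-sym (*-identityʳ a))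

    ε-IPow : ∀ {j a} → IPow (suc j) a → ε a ≡ F.0#
    ε-IPow (prod {a = x} {b = y} z i e) = trans (ε-cong e) (trans (ε-⊠ x y) (trans (cong (F._⊠ ε y) z) (F.zeroˡ _)))
    ε-IPow (add {a = x} {b = y} i i′ e) = trans (ε-cong e) (trans (ε-⊞ x y) (trans (cong₂ F._⊞_ (ε-IPow i) (ε-IPow i′)) (F.+-identityʳ _)))

    IPow-pred : ∀ {j a} → IPow (suc j) a → IPow j a
    IPow-pred {zero}  i             = all
    IPow-pred {suc j} (prod z i e)  = prod z (IPow-pred i) e
    IPow-pred {suc j} (add i i′ e)  = add (IPow-pred i) (IPow-pred i′) e

    IPow-prod : ∀ {i j a b} → IPow i a → IPow j b → IPow (i + j) (a ⊠ b)
    IPow-prod {a = a} all h′ = IPow-* a h′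
    IPow-prod {b = b} (prod {a = x} {b = y} z h e) h′ = prod z (IPow-prod h h′) (≈-trans (*-congʳ {b} e) (*-assoc x y b))
    IPow-prod {b = b} (add {a = x} {b = y} h h′ e) h″ = add (IPow-prod h h″) (IPow-prod h′ h″) (≈-trans (*-congʳ {b} e) (distribʳ b x y))

    ε-· : ∀ n a → ε (n · a) ≡ n F.· ε a
    ε-· zero    a = ε-0
    ε-· (suc n) a = trans (ε-⊞ a (n · a)) (cong (ε a F.⊞_) (ε-· n a))

    P : Carrier
    P = p · 1#

    P⊠ : ∀ a → p · a ≈ P ⊠ a
    P⊠ a = ≈-sym (≈-trans (×-assoc-* p 1# a) (×-congʳ p (*-identityˡ a)))

    IPow-P : IPow 1 P
    IPow-P = IPow-ε (trans (ε-· p 1#) (p·≡0 _))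

    expand : ∀ {j} a b → IPow j b → ∃[ c ] (IPow j c × (a ⊞ b) ↑ p ≈ (a ↑ p ⊞ b ↑ p) ⊞ P ⊠ c)
    expand a b i = let c , ic , e = frobenius-expansion (IPow _) (IPow-0 _) IPow-+ pr a b term in
      c , ic , ≈-trans e (+-congˡ {a ↑ p ⊞ b ↑ p} (P⊠ c))
      where
      open Solver
      term : ∀ k l → suc k + suc l ≡ p → IPow _ (a ↑ suc k ⊠ b ↑ suc l)
      term k l _ = IPow-resp (solve 3 (λ a b c → (a :* c) :* b := a :* (b :* c)) ≈-refl (a ↑ suc k) b (b ↑ l)) (IPow-* (a ↑ suc k ⊠ b ↑ l) i)

    -- Sum rule of δ a = (φ a - aᵖ)/p: it is additive up to the element c with p c = (a + b)ᵖ - aᵖ -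
    -- bᵖ.
    φ-⊞-expand : ∀ a b {x y c} → φ p a ≈ a ↑ p ⊞ P ⊠ x → φ p b ≈ b ↑ p ⊞ P ⊠ y → (a ⊞ b) ↑ p ≈ (a ↑ p ⊞ b ↑ p) ⊞ P ⊠ c →
      φ p (a ⊞ b) ≈ (a ⊞ b) ↑ p ⊞ P ⊠ ((x ⊞ y) ⊞ ⊟ c)
    φ-⊞-expand a b {x} {y} {c} e f g = begin≈
      φ p (a ⊞ b)  ≈⟨ φ-⊞ p a b ⟩
      φ p a ⊞ φ p b  ≈⟨ +-cong e f ⟩
      (a ↑ p ⊞ P ⊠ x) ⊞ (b ↑ p ⊞ P ⊠ y)  ≈⟨ solve 6 (λ a b P x y c → (a :+ P :* x) :+ (b :+ P :* y) := ((a :+ b) :+ P :* c) :+ P :* ((x :+ y) :+ :- c)) ≈-refl (a ↑ p) (b ↑ p) P x y c ⟩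
      ((a ↑ p ⊞ b ↑ p) ⊞ P ⊠ c) ⊞ P ⊠ ((x ⊞ y) ⊞ ⊟ c)  ≈⟨ +-congʳ g ⟨
      (a ⊞ b) ↑ p ⊞ P ⊠ ((x ⊞ y) ⊞ ⊟ c) ∎≈
      where open Solver

    -- Product rule δ(xy) = δ(x) φ(y) + xᵖ δ(y). For x in I and y in Iʲ⁺¹ both summands lie in Iʲ⁺¹:
    -- φ preserves the powers of I, and xᵖ ∈ I makes up for the order that δ(y) loses.
    φ-⊠-expand : ∀ x y {u v} → φ p x ≈ x ↑ p ⊞ P ⊠ u → φ p y ≈ y ↑ p ⊞ P ⊠ v → φ p (x ⊠ y) ≈ (x ⊠ y) ↑ p ⊞ P ⊠ (u ⊠ φ p y ⊞ x ↑ p ⊠ v)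
    φ-⊠-expand x y {u} {v} eu ev = begin≈
      φ p (x ⊠ y)  ≈⟨ φ-⊠ p x y ⟩
      φ p x ⊠ φ p y  ≈⟨ *-congʳ {φ p y} eu ⟩
      (x ↑ p ⊞ P ⊠ u) ⊠ φ p y  ≈⟨ solve 4 (λ x P u y → (x :+ P :* u) :* y := x :* y :+ P :* (u :* y)) ≈-refl (x ↑ p) P u (φ p y) ⟩
      x ↑ p ⊠ φ p y ⊞ P ⊠ (u ⊠ φ p y)  ≈⟨ +-congʳ {P ⊠ (u ⊠ φ p y)} (*-congˡ {x ↑ p} ev) ⟩
      x ↑ p ⊠ (y ↑ p ⊞ P ⊠ v) ⊞ P ⊠ (u ⊠ φ p y)  ≈⟨ solve 5 (λ x y P v w → x :* (y :+ P :* v) :+ P :* w := x :* y :+ P :* (w :+ x :* v)) ≈-refl (x ↑ p) (y ↑ p) P v (u ⊠ φ p y) ⟩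
      x ↑ p ⊠ y ↑ p ⊞ P ⊠ (u ⊠ φ p y ⊞ x ↑ p ⊠ v)  ≈⟨ +-congʳ {P ⊠ (u ⊠ φ p y ⊞ x ↑ p ⊠ v)} (^-distrib-* x y p) ⟨
      (x ⊠ y) ↑ p ⊞ P ⊠ (u ⊠ φ p y ⊞ x ↑ p ⊠ v) ∎≈
      where open Solver

    Lifts : Carrier → Set
    Lifts a = ∃[ b ] φ p a ≈ a ↑ p ⊞ P ⊠ b

    Lifts-resp : ∀ {a b} → a ≈ b → Lifts a → Lifts b
    Lifts-resp e (c , f) = c , ≈-trans (φ-cong p (≈-sym e)) (≈-trans f (+-congʳ {P ⊠ c} (^-congˡ p e)))

    Lifts-⊞ : ∀ {a b} → Lifts a → Lifts b → Lifts (a ⊞ b)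
    Lifts-⊞ {a} {b} (x , e) (y , f) = let c , _ , g = expand {0} a b all in (x ⊞ y) ⊞ ⊟ c , φ-⊞-expand a b e f g

    0↑p : 0# ↑ p ≈ 0#
    0↑p = go p (ℕ.<⇒≤ 1<p)
      where
      go : ∀ n → 0 < n → 0# ↑ n ≈ 0#
      go (suc n) _ = zeroˡ _

    Lifts-⊟ : ∀ {a} → Lifts a → Lifts (⊟ a)
    Lifts-⊟ {a} (x , e) with expand {0} a (⊟ a) all
    ... | c , _ , g = c ⊞ ⊟ x , (begin≈
      φ p (⊟ a)  ≈⟨ φ-⊟ p a ⟩
      ⊟ φ p a  ≈⟨ -‿cong e ⟩
      ⊟ (a ↑ p ⊞ P ⊠ x)  ≈⟨ solve 5 (λ a b P x c → :- (a :+ P :* x) := (b :+ P :* (c :+ :- x)) :+ :- ((a :+ b) :+ P :* c)) ≈-refl (a ↑ p) ((⊟ a) ↑ p) P x c ⟩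
      ((⊟ a) ↑ p ⊞ P ⊠ (c ⊞ ⊟ x)) ⊞ ⊟ ((a ↑ p ⊞ (⊟ a) ↑ p) ⊞ P ⊠ c)
        ≈⟨ +-congˡ {(⊟ a) ↑ p ⊞ P ⊠ (c ⊞ ⊟ x)} (-‿cong (≈-trans (≈-sym g) (≈-trans (^-congˡ p (-‿inverseʳ a)) 0↑p))) ⟩
      ((⊟ a) ↑ p ⊞ P ⊠ (c ⊞ ⊟ x)) ⊞ ⊟ 0#  ≈⟨ ≈-trans (+-congˡ {(⊟ a) ↑ p ⊞ P ⊠ (c ⊞ ⊟ x)} -0#≈0#) (+-identityʳ _) ⟩
      (⊟ a) ↑ p ⊞ P ⊠ (c ⊞ ⊟ x) ∎≈)
      where open Solver

    Lifts-0 : Lifts 0#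
    Lifts-0 = 0# , ≈-trans φ-0 (≈-sym (≈-trans (+-cong 0↑p (zeroʳ P)) (+-identityʳ 0#)))

    Lifts-T : ∀ x → Lifts (T x)
    Lifts-T x = 0# , ≈-trans (φ-T p x) (≈-trans (T-↑ x p) (≈-sym (≈-trans (+-congˡ {T x ↑ p} (zeroʳ P)) (+-identityʳ _))))

    -- φ is the Frobenius map modulo p: on [x] the two sides agree exactly, and both are additive
    -- modulo p.
    lifts : ∀ a → Lifts a
    lifts = generated Lifts Lifts-resp Lifts-0 Lifts-⊞ Lifts-⊟ Lifts-T

    ε-↑ : ∀ a n → ε a ≡ F.0# → 0 < n → ε (a ↑ n) ≡ F.0#
    ε-↑ a (suc n) z _ = trans (ε-⊠ a (a ↑ n)) (trans (cong (F._⊠ ε (a ↑ n)) z) (F.zeroˡ _))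

    ε-φ : ∀ a → ε a ≡ F.0# → ε (φ p a) ≡ F.0#
    ε-φ a z with lifts a
    ... | b , e = begin
      ε (φ p a)  ≡⟨ ε-cong e ⟩
      ε (a ↑ p ⊞ P ⊠ b)  ≡⟨ ε-⊞ (a ↑ p) (P ⊠ b) ⟩
      ε (a ↑ p) F.⊞ ε (P ⊠ b)  ≡⟨ cong₂ F._⊞_ (ε-↑ a p z (ℕ.<⇒≤ 1<p)) (trans (ε-⊠ P b) (trans (cong (F._⊠ ε b) (ε-IPow IPow-P)) (F.zeroˡ _))) ⟩
      F.0# F.⊞ F.0#  ≡⟨ F.+-identityʳ _ ⟩
      F.0# ∎

    IPow-φ : ∀ {j a} → IPow j a → IPow j (φ p a)
    IPow-φ all = all
    IPow-φ (prod {a = x} {b = y} z i e) = prod (ε-φ x z) (IPow-φ i) (≈-trans (φ-cong p e) (φ-⊠ p x y))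
    IPow-φ (add {a = x} {b = y} i i′ e) = add (IPow-φ i) (IPow-φ i′) (≈-trans (φ-cong p e) (φ-⊞ p x y))

    -- The p-derivation a ↦ (φ p a - aᵖ) / p lowers the order of vanishing along the ideal by one.
    derivation : ∀ {j a} → IPow (suc j) a → ∃[ b ] (IPow j b × φ p a ≈ a ↑ p ⊞ P ⊠ b)
    derivation {zero} {a} i = let b , e = lifts a in b , all , e
    derivation {suc j} {a} (prod {a = x} {b = y} z i e) =
      let u , eu = lifts x
          v , iv , ev = derivation i
      in u ⊠ φ p y ⊞ x ↑ p ⊠ v
        , IPow-+ (IPow-* u (IPow-φ i)) (IPow-prod (IPow-ε (ε-↑ x p z (ℕ.<⇒≤ 1<p))) iv)
        , ≈-trans (φ-cong p e) (≈-trans (φ-⊠-expand x y eu ev) (+-congʳ (^-congˡ p (≈-sym e))))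
    derivation {suc j} {a} (add {a = x} {b = y} i i′ e) =
      let u , iu , eu = derivation i
          v , iv , ev = derivation i′
          c , ic , ec = expand x y (IPow-pred i′)
      in (u ⊞ v) ⊞ ⊟ c
        , IPow-+ (IPow-+ iu iv) (IPow-neg ic)
        , ≈-trans (φ-cong p e) (≈-trans (φ-⊞-expand x y eu ev ec) (+-congʳ (^-congˡ p (≈-sym e))))

    ε-1 : ε 1# ≡ F.1#
    ε-1 = trans (ε-cong (≈-sym T-1)) (ε-T F.1#)

    ε-⊟ : ∀ a → ε (⊟ a) ≡ F.⊟ ε a
    ε-⊟ a = begin
      ε (⊟ a)  ≡⟨ F.FS.solve 2 (λ x y → y F.FS.:= (x F.FS.:+ y) F.FS.:- x) refl (ε a) (ε (⊟ a)) ⟩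
      (ε a F.⊞ ε (⊟ a)) F.⊞ F.⊟ ε a  ≡⟨ cong (F._⊞ F.⊟ ε a) (trans (sym (ε-⊞ a (⊟ a))) (trans (ε-cong (-‿inverseʳ a)) ε-0)) ⟩
      F.0# F.⊞ F.⊟ ε a  ≡⟨ F.+-identityˡ _ ⟩
      F.⊟ ε a ∎

    private instance
      p-nonZero = ℕ.>-nonZero (ℕ.<⇒≤ 1<p)

    n·1≡0⇒p∣n : ∀ n → n F.· F.1# ≡ F.0# → p ∣ n
    n·1≡0⇒p∣n n eq with n % p in r
    ... | zero  = m%n≡0⇒n∣m n p r
    ... | suc m = contradiction (sym (Subgroup.divide (_≡ F.0#) (F._≟ F.0#) refl (λ { refl refl → F.+-identityʳ F.0# })
      (s≤s z≤n) (subst (_< p) r (m%n<n n p)) (trans (cong (F._· F.1#) (sym r)) (trans (sym (·-% n F.1#)) eq)))) F.0≢1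

    Divisible : ℕ → ℤ → Set
    Divisible j m = ∃[ c ] m ≡ (pos p ℤ.^ j) ℤ.* c

    ε-ι-zero : ∀ m → ε (ι m) ≡ F.0# → Divisible 1 m
    ε-ι-zero (pos n) eq with n·1≡0⇒p∣n n (trans (cong (n F.·_) (sym ε-1)) (trans (sym (ε-· n 1#)) eq))
    ... | divides c refl = pos c , trans (ℤ.pos-* c p) (trans (ℤ.*-comm (pos c) (pos p)) (cong (ℤ._* pos c) (sym (ℤ.*-identityʳ (pos p)))))
    ε-ι-zero -[1+ n ] eq with ε-ι-zero (pos (suc n)) (begin
        ε (suc n · 1#)  ≡⟨ F.FS.solve 1 (λ x → x F.FS.:= F.FS.:- (F.FS.:- x)) refl _ ⟩
        F.⊟ (F.⊟ ε (suc n · 1#))  ≡⟨ cong F.⊟_ (trans (sym (ε-⊟ (suc n · 1#))) eq) ⟩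
        F.⊟ F.0#  ≡⟨ F.FS.solve 0 (F.FS.:- F.FS.con (pos 0) F.FS.:= F.FS.con (pos 0)) refl ⟩
        F.0# ∎)
    ... | c , e = ℤ.- c , trans (cong ℤ.-_ e) (ℤ.neg-distribʳ-* (pos p ℤ.^ 1) c)

    ι-↑ : ∀ m n → ι (m ℤ.^ n) ≈ ι m ↑ n
    ι-↑ m zero    = +-identityʳ 1#
    ι-↑ m (suc n) = ≈-trans (ι-* m (m ℤ.^ n)) (*-congˡ (ι-↑ m n))

    φ-1 : φ p 1# ≈ 1#
    φ-1 = ≈-trans (φ-cong p (≈-sym T-1)) (≈-trans (φ-T p F.1#) (≈-trans (reflexive (cong T (F.1↑ p))) T-1))

    φ-· : ∀ n → φ p (n · 1#) ≈ n · 1#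
    φ-· zero    = φ-0
    φ-· (suc n) = ≈-trans (φ-⊞ p 1# (n · 1#)) (+-cong φ-1 (φ-· n))

    φ-ι : ∀ m → φ p (ι m) ≈ ι m
    φ-ι (pos n)  = φ-· n
    φ-ι -[1+ n ] = ≈-trans (φ-⊟ p (suc n · 1#)) (-‿cong (φ-· (suc n)))

    P-cancel : ∀ {a b} → P ⊠ a ≈ P ⊠ b → a ≈ b
    P-cancel {a} {b} e = torsion-free p (ℕ.<⇒≤ 1<p) (≈-trans (P⊠ a) (≈-trans e (≈-sym (P⊠ b))))

    module Descent (j : ℕ) (rec : ∀ m → IPow (suc j) (ι m) → Divisible (suc j) m) (m : ℤ) (i : IPow (suc (suc j)) (ι m)) (c : ℤ) (e : m ≡ (pos p ℤ.^ suc j) ℤ.* c) where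
      p₂ : ℕ
      p₂ = p ∸ 2

      -- `w` is mᵖ⁻¹ and `m′` is (m - mᵖ)/p, written without division by means of m = pʲ⁺¹ c.
      w m′ : ℤ
      w  = m ℤ.^ suc p₂
      m′ = (pos p ℤ.^ j) ℤ.* c ℤ.- (pos p ℤ.^ j) ℤ.* c ℤ.* w

      split : m ≡ m ℤ.* w ℤ.+ pos p ℤ.* m′
      split = trans e (trans (lem (pos p) (pos p ℤ.^ j) c w) (cong (λ z → z ℤ.* w ℤ.+ pos p ℤ.* m′) (sym e)))
        where
        lem : ∀ P Q c w → P ℤ.* Q ℤ.* c ≡ P ℤ.* Q ℤ.* c ℤ.* w ℤ.+ P ℤ.* (Q ℤ.* c ℤ.- Q ℤ.* c ℤ.* w)
        lem = solveℤ

      b : Carrier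
      b = proj₁ (derivation i)

      b≈ : b ≈ ι m′
      b≈ = P-cancel (begin≈
        P ⊠ b  ≈⟨ solve 2 (λ x y → y := :- x :+ (x :+ y)) ≈-refl (ι m ↑ p) (P ⊠ b) ⟩
        ⊟ (ι m ↑ p) ⊞ (ι m ↑ p ⊞ P ⊠ b)  ≈⟨ +-congˡ (≈-trans (≈-sym (proj₂ (proj₂ (derivation i)))) (φ-ι m)) ⟩
        ⊟ (ι m ↑ p) ⊞ ι m  ≈⟨ +-congˡ (≈-trans (reflexive (cong ι split)) (≈-trans (ι-+ (m ℤ.* w) (pos p ℤ.* m′)) (+-cong ι-m^p (ι-* (pos p) m′)))) ⟩
        ⊟ (ι m ↑ p) ⊞ (ι m ↑ p ⊞ P ⊠ ι m′)  ≈⟨ solve 2 (λ x y → :- x :+ (x :+ y) := y) ≈-refl (ι m ↑ p) (P ⊠ ι m′) ⟩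
        P ⊠ ι m′ ∎≈)
        where
        open Solver
        ι-m^p : ι (m ℤ.* w) ≈ ι m ↑ p
        ι-m^p = ≈-trans (ι-↑ m (suc (suc p₂))) (reflexive (cong (ι m ↑_) (ℕ.m+[n∸m]≡n 1<p)))

      -- In m = mᵖ + p m′ the integer m′ lies in Iʲ⁺¹, hence is divisible by pʲ⁺¹ by induction, and
      -- mᵖ contains m · m, which is divisible by p²ʲ⁺².
      descend : Divisible (suc (suc j)) m
      descend = let c′ , e′ = rec m′ (IPow-resp b≈ (proj₁ (proj₂ (derivation i)))) in
        c ℤ.* ((pos p ℤ.^ j) ℤ.* c ℤ.* m ℤ.^ p₂) ℤ.+ c′ ,
        trans split (trans (cong₂ (λ x y → x ℤ.* (x ℤ.* m ℤ.^ p₂) ℤ.+ pos p ℤ.* y) e e′) (lem (pos p) (pos p ℤ.^ j) c (m ℤ.^ p₂) c′))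
        where
        lem : ∀ P Q c v d → (P ℤ.* Q ℤ.* c) ℤ.* ((P ℤ.* Q ℤ.* c) ℤ.* v) ℤ.+ P ℤ.* (P ℤ.* Q ℤ.* d) ≡ P ℤ.* (P ℤ.* Q) ℤ.* (c ℤ.* (Q ℤ.* c ℤ.* v) ℤ.+ d)
        lem = solveℤ

    -- φ fixes the integers, so the p-derivation of an integer m is the integer (m - mᵖ)/p, and it
    -- lies in the next lower power of I. This permits induction on j.
    IPow-ι : ∀ j m → IPow j (ι m) → Divisible j m
    IPow-ι zero          m i = m , sym (ℤ.*-identityˡ m)
    IPow-ι (suc zero)    m i = ε-ι-zero m (ε-IPow i)
    IPow-ι (suc (suc j)) m i = let c , e = IPow-ι (suc j) m (IPow-pred i) in Descent.descend j (IPow-ι (suc j)) m i c e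

    -- With a = b + d, the mixed terms of (b + d)ᵖ carry the factor p ∈ I besides d, and dᵖ contains
    -- d · d since p ≥ 2.
    IPow-↑p : ∀ {j a b} → IPow (suc j) (a ⊞ ⊟ b) → IPow (suc (suc j)) (a ↑ p ⊞ ⊟ (b ↑ p))
    IPow-↑p {j} {a} {b} i = let c , ic , e = expand b d i in
      IPow-resp (≈-sym (≈-trans (+-congʳ (≈-trans (^-congˡ p a≈) e)) (solve 3 (λ x y z → ((x :+ y) :+ z) :+ :- x := y :+ z) ≈-refl (b ↑ p) (d ↑ p) (P ⊠ c))))
        (IPow-+ d↑p (IPow-prod IPow-P ic))
      where
      open Solver
      d = a ⊞ ⊟ b
      a≈ : a ≈ b ⊞ d
      a≈ = solve 2 (λ a b → a := b :+ (a :+ :- b)) ≈-refl a b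
      d↑p : IPow (suc (suc j)) (d ↑ p)
      d↑p = subst (λ n → IPow (suc (suc j)) (d ↑ n)) (ℕ.m+[n∸m]≡n 1<p)
        (IPow-resp (solve 2 (λ d w → w :* (d :* d) := d :* (d :* w)) ≈-refl d (d ↑ (p ∸ 2))) (IPow-* (d ↑ (p ∸ 2)) (IPow-prod (IPow-ε (ε-IPow i)) i)))

    IPow-↑p^ : ∀ n {a b} → ε a ≡ ε b → IPow (suc n) (a ↑ (p ^ n) ⊞ ⊟ (b ↑ (p ^ n)))
    IPow-↑p^ zero {a} {b} eq = IPow-resp (+-cong (≈-sym (*-identityʳ a)) (-‿cong (≈-sym (*-identityʳ b))))
      (IPow-ε (trans (ε-⊞ a (⊟ b)) (trans (cong₂ F._⊞_ eq (ε-⊟ b)) (F.-‿inverseʳ (ε b)))))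
    IPow-↑p^ (suc n) {a} {b} eq = IPow-resp (+-cong (lem a) (-‿cong (lem b))) (IPow-↑p (IPow-↑p^ n eq))
      where
      lem : ∀ a → (a ↑ (p ^ n)) ↑ p ≈ a ↑ (p ^ suc n)
      lem a = ≈-trans (^-assocʳ a (p ^ n) p) (reflexive (cong (a ↑_) (ℕ.*-comm (p ^ n) p)))

    IPow-p^ : ∀ k → IPow k ((p ^ k) · 1#)
    IPow-p^ zero    = all
    IPow-p^ (suc k) = IPow-resp (≈-sym (×1-homo-* p (p ^ k))) (IPow-prod IPow-P (IPow-p^ k))

    IPow-↑ : ∀ n {a} → ε a ≡ F.0# → IPow n (a ↑ n)
    IPow-↑ zero    z = all
    IPow-↑ (suc n) z = prod z (IPow-↑ n z) ≈-refl

    module Quotient (k : ℕ) (0<k : 0 < k) where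
      infix 4 _≈ₖ_
      record _≈ₖ_ (a b : Carrier) : Set where
        constructor mk
        field difference : IPow k (a ⊞ ⊟ b)
      open _≈ₖ_

      open Solver

      ≈⇒≈ₖ : ∀ {a b} → a ≈ b → a ≈ₖ b
      ≈⇒≈ₖ {a} {b} e = mk (IPow-resp (≈-sym (≈-trans (+-congʳ e) (-‿inverseʳ b))) (IPow-0 k))

      quotient : CommutativeRing 0ℓ 0ℓ
      quotient = record
        { Carrier = Carrier ; _≈_ = _≈ₖ_ ; _+_ = _⊞_ ; _*_ = _⊠_ ; -_ = ⊟_ ; 0# = 0# ; 1# = 1#
        ; isCommutativeRing = record
          { isRing = record
            { +-isAbelianGroup = record
              { isGroup = record
                { isMonoid = record
                  { isSemigroup = record
                    { isMagma = record
                      { isEquivalence = record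
                        { refl  = ≈⇒≈ₖ ≈-refl
                        ; sym   = λ {a} {b} (mk i) → mk (IPow-resp (solve 2 (λ a b → :- (a :+ :- b) := b :+ :- a) ≈-refl a b) (IPow-neg i))
                        ; trans = λ {a} {b} {c} (mk i) (mk j) → mk (IPow-resp (solve 3 (λ a b c → (a :+ :- b) :+ (b :+ :- c) := a :+ :- c) ≈-refl a b c) (IPow-+ i j))
                        }
                      ; ∙-cong = λ {a} {b} {c} {d} (mk i) (mk j) → mk (IPow-resp (solve 4 (λ a b c d → (a :+ :- b) :+ (c :+ :- d) := (a :+ c) :+ :- (b :+ d)) ≈-refl a b c d) (IPow-+ i j))
                      }
                    ; assoc = λ a b c → ≈⇒≈ₖ (+-assoc a b c)
                    }
                  ; identity = (λ a → ≈⇒≈ₖ (+-identityˡ a)) , (λ a → ≈⇒≈ₖ (+-identityʳ a))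
                  }
                ; inverse = (λ a → ≈⇒≈ₖ (-‿inverseˡ a)) , (λ a → ≈⇒≈ₖ (-‿inverseʳ a))
                ; ⁻¹-cong = λ {a} {b} (mk i) → mk (IPow-resp (solve 2 (λ a b → :- (a :+ :- b) := :- a :+ :- (:- b)) ≈-refl a b) (IPow-neg i))
                }
              ; comm = λ a b → ≈⇒≈ₖ (+-comm a b)
              }
            ; *-cong = λ {a} {b} {c} {d} (mk i) (mk j) → mk (IPow-resp (solve 4 (λ a b c d → c :* (a :+ :- b) :+ b :* (c :+ :- d) := a :* c :+ :- (b :* d)) ≈-refl a b c d)
                (IPow-+ (IPow-* c i) (IPow-* b j)))
            ; *-assoc = λ a b c → ≈⇒≈ₖ (*-assoc a b c)
            ; *-identity = (λ a → ≈⇒≈ₖ (*-identityˡ a)) , (λ a → ≈⇒≈ₖ (*-identityʳ a))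
            ; distrib = (λ a b c → ≈⇒≈ₖ (distribˡ a b c)) , (λ a b c → ≈⇒≈ₖ (distribʳ a b c))
            }
          ; *-comm = λ a b → ≈⇒≈ₖ (*-comm a b)
          }
        }

      open CommRing quotient using () renaming (_·_ to _·ₖ_; _↑_ to _↑ₖ_)

      ·ₖ≡· : ∀ n a → n ·ₖ a ≡ n · a
      ·ₖ≡· zero    a = refl
      ·ₖ≡· (suc n) a = cong (a ⊞_) (·ₖ≡· n a)

      ↑ₖ≡↑ : ∀ a n → a ↑ₖ n ≡ a ↑ n
      ↑ₖ≡↑ a zero    = refl
      ↑ₖ≡↑ a (suc n) = cong (a ⊠_) (↑ₖ≡↑ a n)

      ≈ₖ0 : ∀ {a} → IPow k a → a ≈ₖ 0#
      ≈ₖ0 {a} i = mk (IPow-resp (≈-sym (≈-trans (+-congˡ -0#≈0#) (+-identityʳ a))) i)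

      IPow-≈ₖ0 : ∀ {a} → a ≈ₖ 0# → IPow k a
      IPow-≈ₖ0 {a} (mk i) = IPow-resp (≈-trans (+-congˡ -0#≈0#) (+-identityʳ a)) i

      -- [0] is not 0 in ℤ[F], but it is idempotent and lies in I, so [0] = [0]ᵏ lies in Iᵏ.
      T-0ₖ : T F.0# ≈ₖ 0#
      T-0ₖ = ≈ₖ0 (IPow-resp (≈-trans (≈-sym (T-↑ F.0# k)) (reflexive (cong T (F.↑-zero 0<k)))) (IPow-↑ k (ε-T F.0#)))

      faithfulₖ : ∀ m n → m ·ₖ 1# ≈ₖ n ·ₖ 1# → p ^ k ∣ ℕ.∣ m - n ∣
      faithfulₖ m n (mk i) with IPow-ι k (m ℤ.⊖ n) (IPow-resp (≈-trans (reflexive (cong₂ (λ x y → x ⊞ ⊟ y) (·ₖ≡· m 1#) (·ₖ≡· n 1#))) (≈-sym (ι-⊖ m n))) i)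
      ... | c , e = divides ℤ.∣ c ∣ (begin
        ℕ.∣ m - n ∣  ≡⟨ ∣-∣≡ ⟨
        ℤ.∣ m ℤ.⊖ n ∣  ≡⟨ cong ℤ.∣_∣ e ⟩
        ℤ.∣ (pos p ℤ.^ k) ℤ.* c ∣  ≡⟨ ℤ.abs-* (pos p ℤ.^ k) c ⟩
        ℤ.∣ pos p ℤ.^ k ∣ * ℤ.∣ c ∣  ≡⟨ cong (_* ℤ.∣ c ∣) (abs-^ k) ⟩
        p ^ k * ℤ.∣ c ∣  ≡⟨ ℕ.*-comm (p ^ k) ℤ.∣ c ∣ ⟩
        ℤ.∣ c ∣ * p ^ k ∎)
        where
        abs-^ : ∀ k → ℤ.∣ pos p ℤ.^ k ∣ ≡ p ^ k
        abs-^ zero    = refl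
        abs-^ (suc k) = trans (ℤ.abs-* (pos p) (pos p ℤ.^ k)) (cong (p *_) (abs-^ k))
        ∣-∣≡ : ℤ.∣ m ℤ.⊖ n ∣ ≡ ℕ.∣ m - n ∣
        ∣-∣≡ with ℕ.≤-total m n
        ... | inj₁ m≤n = trans (ℤ.∣⊖∣-≤ m≤n) (sym (ℕ.m≤n⇒∣m-n∣≡n∸m m≤n))
        ... | inj₂ n≤m = trans (cong ℤ.∣_∣ (ℤ.⊖-≥ n≤m)) (sym (trans (ℕ.∣-∣-comm m n) (ℕ.m≤n⇒∣m-n∣≡n∸m n≤m)))

      -- 1 - [x] is a unit modulo Iᵏ: if y inverts 1 - x in F, then e = 1 - (1 - [x])[y] lies in I,
      -- and b ≡ e b ≡ ... ≡ eᵏ b ≡ 0.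
      cancelₖ : ∀ {x b} → x ≢ F.1# → (1# ⊞ ⊟ T x) ⊠ b ≈ₖ 0# → b ≈ₖ 0#
      cancelₖ {x} {b} x≢1 h = ≈ₖ0 (IPow-resp (solve 2 (λ b c → (b :+ :- c) :+ c := b) ≈-refl b (e ↑ k ⊠ b)) (IPow-+ (geometric k) (IPow-resp (*-comm b (e ↑ k)) (IPow-* b (IPow-↑ k εe)))))
        where
        inv = F.invertible (F.1# F.⊞ F.⊟ x) (λ eq → x≢1 (sym (F.x-y≡0⇒x≡y _ _ eq)))
        y = proj₁ inv
        e = 1# ⊞ ⊟ ((1# ⊞ ⊟ T x) ⊠ T y)
        εe : ε e ≡ F.0#
        εe = begin
          ε e  ≡⟨ trans (ε-⊞ 1# _) (cong₂ F._⊞_ ε-1 (trans (ε-⊟ _) (cong F.⊟_ (ε-⊠ _ (T y))))) ⟩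
          F.1# F.⊞ F.⊟ (ε (1# ⊞ ⊟ T x) F.⊠ ε (T y))  ≡⟨ cong₂ (λ u v → F.1# F.⊞ F.⊟ (u F.⊠ v)) (trans (ε-⊞ 1# _) (cong₂ F._⊞_ ε-1 (trans (ε-⊟ (T x)) (cong F.⊟_ (ε-T x))))) (ε-T y) ⟩
          F.1# F.⊞ F.⊟ ((F.1# F.⊞ F.⊟ x) F.⊠ y)  ≡⟨ cong (λ z → F.1# F.⊞ F.⊟ z) (proj₂ inv) ⟩
          F.1# F.⊞ F.⊟ F.1#  ≡⟨ F.-‿inverseʳ F.1# ⟩
          F.0# ∎
        step : ∀ c → IPow k (c ⊠ b ⊞ ⊟ (e ⊠ c ⊠ b))
        step c = IPow-resp (≈-trans (solve 5 (λ o u y c b → (c :* y) :* (u :* b) := o :* c :* b :+ :- ((o :+ :- (u :* y)) :* c :* b)) ≈-refl 1# (1# ⊞ ⊟ T x) (T y) c b)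
            (+-congʳ (*-congʳ (*-identityˡ c)))) (IPow-* (c ⊠ T y) (IPow-≈ₖ0 h))
        geometric : ∀ n → IPow k (b ⊞ ⊟ (e ↑ n ⊠ b))
        geometric zero    = IPow-resp (≈-sym (≈-trans (+-congˡ (-‿cong (*-identityˡ b))) (-‿inverseʳ b))) (IPow-0 k)
        geometric (suc n) = IPow-resp (solve 3 (λ x y z → (x :+ :- y) :+ (y :+ :- z) := x :+ :- z) ≈-refl b (e ↑ n ⊠ b) (e ⊠ e ↑ n ⊠ b)) (IPow-+ (geometric n) (step (e ↑ n)))

      teichmüller : Teichmüller F p k
      teichmüller = record
        { B = quotient ; T = T ; T-* = λ x y → ≈⇒≈ₖ (T-* x y) ; T-1 = ≈⇒≈ₖ T-1 ; T-0 = T-0ₖ ; ε = ε ; ε-⊞ = ε-⊞ ; ε-T = ε-T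
        ; ε-approx = λ {a} {b} eq → mk (subst (λ n → IPow n (a ↑ₖ (p ^ (k ∸ 1)) ⊞ ⊟ (b ↑ₖ (p ^ (k ∸ 1))))) (ℕ.m+[n∸m]≡n 0<k)
            (IPow-resp (reflexive (sym (cong₂ (λ x y → x ⊞ ⊟ y) (↑ₖ≡↑ a (p ^ (k ∸ 1))) (↑ₖ≡↑ b (p ^ (k ∸ 1)))))) (IPow-↑p^ (k ∸ 1) eq)))
        ; p^k· = λ b → ≈ₖ0 (IPow-resp (≈-trans (≈-trans (×-comm-* (p ^ k) b 1#) (×-congʳ (p ^ k) (*-identityʳ b))) (reflexive (sym (·ₖ≡· (p ^ k) b)))) (IPow-* b (IPow-p^ k)))
        ; cancel = cancelₖ ; faithful = faithfulₖ
        }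

-- Periodic sums and counts of residues modulo k.

sumTo : ℕ → (ℕ → ℕ) → ℕ
sumTo zero    f = 0
sumTo (suc n) f = f n + sumTo n f

sumTo-cong : ∀ n {f g} → (∀ i → i < n → f i ≡ g i) → sumTo n f ≡ sumTo n g
sumTo-cong zero    h = refl
sumTo-cong (suc n) h = cong₂ _+_ (h n ℕ.≤-refl) (sumTo-cong n (λ i i<n → h i (ℕ.m≤n⇒m≤1+n i<n)))

sumTo-* : ∀ n c f → sumTo n (λ i → c * f i) ≡ c * sumTo n f
sumTo-* zero    c f = sym (ℕ.*-zeroʳ c)
sumTo-* (suc n) c f = trans (cong (c * f n +_) (sumTo-* n c f)) (sym (ℕ.*-distribˡ-+ c (f n) (sumTo n f)))

sumTo-shift : ∀ n (H : ℕ → ℕ) → sumTo n (λ t → H (suc t)) + H 0 ≡ H n + sumTo n H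
sumTo-shift zero    H = sym (ℕ.+-identityʳ (H 0))
sumTo-shift (suc n) H = trans (ℕ.+-assoc (H (suc n)) _ (H 0)) (cong (H (suc n) +_) (sumTo-shift n H))

-- Moving the window by one removes H l and adds H (k + l), which are equal by periodicity.
sumTo-rotate : ∀ k (H : ℕ → ℕ) → (∀ m → H (m + k) ≡ H m) → ∀ l → sumTo k (λ t → H (t + l)) ≡ sumTo k H
sumTo-rotate k H per zero    = sumTo-cong k (λ i _ → cong H (ℕ.+-identityʳ i))
sumTo-rotate k H per (suc l) = trans (ℕ.+-cancelʳ-≡ (H l) _ _ (begin
  sumTo k (λ t → H (t + suc l)) + H l  ≡⟨ cong (_+ H l) (sumTo-cong k (λ i _ → cong H (ℕ.+-suc i l))) ⟩
  sumTo k (λ t → H (suc t + l)) + H l  ≡⟨ sumTo-shift k (λ t → H (t + l)) ⟩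
  H (k + l) + sumTo k (λ t → H (t + l))  ≡⟨ ℕ.+-comm (H (k + l)) _ ⟩
  sumTo k (λ t → H (t + l)) + H (k + l)  ≡⟨ cong (sumTo k (λ t → H (t + l)) +_) (trans (cong H (ℕ.+-comm k l)) (per l)) ⟩
  sumTo k (λ t → H (t + l)) + H l ∎)) (sumTo-rotate k H per l)
  where open ≡-Reasoning

count : ℕ → (ℕ → Bool) → ℕ
count n S = sumTo n (λ l → if S l then 1 else 0)

count-∨ : ∀ n S S′ → count n (λ l → S l ∨ S′ l) ≤ count n S + count n S′
count-∨ zero    S S′ = z≤n
count-∨ (suc n) S S′ = ℕ.≤-trans (ℕ.+-mono-≤ (bit (S n) (S′ n)) (count-∨ n S S′)) (ℕ.≤-reflexive (lem (b (S n)) (b (S′ n)) (count n S) (count n S′)))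
  where
  b : Bool → ℕ
  b x = if x then 1 else 0
  bit : ∀ x y → b (x ∨ y) ≤ b x + b y
  bit true  y = s≤s z≤n
  bit false y = ℕ.≤-refl
  lem : ∀ a b c d → (a + b) + (c + d) ≡ (a + c) + (b + d)
  lem = solve-∀

count-false : ∀ n → count n (λ _ → false) ≡ 0
count-false zero    = refl
count-false (suc n) = count-false n

count-search : ∀ n S → (∃[ l ] (l < n × S l ≡ false)) ⊎ n ≤ count n S
count-search zero    S = inj₂ z≤n
count-search (suc n) S with S n in eq | count-search n S
... | false | _                     = inj₁ (n , ℕ.≤-refl , eq)
... | true  | inj₁ (l , l<n , s)    = inj₁ (l , ℕ.m≤n⇒m≤1+n l<n , s)
... | true  | inj₂ h                = inj₂ (s≤s h)

count-<ᵇ : ∀ n s → count n (_<ᵇ s) ≤ s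
count-<ᵇ n s = proj₂ (go n)
  where
  go : ∀ n → count n (_<ᵇ s) ≤ n × count n (_<ᵇ s) ≤ s
  go zero = z≤n , z≤n
  go (suc n) with n <ᵇ s in eq | go n
  ... | false | a , b = ℕ.m≤n⇒m≤1+n a , b
  ... | true  | a , b = s≤s a , ℕ.≤-trans (s≤s a) (ℕ.<ᵇ⇒< n s (subst Bool.T (sym eq) tt))

module _ (k : ℕ) .{{_ : NonZero k}} where
  -- Rotation by a permutes the residues modulo k, and at most s of them lie below s.
  count-rotate : ∀ a s → count k (λ l → (a + l) % k <ᵇ s) ≤ s
  count-rotate a s = ℕ.≤-trans (ℕ.≤-reflexive (begin
    sumTo k (λ l → b ((a + l) % k))  ≡⟨ sumTo-cong k (λ l _ → cong (λ z → b (z % k)) (ℕ.+-comm a l)) ⟩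
    sumTo k (λ l → b ((l + a) % k))  ≡⟨ sumTo-rotate k (λ l → b (l % k)) (λ m → cong b ([m+n]%n≡m%n m k)) a ⟩
    sumTo k (λ l → b (l % k))  ≡⟨ sumTo-cong k (λ l l<k → cong b (m<n⇒m%n≡m l<k)) ⟩
    count k (_<ᵇ s) ∎)) (count-<ᵇ k s)
    where
    open ≡-Reasoning
    b : ℕ → ℕ
    b m = if m <ᵇ s then 1 else 0

  -- If adding s wrapped around, the remainder would be at most m % k + s - k < s.
  %-no-wrap : ∀ m s → s ≤ (m + s) % k → (m + s) % k ≡ m % k + s
  %-no-wrap m s h with (m % k + s) ℕ.<? k
  ... | yes lt = trans reduce (m<n⇒m%n≡m lt)
    where
    reduce : (m + s) % k ≡ (m % k + s) % k
    reduce = trans (%-distribˡ-+ m s k) (trans (cong (λ z → (z + s % k) % k) (sym (m%n%n≡m%n m k))) (sym (%-distribˡ-+ (m % k) s k)))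
  ... | no ge = contradiction h (ℕ.<⇒≱ small)
    where
    open ℕ.≤-Reasoning
    k≤ : k ≤ m % k + s
    k≤ = ℕ.≮⇒≥ ge
    small : (m + s) % k < s
    small = begin-strict
      (m + s) % k              ≡⟨ %-distribˡ-+ m s k ⟩
      (m % k + s % k) % k      ≡⟨ cong (λ z → (z + s % k) % k) (m%n%n≡m%n m k) ⟨
      (m % k % k + s % k) % k  ≡⟨ %-distribˡ-+ (m % k) s k ⟨
      (m % k + s) % k          ≡⟨ cong (_% k) (ℕ.m∸n+n≡m k≤) ⟨
      (m % k + s ∸ k + k) % k  ≡⟨ [m+n]%n≡m%n (m % k + s ∸ k) k ⟩
      (m % k + s ∸ k) % k      ≤⟨ m%n≤m (m % k + s ∸ k) k ⟩
      m % k + s ∸ k            <⟨ ℕ.∸-monoˡ-< (ℕ.+-monoˡ-< s (m%n<n m k)) k≤ ⟩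
      k + s ∸ k                ≡⟨ ℕ.m+n∸m≡n k s ⟩
      s                        ∎

-- Monomials and functions of bounded degree.

module Monomials {q} (F : FiniteField q) where
  open FieldTheory F

  ^ᶠ≡↑ : ∀ x n → _^ᶠ_ F x n ≡ x ↑ n
  ^ᶠ≡↑ x zero    = refl
  ^ᶠ≡↑ x (suc n) = cong (x ⊠_) (^ᶠ≡↑ x n)

  evalMono-* : ∀ {n} (e e′ : Vec ℕ n) x → evalMono F (zipWith _+_ e e′) x ≡ evalMono F e x ⊠ evalMono F e′ x
  evalMono-* []      []        []       = sym (*-identityˡ 1#)
  evalMono-* (a ∷ e) (b ∷ e′) (x ∷ xs) = begin
    _^ᶠ_ F x (a + b) ⊠ evalMono F (zipWith _+_ e e′) xs  ≡⟨ cong₂ _⊠_ (trans (^ᶠ≡↑ x (a + b)) (^-homo-* x a b)) (evalMono-* e e′ xs) ⟩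
    (x ↑ a ⊠ x ↑ b) ⊠ (evalMono F e xs ⊠ evalMono F e′ xs)  ≡⟨ solve 4 (λ a b c d → (a :* b) :* (c :* d) := (a :* c) :* (b :* d)) refl (x ↑ a) (x ↑ b) (evalMono F e xs) (evalMono F e′ xs) ⟩
    (x ↑ a ⊠ evalMono F e xs) ⊠ (x ↑ b ⊠ evalMono F e′ xs)  ≡⟨ cong₂ (λ u v → (u ⊠ evalMono F e xs) ⊠ (v ⊠ evalMono F e′ xs)) (^ᶠ≡↑ x a) (^ᶠ≡↑ x b) ⟨
    _ ∎
    where
    open ≡-Reasoning
    open FS

  mdeg-+ : ∀ {n} (e e′ : Vec ℕ n) → mdeg F (zipWith _+_ e e′) ≡ mdeg F e + mdeg F e′
  mdeg-+ []      []       = refl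
  mdeg-+ (a ∷ e) (b ∷ e′) = trans (cong (a + b +_) (mdeg-+ e e′)) (lem a b (mdeg F e) (mdeg F e′))
    where
    lem : ∀ a b c d → (a + b) + (c + d) ≡ (a + c) + (b + d)
    lem = solve-∀

  evalMono-↑ : ∀ {n} c (e : Vec ℕ n) x → evalMono F e (map (_↑ c) x) ≡ evalMono F (map (c *_) e) x
  evalMono-↑ c []      []       = refl
  evalMono-↑ c (a ∷ e) (x ∷ xs) = cong₂ _⊠_ (trans (^ᶠ≡↑ (x ↑ c) a) (trans (^-assocʳ x c a) (sym (^ᶠ≡↑ x (c * a))))) (evalMono-↑ c e xs)

  evalMono-↑′ : ∀ {n} c (e : Vec ℕ n) x → evalMono F e (map (_↑ c) x) ≡ evalMono F e x ↑ c
  evalMono-↑′ c []      []       = sym (1↑ c)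
  evalMono-↑′ c (a ∷ e) (x ∷ xs) = begin
    _^ᶠ_ F (x ↑ c) a ⊠ evalMono F e (map (_↑ c) xs)  ≡⟨ cong₂ _⊠_ (trans (^ᶠ≡↑ (x ↑ c) a) (trans (^-assocʳ x c a) (trans (cong (x ↑_) (ℕ.*-comm c a)) (sym (^-assocʳ x a c))))) (evalMono-↑′ c e xs) ⟩
    (x ↑ a) ↑ c ⊠ evalMono F e xs ↑ c  ≡⟨ ^-distrib-* (x ↑ a) (evalMono F e xs) c ⟨
    (x ↑ a ⊠ evalMono F e xs) ↑ c  ≡⟨ cong (λ z → (z ⊠ evalMono F e xs) ↑ c) (^ᶠ≡↑ x a) ⟨
    _ ∎
    where open ≡-Reasoning

  mdeg-* : ∀ {n} c (e : Vec ℕ n) → mdeg F (map (c *_) e) ≡ c * mdeg F e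
  mdeg-* c []      = sym (ℕ.*-zeroʳ c)
  mdeg-* c (a ∷ e) = trans (cong (c * a +_) (mdeg-* c e)) (sym (ℕ.*-distribˡ-+ c a (mdeg F e)))

  evalMono-0 : ∀ {n} (x : Vec K n) → evalMono F (replicate n 0) x ≡ 1#
  evalMono-0 []       = refl
  evalMono-0 (x ∷ xs) = trans (*-identityˡ _) (evalMono-0 xs)

  mdeg-0 : ∀ n → mdeg F (replicate n 0) ≡ 0
  mdeg-0 zero    = refl
  mdeg-0 (suc n) = mdeg-0 n

  module Span (R : CommutativeRing 0ℓ 0ℓ) (T : K → CommutativeRing.Carrier R)
    (T-* : ∀ x y → CommutativeRing._≈_ R (T (x ⊠ y)) (CommutativeRing._*_ R (T x) (T y)))
    (T-1 : CommutativeRing._≈_ R (T 1#) (CommutativeRing.1# R)) where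

    module R = CommRing R
    open R using (_≈_) renaming (Carrier to A)

    -- Two instances are used: with R = F and T = id these are polynomial functions of degree at
    -- most D; with the Teichmüller map they are the analogues with values in B. Functions up to
    -- pointwise equality are described, not formal polynomials, so exponents may be reduced by x^q
    -- = x.
    data Span {n} (D : ℕ) (f : Vec K n → A) : Set where
      mono : ∀ c e → mdeg F e ≤ D → (∀ x → f x ≈ c R.⊠ T (evalMono F e x)) → Span D f
      add  : ∀ {g h} → Span D g → Span D h → (∀ x → f x ≈ g x R.⊞ h x) → Span D f

    Span-resp : ∀ {n D} {f g : Vec K n → A} → (∀ x → g x ≈ f x) → Span D f → Span D g
    Span-resp eq (mono c e d h) = mono c e d (λ x → R.≈-trans (eq x) (h x))
    Span-resp eq (add s t h)    = add s t (λ x → R.≈-trans (eq x) (h x))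

    Span-mono : ∀ {n D E} {f : Vec K n → A} → D ≤ E → Span D f → Span E f
    Span-mono le (mono c e d h) = mono c e (ℕ.≤-trans d le) h
    Span-mono le (add s t h)    = add (Span-mono le s) (Span-mono le t) h

    Span-const : ∀ {n} c → Span {n} 0 (λ _ → c)
    Span-const {n} c = mono c (replicate n 0) (ℕ.≤-reflexive (mdeg-0 n))
      (λ x → R.≈-sym (R.≈-trans (R.*-congˡ (R.≈-trans (R.reflexive (cong T (evalMono-0 x))) T-1)) (R.*-identityʳ c)))

    Span-+ : ∀ {n D} {f g : Vec K n → A} → Span D f → Span D g → Span D (λ x → f x R.⊞ g x)
    Span-+ s t = add s t (λ x → R.≈-refl)

    Span-* : ∀ {n D E} {f g : Vec K n → A} → Span D f → Span E g → Span (D + E) (λ x → f x R.⊠ g x)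
    Span-* (mono c e d h) (mono c′ e′ d′ h′) = mono (c R.⊠ c′) (zipWith _+_ e e′) (ℕ.≤-trans (ℕ.≤-reflexive (mdeg-+ e e′)) (ℕ.+-mono-≤ d d′))
      (λ x → R.≈-trans (R.*-cong (h x) (h′ x)) (R.≈-trans
        (solve 4 (λ a b c d → (a :* b) :* (c :* d) := (a :* c) :* (b :* d)) R.≈-refl c (T (evalMono F e x)) c′ (T (evalMono F e′ x)))
        (R.*-congˡ (R.≈-trans (R.≈-sym (T-* (evalMono F e x) (evalMono F e′ x))) (R.reflexive (cong T (sym (evalMono-* e e′ x))))))))
      where open R.Solver
    Span-* s@(mono _ _ _ _) (add t u h′) = add (Span-* s t) (Span-* s u) (λ x → R.≈-trans (R.*-congˡ (h′ x)) (R.distribˡ _ _ _))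
    Span-* (add s t h) u = add (Span-* s u) (Span-* t u) (λ x → R.≈-trans (R.*-congʳ (h x)) (R.distribʳ _ _ _))

    Span-↑ : ∀ {n D} {f : Vec K n → A} r → Span D f → Span (r * D) (λ x → f x R.↑ r)
    Span-↑ zero    s = Span-const R.1#
    Span-↑ (suc r) s = Span-* s (Span-↑ r s)

-- Ax's congruence: degrees of twists and sums over flats.

module Ax {q} (F : FiniteField q) (p k : ℕ) (pr : Prime p) (p·1≡0 : CommRing._·_ (FieldTheory.FR F) p (FiniteField.1# F) ≡ FiniteField.0# F)
          (q≡p^k : q ≡ p ^ k) (0<k : 0 < k) (W : Teichmüller F p k) where
  module F = FieldTheory F
  open F using (K)
  open F.Characteristic p pr p·1≡0 using (1<p; frobenius-+)
  open Monomials F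
  open Teichmüller W
  open CommRing B renaming (Carrier to A)
  module Poly = Span F.FR id (λ _ _ → refl) refl
  open Span B T T-* T-1 using (Span; Span-resp; Span-mono; Span-const; Span-+; Span-*; Span-↑; mono; add)
  open import Relation.Binary.Reasoning.Setoid setoid

  private instance
    k-nonZero : NonZero k
    k-nonZero = ℕ.>-nonZero 0<k

    p-nonZero : NonZero p
    p-nonZero = ℕ.>-nonZero (ℕ.<⇒≤ 1<p)

  frob : ∀ {n} → ℕ → Vec K n → Vec K n
  frob l = map (F._↑ (p ^ l))

  ↑p^k : ∀ x → x F.↑ (p ^ k) ≡ x
  ↑p^k x = trans (cong (x F.↑_) (sym q≡p^k)) (F.fermat x)

  ↑p^+ : ∀ x a b → x F.↑ (p ^ (a + b)) ≡ (x F.↑ (p ^ a)) F.↑ (p ^ b)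
  ↑p^+ x a b = trans (cong (x F.↑_) (ℕ.^-distribˡ-+-* p a b)) (sym (F.^-assocʳ x (p ^ a) (p ^ b)))

  ↑p^k* : ∀ x c → x F.↑ (p ^ (c * k)) ≡ x
  ↑p^k* x zero    = F.*-identityʳ x
  ↑p^k* x (suc c) = trans (↑p^+ x k (c * k)) (trans (cong (F._↑ (p ^ (c * k))) (↑p^k x)) (↑p^k* x c))

  ↑p^-% : ∀ x m → x F.↑ (p ^ m) ≡ x F.↑ (p ^ (m % k))
  ↑p^-% x m = trans (cong (λ z → x F.↑ (p ^ z)) (m≡m%n+[m/n]*n m k)) (trans (↑p^+ x (m % k) (m ℕ./ k * k)) (↑p^k* (x F.↑ (p ^ (m % k))) (m ℕ./ k)))

  frobenius-+^ : ∀ j x y → (x F.⊞ y) F.↑ (p ^ j) ≡ x F.↑ (p ^ j) F.⊞ y F.↑ (p ^ j)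
  frobenius-+^ zero    x y = trans (F.*-identityʳ _) (sym (cong₂ F._⊞_ (F.*-identityʳ x) (F.*-identityʳ y)))
  frobenius-+^ (suc j) x y = trans (lem (x F.⊞ y)) (trans (cong (F._↑ (p ^ j)) (frobenius-+ x y))
    (trans (frobenius-+^ j (x F.↑ p) (y F.↑ p)) (sym (cong₂ F._⊞_ (lem x) (lem y)))))
    where
    lem : ∀ x → x F.↑ (p ^ suc j) ≡ (x F.↑ p) F.↑ (p ^ j)
    lem x = sym (F.^-assocʳ x p (p ^ j))

  T-↑ : ∀ x n → T (x F.↑ n) ≈ T x ↑ n
  T-↑ x zero    = T-1
  T-↑ x (suc n) = ≈-trans (T-* x (x F.↑ n)) (*-congˡ (T-↑ x n))

  module _ {n : ℕ} where
    Fun : Set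
    Fun = Vec K n → A

    open import Algebra.Construct.Pointwise (Vec K n) using () renaming (commutativeRing to pointwise)
    private module FunRing = CommRing (pointwise B)

    ↑-at : ∀ (f : Fun) r x → (f FunRing.↑ r) x ≡ f x ↑ r
    ↑-at f zero    x = refl
    ↑-at f (suc r) x = cong (f x ⊠_) (↑-at f r x)

    ·-at : ∀ m (f : Fun) x → (m FunRing.· f) x ≡ m · f x
    ·-at zero    f x = refl
    ·-at (suc m) f x = cong (f x ⊞_) (·-at m f x)

    -- The expansion is taken in the ring of functions and not point by point, so that the
    -- correction is a single function to which a degree bound can be attached.
    fun-expansion : (Q : Fun → Set) → (∀ {f g} → (∀ x → g x ≈ f x) → Q f → Q g) → Q (λ _ → 0#) → (∀ {f g} → Q f → Q g → Q (λ x → f x ⊞ g x)) →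
      ∀ a b → (∀ i j → suc i + suc j ≡ p → Q (λ x → a x ↑ suc i ⊠ b x ↑ suc j)) →
      ∃[ c ] (Q c × (∀ x → (a x ⊞ b x) ↑ p ≈ (a x ↑ p ⊞ b x ↑ p) ⊞ p · c x))
    fun-expansion Q Q-resp Q0 Q+ a b h =
      let c , Qc , e = FunRing.frobenius-expansion Q Q0 Q+ pr a b
            (λ i j eq → Q-resp (λ x → reflexive (cong₂ _⊠_ (↑-at a (suc i) x) (↑-at b (suc j) x))) (h i j eq))
      in c , Qc , λ x → ≈-trans (≈-trans (reflexive (sym (↑-at _ p x))) (e x))
           (reflexive (cong₂ _⊞_ (cong₂ _⊞_ (↑-at a p x) (↑-at b p x)) (·-at p c x)))

    -- The bounds for different l are separate data since, after reduction by x^q = x, a twist can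
    -- have smaller degree than g itself.
    record Degrees (D : ℕ → ℕ) (g : Fun) : Set where
      constructor degrees
      field span : ∀ l → Span (D l) (λ x → g (frob l x))
    open Degrees

    Degrees-resp : ∀ {D f g} → (∀ x → g x ≈ f x) → Degrees D f → Degrees D g
    Degrees-resp e d = degrees λ l → Span-resp (λ x → e (frob l x)) (span d l)

    Degrees-mono : ∀ {D E g} → (∀ l → D l ≤ E l) → Degrees D g → Degrees E g
    Degrees-mono le d = degrees λ l → Span-mono (le l) (span d l)

    Degrees-const : ∀ {D} c → Degrees D (λ _ → c)
    Degrees-const c = degrees λ l → Span-mono z≤n (Span-const c)

    Degrees-+ : ∀ {D f g} → Degrees D f → Degrees D g → Degrees D (λ x → f x ⊞ g x)
    Degrees-+ d e = degrees λ l → Span-+ (span d l) (span e l)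

    Degrees-* : ∀ {D E f g} → Degrees D f → Degrees E g → Degrees (λ l → D l + E l) (λ x → f x ⊠ g x)
    Degrees-* d e = degrees λ l → Span-* (span d l) (span e l)

    Degrees-↑ : ∀ {D f} r → Degrees D f → Degrees (λ l → r * D l) (λ x → f x ↑ r)
    Degrees-↑ r d = degrees λ l → Span-↑ r (span d l)

    Degrees-· : ∀ {D f} m → Degrees D f → Degrees D (λ x → m · f x)
    Degrees-· zero    d = Degrees-const 0#
    Degrees-· (suc m) d = Degrees-+ d (Degrees-· m d)

    -- In (u + pᵐ⁺¹ C)ᵖ the mixed terms have the binomial factor p besides pᵐ⁺¹, and the last term
    -- has the factor p²ᵐ⁺². Up to integers each term is a product of p functions of degree E,
    -- whence p E.
    ↑p-lift : ∀ {E u C} m → Degrees E u → Degrees E C →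
      ∃[ c ] (Degrees (λ l → p * E l) c × (∀ x → (u x ⊞ (p ^ suc m) · C x) ↑ p ≈ u x ↑ p ⊞ (p ^ suc (suc m)) · c x))
    ↑p-lift {E} {u} {C} m du dC =
      let c , (c′ , dc′ , ec) , e = fun-expansion Q Q-resp Q0 Q+ u v term
      in (λ x → c′ x ⊞ w x) , Degrees-+ dc′ dw , λ x → begin
        (u x ⊞ v x) ↑ p  ≈⟨ e x ⟩
        (u x ↑ p ⊞ v x ↑ p) ⊞ p · c x  ≈⟨ +-cong (+-congˡ (v↑p x)) (×-congʳ p (ec x)) ⟩
        (u x ↑ p ⊞ (p ^ suc (suc m)) · w x) ⊞ p · ((p ^ suc m) · c′ x) ≈⟨ +-congˡ (×-assocˡ (c′ x) p (p ^ suc m)) ⟩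
        (u x ↑ p ⊞ (p ^ suc (suc m)) · w x) ⊞ (p ^ suc (suc m)) · c′ x ≈⟨ solve 3 (λ a b c → (a :+ b) :+ c := a :+ (c :+ b)) ≈-refl _ _ _ ⟩
        u x ↑ p ⊞ ((p ^ suc (suc m)) · c′ x ⊞ (p ^ suc (suc m)) · w x) ≈⟨ +-congˡ (·-distrib (c′ x) (w x) (p ^ suc (suc m))) ⟨
        u x ↑ p ⊞ (p ^ suc (suc m)) · (c′ x ⊞ w x) ∎
      where
      open Solver
      M = p ^ suc m
      v : Fun
      v x = M · C x
      dv : Degrees E v
      dv = Degrees-· M dC
      Q : Fun → Set
      Q f = ∃[ h ] (Degrees (λ l → p * E l) h × (∀ x → f x ≈ M · h x))
      Q-resp : ∀ {f g} → (∀ x → g x ≈ f x) → Q f → Q g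
      Q-resp eq (h , d , e) = h , d , λ x → ≈-trans (eq x) (e x)
      Q0 : Q (λ _ → 0#)
      Q0 = (λ _ → 0#) , Degrees-const 0# , λ x → ≈-sym (·-zero M)
      Q+ : ∀ {f g} → Q f → Q g → Q (λ x → f x ⊞ g x)
      Q+ (h , d , e) (h′ , d′ , e′) = (λ x → h x ⊞ h′ x) , Degrees-+ d d′ , λ x → ≈-trans (+-cong (e x) (e′ x)) (≈-sym (·-distrib (h x) (h′ x) M))
      term : ∀ i j → suc i + suc j ≡ p → Q (λ x → u x ↑ suc i ⊠ v x ↑ suc j)
      term i j eq = (λ x → u x ↑ suc i ⊠ (C x ⊠ v x ↑ j))
        , Degrees-mono (λ l → ℕ.≤-reflexive (trans (sym (ℕ.*-distribʳ-+ (E l) (suc i) (suc j))) (cong (_* E l) eq))) (Degrees-* (Degrees-↑ (suc i) du) (Degrees-* dC (Degrees-↑ j dv)))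
        , λ x → ≈-trans (*-congˡ (×-assoc-* M (C x) (v x ↑ j))) (×-comm-* M (u x ↑ suc i) (C x ⊠ v x ↑ j))
      -- The quotient of (pᵐ⁺¹ C)ᵖ by pᵐ⁺²: two factors pᵐ⁺¹ C are pulled out, and their p²ᵐ⁺² is
      -- split as pᵐ⁺² · pᵐ.
      w : Fun
      w x = (p ^ m) · (C x ⊠ (C x ⊠ v x ↑ (p ∸ 2)))
      p≡ : suc (suc (p ∸ 2)) ≡ p
      p≡ = ℕ.m+[n∸m]≡n 1<p
      dw : Degrees (λ l → p * E l) w
      dw = Degrees-mono (λ l → ℕ.≤-reflexive (cong (_* E l) p≡)) (Degrees-· (p ^ m) (Degrees-* dC (Degrees-* dC (Degrees-↑ (p ∸ 2) dv))))
      v↑p : ∀ x → v x ↑ p ≈ (p ^ suc (suc m)) · w x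
      v↑p x = begin
        v x ↑ p  ≡⟨ cong (v x ↑_) p≡ ⟨
        v x ⊠ (v x ⊠ t)  ≈⟨ *-cong ≈-refl (×-assoc-* M (C x) t) ⟩
        (M · C x) ⊠ (M · (C x ⊠ t))  ≈⟨ ×-assoc-* M (C x) (M · (C x ⊠ t)) ⟩
        M · (C x ⊠ (M · (C x ⊠ t)))  ≈⟨ ×-congʳ M (×-comm-* M (C x) (C x ⊠ t)) ⟩
        M · (M · s)  ≈⟨ ×-assocˡ s M M ⟩
        (M * M) · s  ≡⟨ cong (_· s) (lem p (p ^ m)) ⟩
        (p ^ suc (suc m) * p ^ m) · s  ≈⟨ ×-assocˡ s (p ^ suc (suc m)) (p ^ m) ⟨
        (p ^ suc (suc m)) · w x ∎
        where
        t = v x ↑ (p ∸ 2)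
        s = C x ⊠ (C x ⊠ t)
        lem : ∀ p a → (p * a) * (p * a) ≡ p * (p * a) * a
        lem = solve-∀

    -- A lift of f^(pʲ) that applies T to each monomial separately. Unlike T(f^(pʲ)) it has a
    -- visible degree, and both have the same image under `ε`.
    terms : ∀ {D f} → Poly.Span D f → ℕ → Fun
    terms (Poly.mono c e _ _) j x = T ((c F.⊠ evalMono F e x) F.↑ (p ^ j))
    terms (Poly.add s t _)    j x = terms s j x ⊞ terms t j x

    ε-terms : ∀ {D f} (s : Poly.Span D f) j x → ε (terms s j x) ≡ f x F.↑ (p ^ j)
    ε-terms (Poly.mono c e _ h) j x = trans (ε-T _) (cong (F._↑ (p ^ j)) (sym (h x)))
    ε-terms (Poly.add s t h)    j x = trans (ε-⊞ _ _) (trans (cong₂ F._⊞_ (ε-terms s j x) (ε-terms t j x)) (trans (sym (frobenius-+^ j _ _)) (cong (F._↑ (p ^ j)) (sym (h x)))))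

    -- A pʲ-th power composed with `frob l` multiplies exponents by pʲ⁺ˡ; since x^(pᵏ) = x, only j +
    -- l modulo k matters.
    Exponent : ℕ → ℕ → ℕ → ℕ
    Exponent D j l = p ^ ((j + l) % k) * D

    Degrees-terms : ∀ {D f} (s : Poly.Span D f) j → Degrees (Exponent D j) (terms s j)
    Degrees-terms {D} (Poly.mono c e d _) j = degrees λ l → let ρ = (j + l) % k in mono (T (c F.↑ (p ^ j))) (map (p ^ ρ *_) e)
      (ℕ.≤-trans (ℕ.≤-reflexive (mdeg-* (p ^ ρ) e)) (ℕ.*-monoʳ-≤ (p ^ ρ) d))
      (λ x → ≈-trans (reflexive (cong T (trans (F.^-distrib-* c _ (p ^ j)) (cong (c F.↑ (p ^ j) F.⊠_) (eq l x))))) (T-* _ _))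
      where
      eq : ∀ l x → evalMono F e (frob l x) F.↑ (p ^ j) ≡ evalMono F (map (p ^ ((j + l) % k) *_) e) x
      eq l x = let ρ = (j + l) % k in trans (cong (F._↑ (p ^ j)) (evalMono-↑′ (p ^ l) e x)) (trans (sym (↑p^+ _ l j)) (trans (cong (λ z → evalMono F e x F.↑ (p ^ z)) (ℕ.+-comm l j))
        (trans (↑p^-% _ (j + l)) (trans (sym (evalMono-↑′ (p ^ ρ) e x)) (evalMono-↑ (p ^ ρ) e x)))))
    Degrees-terms (Poly.add s t _) j = Degrees-+ (Degrees-terms s j) (Degrees-terms t j)

    -- On a single monomial T commutes with p-th powers, so only the mixed terms of the p-th power
    -- of a sum remain, all divisible by p.
    terms-↑p : ∀ {D f} (s : Poly.Span D f) j → ∃[ c ] (Degrees (λ l → p * Exponent D j l) c × (∀ x → terms s j x ↑ p ≈ terms s (suc j) x ⊞ p · c x))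
    terms-↑p (Poly.mono c e _ _) j = (λ _ → 0#) , Degrees-const 0# , λ x → begin
      T (y x F.↑ (p ^ j)) ↑ p  ≈⟨ T-↑ (y x F.↑ (p ^ j)) p ⟨
      T ((y x F.↑ (p ^ j)) F.↑ p)  ≡⟨ cong T (trans (F.^-assocʳ (y x) (p ^ j) p) (cong (y x F.↑_) (ℕ.*-comm (p ^ j) p))) ⟩
      T (y x F.↑ (p ^ suc j))  ≈⟨ +-identityʳ _ ⟨
      T (y x F.↑ (p ^ suc j)) ⊞ 0#  ≈⟨ +-congˡ (·-zero p) ⟨
      T (y x F.↑ (p ^ suc j)) ⊞ p · 0# ∎
      where
      y : Vec K n → K
      y x = c F.⊠ evalMono F e x
    terms-↑p {D} (Poly.add s t _) j =
      let c₁ , d₁ , e₁ = terms-↑p s j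
          c₂ , d₂ , e₂ = terms-↑p t j
          c₀ , d₀ , e₀ = fun-expansion (Degrees (λ l → p * Exponent D j l)) Degrees-resp (Degrees-const 0#) Degrees-+ (terms s j) (terms t j) term
      in (λ x → (c₁ x ⊞ c₂ x) ⊞ c₀ x) , Degrees-+ (Degrees-+ d₁ d₂) d₀ , λ x → begin
        (terms s j x ⊞ terms t j x) ↑ p  ≈⟨ e₀ x ⟩
        (terms s j x ↑ p ⊞ terms t j x ↑ p) ⊞ p · c₀ x  ≈⟨ +-congʳ (+-cong (e₁ x) (e₂ x)) ⟩
        ((terms s (suc j) x ⊞ p · c₁ x) ⊞ (terms t (suc j) x ⊞ p · c₂ x)) ⊞ p · c₀ x
          ≈⟨ solve 5 (λ a b c d e → ((a :+ b) :+ (c :+ d)) :+ e := (a :+ c) :+ ((b :+ d) :+ e)) ≈-refl (terms s (suc j) x) (p · c₁ x) (terms t (suc j) x) (p · c₂ x) (p · c₀ x) ⟩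
        (terms s (suc j) x ⊞ terms t (suc j) x) ⊞ ((p · c₁ x ⊞ p · c₂ x) ⊞ p · c₀ x)
          ≈⟨ +-congˡ (≈-trans (·-distrib (c₁ x ⊞ c₂ x) (c₀ x) p) (+-congʳ (·-distrib (c₁ x) (c₂ x) p))) ⟨
        (terms s (suc j) x ⊞ terms t (suc j) x) ⊞ p · ((c₁ x ⊞ c₂ x) ⊞ c₀ x) ∎
      where
      open Solver
      term : ∀ a b → suc a + suc b ≡ p → Degrees (λ l → p * Exponent D j l) (λ x → terms s j x ↑ suc a ⊠ terms t j x ↑ suc b)
      term a b eq = Degrees-mono (λ l → ℕ.≤-reflexive (trans (sym (ℕ.*-distribʳ-+ (Exponent D j l) (suc a) (suc b))) (cong (_* Exponent D j l) eq)))
        (Degrees-* (Degrees-↑ (suc a) (Degrees-terms s j)) (Degrees-↑ (suc b) (Degrees-terms t j)))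

    Exponent-suc : ∀ D j l → Exponent D (suc j) l ≤ p * Exponent D j l
    Exponent-suc D j l = ℕ.≤-trans (ℕ.*-monoˡ-≤ D (ℕ.^-monoʳ-≤ p (%-suc (j + l)))) (ℕ.≤-reflexive (ℕ.*-assoc p (p ^ ((j + l) % k)) D))
      where
      %-suc : ∀ m → suc m % k ≤ suc (m % k)
      %-suc m = ℕ.≤-trans (ℕ.≤-reflexive (trans (cong (λ z → suc z % k) (m≡m%n+[m/n]*n m k)) ([m+kn]%n≡m%n (suc (m % k)) (m ℕ./ k) k))) (m%n≤m (suc (m % k)) k)

    -- Induction on i: raising the relation to the p-th power gains one factor p in the error, by
    -- `↑p-lift`.
    terms-↑p^ : ∀ {D f} (s : Poly.Span D f) i j →
      ∃[ c ] (Degrees (λ l → p ^ suc i * Exponent D j l) c × (∀ x → terms s j x ↑ (p ^ suc i) ≈ terms s (suc j) x ↑ (p ^ i) ⊞ (p ^ suc i) · c x))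
    terms-↑p^ {D} s zero j =
      let c , d , e = terms-↑p s j
      in c , Degrees-mono (λ l → ℕ.≤-reflexive (cong (_* Exponent D j l) (sym (ℕ.*-identityʳ p)))) d , λ x → begin
        terms s j x ↑ (p * 1)  ≡⟨ cong (terms s j x ↑_) (ℕ.*-identityʳ p) ⟩
        terms s j x ↑ p  ≈⟨ e x ⟩
        terms s (suc j) x ⊞ p · c x  ≈⟨ +-cong (≈-sym (*-identityʳ _)) (reflexive (cong (_· c x) (sym (ℕ.*-identityʳ p)))) ⟩
        terms s (suc j) x ↑ 1 ⊞ (p * 1) · c x ∎
    terms-↑p^ {D} s (suc i) j =
      let C , dC , e = terms-↑p^ s i j
          c , dc , e′ = ↑p-lift i (Degrees-mono bound (Degrees-↑ (p ^ i) (Degrees-terms s (suc j)))) dC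
      in c , Degrees-mono (λ l → ℕ.≤-reflexive (sym (ℕ.*-assoc p (p ^ suc i) (Exponent D j l)))) dc , λ x → begin
        terms s j x ↑ (p * p ^ suc i)  ≈⟨ ↑-comm (terms s j x) (p ^ suc i) ⟨
        (terms s j x ↑ (p ^ suc i)) ↑ p  ≈⟨ ^-congˡ p (e x) ⟩
        (terms s (suc j) x ↑ (p ^ i) ⊞ (p ^ suc i) · C x) ↑ p  ≈⟨ e′ x ⟩
        (terms s (suc j) x ↑ (p ^ i)) ↑ p ⊞ (p ^ suc (suc i)) · c x  ≈⟨ +-congʳ (↑-comm (terms s (suc j) x) (p ^ i)) ⟩
        terms s (suc j) x ↑ (p ^ suc i) ⊞ (p ^ suc (suc i)) · c x ∎
      where
      ↑-comm : ∀ a m → (a ↑ m) ↑ p ≈ a ↑ (p * m)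
      ↑-comm a m = ≈-trans (^-assocʳ a m p) (reflexive (cong (a ↑_) (ℕ.*-comm m p)))
      bound : ∀ l → p ^ i * Exponent D (suc j) l ≤ p ^ suc i * Exponent D j l
      bound l = ℕ.≤-trans (ℕ.*-monoʳ-≤ (p ^ i) (Exponent-suc D j l)) (ℕ.≤-reflexive (lem p (p ^ i) (Exponent D j l)))
        where
        lem : ∀ p a b → a * (p * b) ≡ p * a * b
        lem = solve-∀

    -- At most e of the l < k are exceptional: either e ≥ k and p^e kills g, or some l bounds the degree of g ∘ frob l.
    data Weighted (D : ℕ → ℕ) (f : Fun) : Set where
      gen : ∀ (S : ℕ → Bool) (e : ℕ) (g : Fun) → count k S ≤ e → (∀ l → l < k → S l ≡ false → Span (D l) (λ x → g (frob l x))) → (∀ x → f x ≈ (p ^ e) · g x) → Weighted D f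
      add : ∀ {g h : Fun} → Weighted D g → Weighted D h → (∀ x → f x ≈ g x ⊞ h x) → Weighted D f

    Weighted-resp : ∀ {D f g} → (∀ x → g x ≈ f x) → Weighted D f → Weighted D g
    Weighted-resp eq (gen S e g c d h) = gen S e g c d (λ x → ≈-trans (eq x) (h x))
    Weighted-resp eq (add s t h)       = add s t (λ x → ≈-trans (eq x) (h x))

    Weighted-mono : ∀ {D E f} → (∀ l → D l ≤ E l) → Weighted D f → Weighted E f
    Weighted-mono le (gen S e g c d h) = gen S e g c (λ l l<k s → Span-mono (le l) (d l l<k s)) h
    Weighted-mono le (add s t h)       = add (Weighted-mono le s) (Weighted-mono le t) h

    Weighted-Degrees : ∀ {D f} → Degrees D f → Weighted D f
    Weighted-Degrees {f = f} d = gen (λ _ → false) 0 f (ℕ.≤-reflexive (count-false k)) (λ l _ _ → span d l) (λ x → ≈-sym (+-identityʳ _))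

    Weighted-* : ∀ {D E f g} → Weighted D f → Weighted E g → Weighted (λ l → D l + E l) (λ x → f x ⊠ g x)
    Weighted-* (gen S e g c d h) (gen S′ e′ g′ c′ d′ h′) =
      gen (λ l → S l ∨ S′ l) (e + e′) (λ x → g x ⊠ g′ x) (ℕ.≤-trans (count-∨ k S S′) (ℕ.+-mono-≤ c c′))
        (λ l l<k s → Span-* (d l l<k (left (S l) s)) (d′ l l<k (right (S l) s)))
        (λ x → begin
          _ ⊠ _  ≈⟨ *-cong (h x) (h′ x) ⟩
          ((p ^ e) · g x) ⊠ ((p ^ e′) · g′ x)  ≈⟨ ×-assoc-* (p ^ e) (g x) ((p ^ e′) · g′ x) ⟩
          (p ^ e) · (g x ⊠ ((p ^ e′) · g′ x))  ≈⟨ ×-congʳ (p ^ e) (×-comm-* (p ^ e′) (g x) (g′ x)) ⟩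
          (p ^ e) · ((p ^ e′) · (g x ⊠ g′ x))  ≈⟨ ×-assocˡ (g x ⊠ g′ x) (p ^ e) (p ^ e′) ⟩
          (p ^ e * p ^ e′) · (g x ⊠ g′ x)  ≡⟨ cong (_· (g x ⊠ g′ x)) (ℕ.^-distribˡ-+-* p e e′) ⟨
          (p ^ (e + e′)) · (g x ⊠ g′ x) ∎)
      where
      left : ∀ a {b} → a ∨ b ≡ false → a ≡ false
      left false eq = refl
      right : ∀ a {b} → a ∨ b ≡ false → b ≡ false
      right false eq = eq
    Weighted-* s@(gen _ _ _ _ _ _) (add t u h′) = add (Weighted-* s t) (Weighted-* s u) (λ x → ≈-trans (*-congˡ (h′ x)) (distribˡ _ _ _))
    Weighted-* (add s t h) u = add (Weighted-* s u) (Weighted-* t u) (λ x → ≈-trans (*-congʳ (h x)) (distribʳ _ _ _))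

    Weighted-↑ : ∀ {D f} r → Weighted D f → Weighted (λ l → r * D l) (λ x → f x ↑ r)
    Weighted-↑ zero    s = Weighted-Degrees (Degrees-const 1#)
    Weighted-↑ (suc r) s = Weighted-* s (Weighted-↑ r s)

    -- One p-th power is traded for a step in j, with a correction pⁱ c whose degree at twist l is
    -- p^(i + (j + l) % k) D. This is the required degree unless adding i to j + l wraps around
    -- modulo k, which happens for at most i of the twists; these form `S`.
    Weighted-terms : ∀ {D f} (s : Poly.Span D f) i j → Weighted (λ l → p ^ ((j + i + l) % k) * D) (λ x → terms s j x ↑ (p ^ i))
    Weighted-terms {D} s zero j = Weighted-resp (λ x → *-identityʳ _)
      (Weighted-mono (λ l → ℕ.≤-reflexive (cong (λ z → p ^ ((z + l) % k) * D) (sym (ℕ.+-identityʳ j)))) (Weighted-Degrees (Degrees-terms s j)))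
    Weighted-terms {D} s (suc i) j =
      let c , d , e = terms-↑p^ s i j
      in add (Weighted-mono (λ l → ℕ.≤-reflexive (cong (λ z → p ^ ((z + l) % k) * D) (sym (ℕ.+-suc j i)))) (Weighted-terms s i (suc j)))
        (gen S (suc i) c (count-rotate k (j + suc i) (suc i)) (λ l l<k s → Span-mono (ℕ.≤-reflexive (bound l s)) (span d l)) (λ x → ≈-refl)) e
      where
      S : ℕ → Bool
      S l = (j + suc i + l) % k <ᵇ suc i
      bound : ∀ l → S l ≡ false → p ^ suc i * Exponent D j l ≡ p ^ ((j + suc i + l) % k) * D
      bound l eq = trans (sym (ℕ.*-assoc (p ^ suc i) (p ^ ((j + l) % k)) D)) (cong (_* D)
        (trans (sym (ℕ.^-distribˡ-+-* p (suc i) ((j + l) % k))) (cong (p ^_) (trans (ℕ.+-comm (suc i) ((j + l) % k)) (sym no-wrap)))))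
        where
        reassoc : j + suc i + l ≡ j + l + suc i
        reassoc = lem j (suc i) l
          where
          lem : ∀ a b c → a + b + c ≡ a + c + b
          lem = solve-∀
        large : suc i ≤ (j + l + suc i) % k
        large = ℕ.≮⇒≥ (λ lt → subst Bool.T (trans (cong (λ z → z % k <ᵇ suc i) (sym reassoc)) eq) (ℕ.<⇒<ᵇ lt))
        no-wrap : (j + suc i + l) % k ≡ (j + l) % k + suc i
        no-wrap = trans (cong (_% k) reassoc) (%-no-wrap k (j + l) (suc i) large)

    -- From x^(pᵏ) = x one gets T(f)^(pᵗ) = T(f^(pᵗ⁺¹))^(pᵏ⁻¹). Elements with the same image under
    -- `ε` have equal pᵏ⁻¹-th powers, so T(f^(pᵗ⁺¹)) may be replaced by `terms`, whose degree is
    -- known.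
    Weighted-T↑ : ∀ {D f} → Poly.Span D f → ∀ t → Weighted (λ l → p ^ ((t + l) % k) * D) (λ x → T (f x) ↑ (p ^ t))
    Weighted-T↑ {D} {f} s t = Weighted-resp eq
      (Weighted-mono (λ l → ℕ.≤-reflexive (cong (λ z → p ^ z * D) (index l))) (Weighted-terms s (k ∸ 1) (suc t)))
      where
      k≡ : suc (k ∸ 1) ≡ k
      k≡ = ℕ.m+[n∸m]≡n 0<k
      index : ∀ l → (suc t + (k ∸ 1) + l) % k ≡ (t + l) % k
      index l = trans (cong (_% k) (trans (lem t (k ∸ 1) l) (cong (t + l +_) k≡))) ([m+n]%n≡m%n (t + l) k)
        where
        lem : ∀ t c l → suc t + c + l ≡ t + l + suc c
        lem = solve-∀
      eq : ∀ x → T (f x) ↑ (p ^ t) ≈ terms s (suc t) x ↑ (p ^ (k ∸ 1))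
      eq x = begin
        T (f x) ↑ (p ^ t)  ≈⟨ T-↑ (f x) (p ^ t) ⟨
        T (f x F.↑ (p ^ t))  ≡⟨ cong T (↑p^k (f x F.↑ (p ^ t))) ⟨
        T ((f x F.↑ (p ^ t)) F.↑ (p ^ k))  ≡⟨ cong T (↑p^+ (f x) t k) ⟨
        T (f x F.↑ (p ^ (t + k)))  ≡⟨ cong (λ z → T (f x F.↑ (p ^ z))) (trans (cong (t +_) (sym k≡)) (ℕ.+-suc t (k ∸ 1))) ⟩
        T (f x F.↑ (p ^ (suc t + (k ∸ 1))))  ≡⟨ cong T (↑p^+ (f x) (suc t) (k ∸ 1)) ⟩
        T ((f x F.↑ (p ^ suc t)) F.↑ (p ^ (k ∸ 1)))  ≈⟨ T-↑ (f x F.↑ (p ^ suc t)) (p ^ (k ∸ 1)) ⟩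
        T (f x F.↑ (p ^ suc t)) ↑ (p ^ (k ∸ 1))  ≈⟨ ε-approx (trans (ε-T _) (sym (ε-terms s (suc t) x))) ⟩
        terms s (suc t) x ↑ (p ^ (k ∸ 1)) ∎

    -- The number pʲ - 1, whose j digits in base p all equal p - 1.
    digits : ℕ → ℕ
    digits j = sumTo j (λ t → p ^ t * (p ∸ 1))

    suc-digits : ∀ j → suc (digits j) ≡ p ^ j
    suc-digits zero    = refl
    suc-digits (suc j) = trans (sym (ℕ.+-suc (p ^ j * (p ∸ 1)) (digits j))) (trans (cong (p ^ j * (p ∸ 1) +_) (suc-digits j))
      (trans (lem (p ^ j) (p ∸ 1)) (cong (_* p ^ j) (ℕ.m+[n∸m]≡n (ℕ.<⇒≤ 1<p)))))
      where
      lem : ∀ a b → a * b + a ≡ (1 + b) * a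
      lem = solve-∀

    Weighted-digits : ∀ {D f} → Poly.Span D f → ∀ j → Weighted (λ l → sumTo j (λ t → (p ∸ 1) * (p ^ ((t + l) % k) * D))) (λ x → T (f x) ↑ digits j)
    Weighted-digits s zero    = Weighted-Degrees (Degrees-const 1#)
    Weighted-digits {D} {f} s (suc j) = Weighted-resp
      (λ x → ≈-trans (^-homo-* (T (f x)) (p ^ j * (p ∸ 1)) (digits j)) (*-congʳ (≈-sym (^-assocʳ (T (f x)) (p ^ j) (p ∸ 1)))))
      (Weighted-* (Weighted-↑ (p ∸ 1) (Weighted-T↑ s j)) (Weighted-digits s j))

    -- T(f)^(q-1) is the product over t < k of (T(f)^(p^t))^(p-1), and composing with frob l permutes the degrees of these factors cyclically.
    Weighted-T↑[q-1] : ∀ {D f} → Poly.Span D f → Weighted (λ _ → (q ∸ 1) * D) (λ x → T (f x) ↑ (q ∸ 1))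
    Weighted-T↑[q-1] {D} {f} s = Weighted-resp (λ x → reflexive (cong (T (f x) ↑_) q-1≡))
      (Weighted-mono (λ l → ℕ.≤-reflexive (total l)) (Weighted-digits s k))
      where
      q-1≡ : q ∸ 1 ≡ digits k
      q-1≡ = cong (_∸ 1) (trans q≡p^k (sym (suc-digits k)))
      total : ∀ l → sumTo k (λ t → (p ∸ 1) * (p ^ ((t + l) % k) * D)) ≡ (q ∸ 1) * D
      total l = ≡R.begin
        sumTo k (λ t → (p ∸ 1) * (p ^ ((t + l) % k) * D))  ≡R.≡⟨ sumTo-cong k (λ t _ → lem (p ∸ 1) (p ^ ((t + l) % k)) D) ⟩
        sumTo k (λ t → D * (p ^ ((t + l) % k) * (p ∸ 1)))  ≡R.≡⟨ sumTo-* k D _ ⟩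
        D * sumTo k (λ t → p ^ ((t + l) % k) * (p ∸ 1))  ≡R.≡⟨ cong (D *_) (sumTo-rotate k (λ t → p ^ (t % k) * (p ∸ 1)) (λ m → cong (λ z → p ^ z * (p ∸ 1)) ([m+n]%n≡m%n m k)) l) ⟩
        D * sumTo k (λ t → p ^ (t % k) * (p ∸ 1))  ≡R.≡⟨ cong (D *_) (sumTo-cong k (λ t t<k → cong (λ z → p ^ z * (p ∸ 1)) (m<n⇒m%n≡m t<k))) ⟩
        D * digits k  ≡R.≡⟨ trans (cong (D *_) (sym q-1≡)) (ℕ.*-comm D (q ∸ 1)) ⟩
        (q ∸ 1) * D  ≡R.∎
        where
        module ≡R = ≡-Reasoning
        lem : ∀ a b c → a * (b * c) ≡ c * (b * a)
        lem = solve-∀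

    Weighted-1-T↑ : ∀ {D f} → Poly.Span D f → Weighted (λ _ → (q ∸ 1) * D) (λ x → 1# ⊞ ⊟ (T (f x) ↑ (q ∸ 1)))
    Weighted-1-T↑ s = add (Weighted-Degrees (Degrees-const 1#)) (Weighted-* {D = λ _ → 0} (Weighted-Degrees (Degrees-const (⊟ 1#))) (Weighted-T↑[q-1] s))
      (λ x → +-congˡ (≈-sym (≈-trans (≈-sym (-‿distribˡ-* 1# _)) (-‿cong (*-identityˡ _)))))

  module ΣB = F.Sum +-commutativeMonoid
  open ΣB using (∑; ∑ᵛ)

  0<q∸1 : 0 < q ∸ 1
  0<q∸1 = ℕ.≤-trans (ℕ.≤-trans (ℕ.∸-monoˡ-≤ 1 1<p) (ℕ.∸-monoˡ-≤ 1 (ℕ.m≤m*n p (p ^ (k ∸ 1)) {{ℕ.m^n≢0 p (k ∸ 1)}})))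
    (ℕ.≤-reflexive (cong (_∸ 1) (sym (trans q≡p^k (cong (p ^_) (sym (ℕ.m+[n∸m]≡n 0<k)))))))

  ∑-⊠ : ∀ c f → ∑ (λ x → c ⊠ f x) ≈ c ⊠ ∑ f
  ∑-⊠ c f = ≈-sym (*-distribˡ-sum c (λ i → f (F.from i)))
    where open import Algebra.Properties.Semiring.Sum semiring using (*-distribˡ-sum)

  -- For e = 0 the sum is q · 1 = 0. Otherwise some h ≠ 0 has hᵉ ≠ 1; replacing x by h x multiplies
  -- the sum by T(hᵉ), and 1 - T(hᵉ) can be cancelled.
  ∑-T↑ : ∀ e → e < q ∸ 1 → ∑ (λ x → T (x F.↑ e)) ≈ 0#
  ∑-T↑ zero    _    = ≈-trans (ΣB.∑-constant (T F.1#)) (≈-trans (reflexive (cong (_· T F.1#) q≡p^k)) (p^k· (T F.1#)))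
  ∑-T↑ e@(suc _) e<q =
    let h , h≢0 , h^e≢1 = F.∃-nontrivial-power e (s≤s z≤n) (ℕ.≤-trans (s≤s e<q) (ℕ.≤-reflexive (ℕ.m+[n∸m]≡n F.0<q)))
    in cancel h^e≢1 (begin
      (1# ⊞ ⊟ T (h F.↑ e)) ⊠ s  ≈⟨ ≈-trans (distribʳ s 1# (⊟ T (h F.↑ e))) (+-cong (*-identityˡ s) (≈-sym (-‿distribˡ-* (T (h F.↑ e)) s))) ⟩
      s ⊞ ⊟ (T (h F.↑ e) ⊠ s)  ≈⟨ +-congˡ (-‿cong (dilate h h≢0)) ⟨
      s ⊞ ⊟ s  ≈⟨ -‿inverseʳ s ⟩
      0# ∎)
    where
    s = ∑ (λ x → T (x F.↑ e))
    dilate : ∀ h → h ≢ F.0# → s ≈ T (h F.↑ e) ⊠ s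
    dilate h h≢0 = begin
      s  ≈⟨ ΣB.∑-dilate h≢0 (λ x → T (x F.↑ e)) ⟨
      ∑ (λ x → T ((h F.⊠ x) F.↑ e))  ≈⟨ ΣB.∑-cong (λ x → ≈-trans (reflexive (cong T (F.^-distrib-* h x e))) (T-* _ _)) ⟩
      ∑ (λ x → T (h F.↑ e) ⊠ T (x F.↑ e))  ≈⟨ ∑-⊠ (T (h F.↑ e)) (λ x → T (x F.↑ e)) ⟩
      T (h F.↑ e) ⊠ s ∎

  ∑ᵛ-0 : ∀ m → ∑ᵛ m (λ _ → 0#) ≈ 0#
  ∑ᵛ-0 m = ΣB.∑ᵛ-single m (λ _ → 0#) (replicate m F.0#) (λ _ _ → ≈-refl)

  -- The sum factors over the coordinates, so it vanishes as soon as one exponent is below q - 1;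
  -- otherwise each variable contributes at least q - 1 to the degree.
  ∑ᵛ-monomial : ∀ {m} (u : Vec ℕ m) → (∀ c → ∑ᵛ m (λ x → c ⊠ T (evalMono F u x)) ≈ 0#) ⊎ (q ∸ 1) * m ≤ mdeg F u
  ∑ᵛ-monomial [] = inj₂ (ℕ.≤-reflexive (ℕ.*-zeroʳ (q ∸ 1)))
  ∑ᵛ-monomial {suc m} (e ∷ u) with e ℕ.<? (q ∸ 1) | ∑ᵛ-monomial u
  ... | yes e<q | _ = inj₁ (λ c → begin
    ∑ (λ x → ∑ᵛ m (λ xs → c ⊠ T (_^ᶠ_ F x e F.⊠ evalMono F u xs)))  ≈⟨ ΣB.∑-∑ᵛ-swap m (λ x xs → c ⊠ T (_^ᶠ_ F x e F.⊠ evalMono F u xs)) ⟩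
    ∑ᵛ m (λ xs → ∑ (λ x → c ⊠ T (_^ᶠ_ F x e F.⊠ evalMono F u xs)))  ≈⟨ ΣB.∑ᵛ-cong m (λ xs → inner c xs) ⟩
    ∑ᵛ m (λ _ → 0#)  ≈⟨ ∑ᵛ-0 m ⟩
    0# ∎)
    where
    inner : ∀ c xs → ∑ (λ x → c ⊠ T (_^ᶠ_ F x e F.⊠ evalMono F u xs)) ≈ 0#
    inner c xs = begin
      ∑ (λ x → c ⊠ T (_^ᶠ_ F x e F.⊠ M))  ≈⟨ ΣB.∑-cong (λ x → ≈-trans (*-congˡ (≈-trans (reflexive (cong (λ z → T (z F.⊠ M)) (^ᶠ≡↑ x e))) (T-* _ _))) (solve 3 (λ a b c → a :* (b :* c) := (a :* c) :* b) ≈-refl c (T (x F.↑ e)) (T M))) ⟩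
      ∑ (λ x → (c ⊠ T M) ⊠ T (x F.↑ e))  ≈⟨ ∑-⊠ (c ⊠ T M) (λ x → T (x F.↑ e)) ⟩
      (c ⊠ T M) ⊠ ∑ (λ x → T (x F.↑ e))  ≈⟨ ≈-trans (*-congˡ (∑-T↑ e e<q)) (zeroʳ _) ⟩
      0# ∎
      where
      open Solver
      M = evalMono F u xs
  ... | no e≮q | inj₁ h = inj₁ (λ c → ≈-trans (ΣB.∑-cong (λ x → ≈-trans
      (ΣB.∑ᵛ-cong m (λ xs → ≈-trans (*-congˡ (T-* _ _)) (≈-sym (*-assoc c _ _)))) (h (c ⊠ T (_^ᶠ_ F x e))))) (ΣB.∑-single (λ _ → 0#) F.0# (λ _ _ → ≈-refl)))
  ... | no e≮q | inj₂ h = inj₂ (ℕ.≤-trans (ℕ.≤-reflexive (ℕ.*-suc (q ∸ 1) m)) (ℕ.+-mono-≤ (ℕ.≮⇒≥ e≮q) h))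

  -- The first coordinate selects a member of a family of parallel flats, the others parametrise it.
  -- Comparing 0 with 1 suffices, as any two parallel flats are these two members of a suitable
  -- family.
  Independent : ∀ {d} → (Vec K (suc d) → A) → Set
  Independent {d} f = ∑ᵛ d (λ x → f (F.0# ∷ x)) ≈ ∑ᵛ d (λ x → f (F.1# ∷ x))

  Independent-+ : ∀ {d} {f g h : Vec K (suc d) → A} → Independent g → Independent h → (∀ x → f x ≈ g x ⊞ h x) → Independent f
  Independent-+ {d} {f} {g} {h} i j e = ≈-trans (lem F.0#) (≈-trans (+-cong i j) (≈-sym (lem F.1#)))
    where
    lem : ∀ a → ∑ᵛ d (λ x → f (a ∷ x)) ≈ ∑ᵛ d (λ x → g (a ∷ x)) ⊞ ∑ᵛ d (λ x → h (a ∷ x))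
    lem a = ≈-trans (ΣB.∑ᵛ-cong d (λ x → e (a ∷ x))) (ΣB.∑ᵛ-+ d (λ x → g (a ∷ x)) (λ x → h (a ∷ x)))

  -- Either the sum over the last d variables vanishes, or these variables already use up the degree
  -- (q - 1) d and the first one does not occur.
  Span-independent : ∀ {d} {f : Vec K (suc d) → A} → Span ((q ∸ 1) * d) f → Independent f
  Span-independent (add s t h) = Independent-+ (Span-independent s) (Span-independent t) h
  Span-independent {d} {f} (mono c (e ∷ u) deg h) with ∑ᵛ-monomial u
  ... | inj₁ z = ≈-trans (lem F.0#) (≈-sym (lem F.1#))
    where
    lem : ∀ a → ∑ᵛ d (λ x → f (a ∷ x)) ≈ 0#
    lem a = ≈-trans (ΣB.∑ᵛ-cong d (λ x → ≈-trans (h (a ∷ x)) (≈-trans (*-congˡ (T-* _ _)) (≈-sym (*-assoc c _ _))))) (z (c ⊠ T (_^ᶠ_ F a e)))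
  ... | inj₂ full = ΣB.∑ᵛ-cong d (λ x → ≈-trans (h (F.0# ∷ x)) (≈-trans (*-congˡ (reflexive (cong (λ z → T (z F.⊠ evalMono F u x)) (eq e≡0)))) (≈-sym (h (F.1# ∷ x)))))
    where
    e≡0 : e ≡ 0
    e≡0 = ℕ.n≤0⇒n≡0 (ℕ.+-cancelʳ-≤ (mdeg F u) e 0 (ℕ.≤-trans deg full))
    eq : e ≡ 0 → _^ᶠ_ F F.0# e ≡ _^ᶠ_ F F.1# e
    eq refl = refl

  -- Composition with `frob l` permutes each of the two flats, because x ↦ x^(pˡ) is a bijection of
  -- F that fixes 0 and 1. So the sums of g may be computed from any unexceptional twist.
  Weighted-independent : ∀ {d} {f : Vec K (suc d) → A} → Weighted (λ _ → (q ∸ 1) * d) f → Independent f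
  Weighted-independent (add s t h) = Independent-+ (Weighted-independent s) (Weighted-independent t) h
  Weighted-independent {d} {f} (gen S e g c sp h) with count-search k S
  ... | inj₂ k≤ = ΣB.∑ᵛ-cong d (λ x → ≈-trans (zero′ (F.0# ∷ x)) (≈-sym (zero′ (F.1# ∷ x))))
    where
    zero′ : ∀ x → f x ≈ 0#
    zero′ x = begin
      f x  ≈⟨ h x ⟩
      (p ^ e) · g x  ≡⟨ cong (λ z → (p ^ z) · g x) (ℕ.m+[n∸m]≡n (ℕ.≤-trans k≤ c)) ⟨
      (p ^ (k + (e ∸ k))) · g x  ≡⟨ cong (_· g x) (ℕ.^-distribˡ-+-* p k (e ∸ k)) ⟩
      (p ^ k * p ^ (e ∸ k)) · g x  ≈⟨ ×-assocˡ (g x) (p ^ k) (p ^ (e ∸ k)) ⟨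
      (p ^ k) · ((p ^ (e ∸ k)) · g x)  ≈⟨ p^k· _ ⟩
      0# ∎
  ... | inj₁ (l , l<k , s) = ≈-trans (lem F.0# (F.↑-zero (ℕ.m^n>0 p l))) (≈-trans (×-congʳ (p ^ e) (Span-independent (sp l l<k s))) (≈-sym (lem F.1# (F.1↑ (p ^ l)))))
    where
    ∑ᵛ-· : ∀ m (f : Vec K d → A) → ∑ᵛ d (λ x → m · f x) ≈ m · ∑ᵛ d f
    ∑ᵛ-· zero    f = ∑ᵛ-0 d
    ∑ᵛ-· (suc m) f = ≈-trans (ΣB.∑ᵛ-+ d f (λ x → m · f x)) (+-congˡ (∑ᵛ-· m f))
    inverse : ∀ a b → a + b ≡ k → ∀ x → (x F.↑ (p ^ a)) F.↑ (p ^ b) ≡ x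
    inverse a b eq x = trans (sym (↑p^+ x a b)) (trans (cong (λ z → x F.↑ (p ^ z)) eq) (↑p^k x))
    lem : ∀ a → a F.↑ (p ^ l) ≡ a → ∑ᵛ d (λ x → f (a ∷ x)) ≈ (p ^ e) · ∑ᵛ d (λ x → g (frob l (a ∷ x)))
    lem a fix = begin
      ∑ᵛ d (λ x → f (a ∷ x))  ≈⟨ ΣB.∑ᵛ-cong d (λ x → h (a ∷ x)) ⟩
      ∑ᵛ d (λ x → (p ^ e) · g (a ∷ x))  ≈⟨ ∑ᵛ-· (p ^ e) (λ x → g (a ∷ x)) ⟩
      (p ^ e) · ∑ᵛ d (λ x → g (a ∷ x))  ≈⟨ ×-congʳ (p ^ e) (ΣB.∑ᵛ-bijection d (F._↑ (p ^ l)) (F._↑ (p ^ (k ∸ l))) (inverse (k ∸ l) l (ℕ.m∸n+n≡m (ℕ.<⇒≤ l<k))) (inverse l (k ∸ l) (ℕ.m+[n∸m]≡n (ℕ.<⇒≤ l<k))) (λ x → g (a ∷ x))) ⟨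
      (p ^ e) · ∑ᵛ d (λ x → g (a ∷ frob l x))  ≡⟨ cong (λ b → (p ^ e) · ∑ᵛ d (λ x → g (b ∷ frob l x))) fix ⟨
      (p ^ e) · ∑ᵛ d (λ x → g (frob l (a ∷ x))) ∎

-- Linear algebra and counting in Fⁿ.

module Vectors {q} (F : FiniteField q) where
  open FieldTheory F public
  open FS

  infixl 6 _∔_
  infixr 7 _◂_

  _∔_ : ∀ {n} → Vec K n → Vec K n → Vec K n
  _∔_ = _⊕_ F

  _◂_ : ∀ {n} → K → Vec K n → Vec K n
  _◂_ = _⊙_ F

  0ᵛ : ∀ {n} → Vec K n
  0ᵛ = zeroV F

  _≟ᵛ_ : ∀ {n} (u v : Vec K n) → Dec (u ≡ v)
  _≟ᵛ_ = Vec.≡-dec _≟_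

  ∔-assoc : ∀ {n} (u v w : Vec K n) → (u ∔ v) ∔ w ≡ u ∔ (v ∔ w)
  ∔-assoc = Vec.zipWith-assoc +-assoc

  ∔-comm : ∀ {n} (u v : Vec K n) → u ∔ v ≡ v ∔ u
  ∔-comm = Vec.zipWith-comm +-comm

  ∔-identityʳ : ∀ {n} (u : Vec K n) → u ∔ 0ᵛ ≡ u
  ∔-identityʳ = Vec.zipWith-identityʳ +-identityʳ

  ∔-identityˡ : ∀ {n} (u : Vec K n) → 0ᵛ ∔ u ≡ u
  ∔-identityˡ = Vec.zipWith-identityˡ +-identityˡ

  ◂-assoc : ∀ {n} a b (u : Vec K n) → (a ⊠ b) ◂ u ≡ a ◂ (b ◂ u)
  ◂-assoc a b []      = refl
  ◂-assoc a b (x ∷ u) = cong₂ _∷_ (*-assoc a b x) (◂-assoc a b u)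

  ◂-distribˡ : ∀ {n} a (u v : Vec K n) → a ◂ (u ∔ v) ≡ (a ◂ u) ∔ (a ◂ v)
  ◂-distribˡ a []      []      = refl
  ◂-distribˡ a (x ∷ u) (y ∷ v) = cong₂ _∷_ (distribˡ a x y) (◂-distribˡ a u v)

  ◂-distribʳ : ∀ {n} a b (u : Vec K n) → (a ⊞ b) ◂ u ≡ (a ◂ u) ∔ (b ◂ u)
  ◂-distribʳ a b []      = refl
  ◂-distribʳ a b (x ∷ u) = cong₂ _∷_ (distribʳ x a b) (◂-distribʳ a b u)

  1◂ : ∀ {n} (u : Vec K n) → 1# ◂ u ≡ u
  1◂ []      = refl
  1◂ (x ∷ u) = cong₂ _∷_ (*-identityˡ x) (1◂ u)

  0◂ : ∀ {n} (u : Vec K n) → 0# ◂ u ≡ 0ᵛ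
  0◂ []      = refl
  0◂ (x ∷ u) = cong₂ _∷_ (zeroˡ x) (0◂ u)

  ◂0ᵛ : ∀ {n} a → a ◂ 0ᵛ {n} ≡ 0ᵛ
  ◂0ᵛ {zero}  a = refl
  ◂0ᵛ {suc n} a = cong₂ _∷_ (zeroʳ a) (◂0ᵛ a)

  ⊝_ : ∀ {n} → Vec K n → Vec K n
  ⊝ u = (⊟ 1#) ◂ u

  ∔-inverseʳ : ∀ {n} (u : Vec K n) → u ∔ ⊝ u ≡ 0ᵛ
  ∔-inverseʳ u = trans (cong (_∔ ⊝ u) (sym (1◂ u))) (trans (sym (◂-distribʳ 1# (⊟ 1#) u)) (trans (cong (_◂ u) (-‿inverseʳ 1#)) (0◂ u)))

  ∔-cancel : ∀ {n} (a u : Vec K n) → a ∔ (u ∔ ⊝ a) ≡ u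
  ∔-cancel a u = trans (∔-comm a (u ∔ ⊝ a)) (trans (∔-assoc u (⊝ a) a) (trans (cong (u ∔_) (trans (∔-comm (⊝ a) a) (∔-inverseʳ a))) (∔-identityʳ u)))

  ∔-interchange : ∀ {n} (a b c d : Vec K n) → (a ∔ b) ∔ (c ∔ d) ≡ (a ∔ c) ∔ (b ∔ d)
  ∔-interchange []      []      []      []      = refl
  ∔-interchange (a ∷ as) (b ∷ bs) (c ∷ cs) (d ∷ ds) =
    cong₂ _∷_ (solve 4 (λ a b c d → (a :+ b) :+ (c :+ d) := (a :+ c) :+ (b :+ d)) refl a b c d) (∔-interchange as bs cs ds)

  ◂-inverse : ∀ {n} {a} → a ≢ 0# → ∃[ b ] (∀ (u : Vec K n) → b ◂ (a ◂ u) ≡ u)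
  ◂-inverse {a = a} a≢0 = let b , ab≡1 = invertible a a≢0 in
    b , λ u → trans (sym (◂-assoc b a u)) (trans (cong (_◂ u) (trans (*-comm b a) ab≡1)) (1◂ u))

  comb : ∀ {n k} → Vec K k → Vec (Vec K n) k → Vec K n
  comb []       []       = 0ᵛ
  comb (c ∷ cs) (v ∷ vs) = (c ◂ v) ∔ comb cs vs

  comb-∔ : ∀ {n k} (bs cs : Vec K k) (vs : Vec (Vec K n) k) → comb (bs ∔ cs) vs ≡ comb bs vs ∔ comb cs vs
  comb-∔ []       []       []       = sym (∔-identityˡ 0ᵛ)
  comb-∔ (b ∷ bs) (c ∷ cs) (v ∷ vs) = trans (cong₂ _∔_ (◂-distribʳ b c v) (comb-∔ bs cs vs)) (∔-interchange (b ◂ v) (c ◂ v) (comb bs vs) (comb cs vs))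

  comb-◂ : ∀ {n k} a (cs : Vec K k) (vs : Vec (Vec K n) k) → comb (a ◂ cs) vs ≡ a ◂ comb cs vs
  comb-◂ a []       []       = sym (◂0ᵛ a)
  comb-◂ a (c ∷ cs) (v ∷ vs) = trans (cong₂ _∔_ (◂-assoc a c v) (comb-◂ a cs vs)) (sym (◂-distribˡ a (c ◂ v) (comb cs vs)))

  comb-0 : ∀ {n k} (vs : Vec (Vec K n) k) → comb 0ᵛ vs ≡ 0ᵛ
  comb-0 []       = refl
  comb-0 (v ∷ vs) = trans (cong₂ _∔_ (0◂ v) (comb-0 vs)) (∔-identityˡ 0ᵛ)

  InSpan : ∀ {n k} → Vec (Vec K n) k → Vec K n → Set
  InSpan vs w = ∃[ cs ] comb cs vs ≡ w

  InSpan? : ∀ {n k} (vs : Vec (Vec K n) k) → Decidable (InSpan vs)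
  InSpan? {k = k} vs w = searchᵛ k (λ cs → comb cs vs ≟ᵛ w)

  InSpan-∔ : ∀ {n k} {vs : Vec (Vec K n) k} {u w} → InSpan vs u → InSpan vs w → InSpan vs (u ∔ w)
  InSpan-∔ {vs = vs} (bs , refl) (cs , refl) = bs ∔ cs , comb-∔ bs cs vs

  InSpan-◂ : ∀ {n k} {vs : Vec (Vec K n) k} {w} a → InSpan vs w → InSpan vs (a ◂ w)
  InSpan-◂ {vs = vs} a (cs , refl) = a ◂ cs , comb-◂ a cs vs

  InSpan-◂⁻¹ : ∀ {n k} {vs : Vec (Vec K n) k} {w a} → a ≢ 0# → InSpan vs (a ◂ w) → InSpan vs w
  InSpan-◂⁻¹ {vs = vs} {w} a≢0 s = let b , eq = ◂-inverse a≢0 in subst (InSpan vs) (eq w) (InSpan-◂ b s)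

  Indep : ∀ {n k} → Vec (Vec K n) k → Set
  Indep []       = ⊤
  Indep (w ∷ vs) = ¬ InSpan vs w × Indep vs

  open ΣF using (∑; ∑ᵛ) public

  ∑ᵛ-mono : ∀ n {f g} → (∀ x → f x ≤ g x) → ∑ᵛ n f ≤ ∑ᵛ n g
  ∑ᵛ-mono zero    h = h []
  ∑ᵛ-mono (suc n) h = ∑-mono (λ x → ∑ᵛ-mono n (λ xs → h (x ∷ xs)))

  ∑ᵛ-* : ∀ n c f → ∑ᵛ n (λ x → c * f x) ≡ c * ∑ᵛ n f
  ∑ᵛ-* zero    c f = refl
  ∑ᵛ-* (suc n) c f = trans (ΣF.∑-cong (λ x → ∑ᵛ-* n c (λ xs → f (x ∷ xs)))) (∑-* c (λ x → ∑ᵛ n (λ xs → f (x ∷ xs))))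

  ∑ᵛ-const : ∀ n c → ∑ᵛ n (λ _ → c) ≡ q ^ n * c
  ∑ᵛ-const zero    c = sym (ℕ.+-identityʳ c)
  ∑ᵛ-const (suc n) c = trans (ΣF.∑-cong (λ _ → ∑ᵛ-const n c)) (trans (∑-const (q ^ n * c)) (sym (ℕ.*-assoc q (q ^ n) c)))

  ∑ᵛ-delta : ∀ n a → ∑ᵛ n (λ x → indicator (x ≟ᵛ a)) ≡ 1
  ∑ᵛ-delta n a = trans (ΣF.∑ᵛ-single n _ a (λ y y≢a → indicator-no (y ≟ᵛ a) y≢a)) (indicator-yes (a ≟ᵛ a) refl)

  ∑ᵛ-strict : ∀ n {f g} → (∀ x → f x ≤ g x) → ∀ a → f a < g a → ∑ᵛ n f < ∑ᵛ n g
  ∑ᵛ-strict n {f} {g} h a lt = ℕ.≤-trans (ℕ.≤-reflexive (trans (cong (_+ ∑ᵛ n f) (sym (∑ᵛ-delta n a))) (sym (ΣF.∑ᵛ-+ n (λ x → indicator (x ≟ᵛ a)) f)))) (∑ᵛ-mono n bound)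
    where
    bound : ∀ x → indicator (x ≟ᵛ a) + f x ≤ g x
    bound x with x ≟ᵛ a
    ... | yes refl = lt
    ... | no _     = h x

  ∑ᵛ-affine : ∀ n a {c} → c ≢ 0# → ∀ f → ∑ᵛ n (λ x → f (a ∔ c ◂ x)) ≡ ∑ᵛ n f
  ∑ᵛ-affine zero    []       c≢0 f = refl
  ∑ᵛ-affine (suc n) (a ∷ as) {c} c≢0 f = trans (ΣF.∑-cong (λ x → ∑ᵛ-affine n as c≢0 (λ xs → f (a ⊞ c ⊠ x ∷ xs))))
    (trans (ΣF.∑-dilate c≢0 (λ x → ∑ᵛ n (λ xs → f (a ⊞ x ∷ xs)))) (ΣF.∑-translate a (λ x → ∑ᵛ n (λ xs → f (x ∷ xs)))))

  ∑ᵛ-translate : ∀ n a f → ∑ᵛ n (λ x → f (a ∔ x)) ≡ ∑ᵛ n f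
  ∑ᵛ-translate n a f = trans (ΣF.∑ᵛ-cong n (λ x → cong (λ y → f (a ∔ y)) (sym (1◂ x)))) (∑ᵛ-affine n a 1≢0 f)

  nonZero : K → ℕ
  nonZero x = indicator (¬? (x ≟ 0#))

  ∑-split : ∀ f → ∑ f ≡ f 0# + ∑ (λ x → nonZero x * f x)
  ∑-split f = trans (ΣF.∑-cong split) (trans (ΣF.∑-+ (λ x → indicator (x ≟ 0#) * f x) (λ x → nonZero x * f x)) (cong (_+ ∑ (λ x → nonZero x * f x)) single))
    where
    split : ∀ x → f x ≡ indicator (x ≟ 0#) * f x + nonZero x * f x
    split x with x ≟ 0#
    ... | yes _ = sym (trans (ℕ.+-identityʳ (f x + 0)) (ℕ.+-identityʳ (f x)))
    ... | no _  = sym (ℕ.+-identityʳ (f x))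
    single : ∑ (λ x → indicator (x ≟ 0#) * f x) ≡ f 0#
    single = trans (ΣF.∑-single _ 0# (λ y y≢0 → cong (_* f y) (indicator-no (y ≟ 0#) y≢0)))
      (trans (cong (_* f 0#) (indicator-yes (0# ≟ 0#) refl)) (ℕ.*-identityˡ (f 0#)))

  ∑-nonZero : suc (∑ nonZero) ≡ q
  ∑-nonZero = trans (sym (trans (∑-split (λ _ → 1)) (cong suc (ΣF.∑-cong (λ x → ℕ.*-identityʳ (nonZero x)))))) (trans (∑-const 1) (ℕ.*-identityʳ q))

  spanIndicator : ∀ {n k} → Vec (Vec K n) k → Vec K n → ℕ
  spanIndicator vs x = indicator (InSpan? vs x)

  -- The span of w ∷ vs is the disjoint union of q translates of the span of vs, one for each
  -- coefficient of w.
  ∑ᵛ-span : ∀ {n k} (vs : Vec (Vec K n) k) → Indep vs → ∑ᵛ n (spanIndicator vs) ≡ q ^ k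
  ∑ᵛ-span {n} [] _ = trans (ΣF.∑ᵛ-single n _ 0ᵛ (λ y y≢0 → indicator-no (InSpan? [] y) (λ { ([] , eq) → y≢0 (sym eq) }))) (indicator-yes (InSpan? [] 0ᵛ) ([] , refl))
  ∑ᵛ-span {n} {suc k} (w ∷ vs) (w∉ , ind) = begin
    ∑ᵛ n (spanIndicator (w ∷ vs))  ≡⟨ ΣF.∑ᵛ-cong n split ⟩
    ∑ᵛ n (λ x → ∑ (λ μ → spanIndicator vs (μ ◂ w ∔ x)))  ≡⟨ ΣF.∑-∑ᵛ-swap n (λ μ x → spanIndicator vs (μ ◂ w ∔ x)) ⟨
    ∑ (λ μ → ∑ᵛ n (λ x → spanIndicator vs (μ ◂ w ∔ x)))  ≡⟨ ΣF.∑-cong (λ μ → trans (∑ᵛ-translate n (μ ◂ w) (spanIndicator vs)) (∑ᵛ-span vs ind)) ⟩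
    ∑ (λ _ → q ^ k)  ≡⟨ ∑-const (q ^ k) ⟩
    q ^ suc k ∎
    where
    open ≡-Reasoning
    unique : ∀ {x μ ν} → InSpan vs (μ ◂ w ∔ x) → InSpan vs (ν ◂ w ∔ x) → μ ≡ ν
    unique {x} {μ} {ν} s t with μ ≟ ν
    ... | yes eq = eq
    ... | no neq = contradiction (InSpan-◂⁻¹ (λ eq → neq (x-y≡0⇒x≡y μ ν eq)) (subst (InSpan vs) eq (InSpan-∔ s (InSpan-◂ (⊟ 1#) t)))) w∉
      where
      lem : ∀ {n} (w x : Vec K n) → (μ ◂ w ∔ x) ∔ ⊝ (ν ◂ w ∔ x) ≡ (μ ⊞ ⊟ ν) ◂ w
      lem []      []      = refl
      lem (w ∷ ws) (x ∷ xs) = cong₂ _∷_ (trans (solve 5 (λ o μ ν w x → (μ :* w :+ x) :+ (:- o) :* (ν :* w :+ x) := μ :* w :+ x :- o :* (ν :* w :+ x)) refl 1# μ ν w x)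
        (trans (cong (λ z → μ ⊠ w ⊞ x ⊞ ⊟ z) (*-identityˡ _)) (solve 4 (λ μ ν w x → (μ :* w :+ x) :- (ν :* w :+ x) := (μ :+ :- ν) :* w) refl μ ν w x))) (lem ws xs)
      eq = lem w x
    split : ∀ x → spanIndicator (w ∷ vs) x ≡ ∑ (λ μ → spanIndicator vs (μ ◂ w ∔ x))
    split x with InSpan? (w ∷ vs) x
    ... | yes (c ∷ cs , refl) = sym (trans (ΣF.∑-single _ (⊟ c) (λ ν ν≢ → indicator-no (InSpan? vs _) (λ t → ν≢ (unique {x} t inside)))) (indicator-yes (InSpan? vs _) inside))
      where
      lem : ∀ {n} (w u : Vec K n) → u ≡ (⊟ c) ◂ w ∔ (c ◂ w ∔ u)
      lem []      []      = refl
      lem (w ∷ ws) (u ∷ us) = cong₂ _∷_ (solve 3 (λ c w u → u := (:- c) :* w :+ (c :* w :+ u)) refl c w u) (lem ws us)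
      inside : InSpan vs ((⊟ c) ◂ w ∔ ((c ◂ w) ∔ comb cs vs))
      inside = cs , lem w (comb cs vs)
    ... | no ∉ = sym (trans (ΣF.∑-cong (λ μ → indicator-no (InSpan? vs _) (λ (cs , eq) → ∉ (⊟ μ ∷ cs , trans (cong ((⊟ μ) ◂ w ∔_) eq) (lem μ w x))))) (trans (∑-const 0) (ℕ.*-zeroʳ q)))
      where
      lem : ∀ {n} μ (w x : Vec K n) → (⊟ μ) ◂ w ∔ (μ ◂ w ∔ x) ≡ x
      lem μ []      []      = refl
      lem μ (w ∷ ws) (x ∷ xs) = cong₂ _∷_ (solve 3 (λ c w u → (:- c) :* w :+ (c :* w :+ u) := u) refl μ w x) (lem μ ws xs)

  module Counting {n} (z : Vec K n → Set) (z? : Decidable z) where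
    χ : Vec K n → ℕ
    χ x = indicator (z? x)

    size : ℕ
    size = ∑ᵛ n χ

    -- Summed over coefficient vectors and not over points: for dependent directions points count
    -- with multiplicity, so the recursion on v and the congruences hold for every tuple of
    -- directions.
    cnt : ∀ {k} → Vec K n → Vec (Vec K n) k → ℕ
    cnt {k} p v = ∑ᵛ k (λ cs → χ (p ∔ comb cs v))

    cnt-∷ : ∀ {k} p w (v : Vec (Vec K n) k) → cnt p (w ∷ v) ≡ ∑ (λ μ → cnt (p ∔ μ ◂ w) v)
    cnt-∷ {k} p w v = ΣF.∑-cong (λ μ → ΣF.∑ᵛ-cong k (λ cs → cong χ (sym (∔-assoc p (μ ◂ w) (comb cs v)))))

    extra : ∀ {k} → Vec K n → Vec (Vec K n) k → Vec K n → ℕ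
    extra p v w = ∑ (λ μ → nonZero μ * cnt (p ∔ μ ◂ w) v)

    cnt-extra : ∀ {k} p w (v : Vec (Vec K n) k) → cnt p (w ∷ v) ≡ cnt p v + extra p v w
    cnt-extra p w v = trans (cnt-∷ p w v) (trans (∑-split (λ μ → cnt (p ∔ μ ◂ w) v)) (cong (λ u → cnt u v + extra p v w) (trans (cong (p ∔_) (0◂ w)) (∔-identityʳ p))))

    cnt-shift : ∀ {k} p (v : Vec (Vec K n) k) {w} → InSpan v w → cnt (p ∔ w) v ≡ cnt p v
    cnt-shift {k} p v (bs , refl) = trans (ΣF.∑ᵛ-cong k (λ cs → cong χ (trans (∔-assoc p (comb bs v) (comb cs v)) (cong (p ∔_) (sym (comb-∔ bs cs v))))))
      (∑ᵛ-translate k bs (λ cs → χ (p ∔ comb cs v)))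

    -- For fixed cs and μ ≠ 0 the map w ↦ p + μ w + comb cs v is a bijection of Fⁿ, so each
    -- coefficient vector contributes `size`.
    ∑ᵛ-cnt : ∀ {k} p (v : Vec (Vec K n) k) {μ} → μ ≢ 0# → ∑ᵛ n (λ w → cnt (p ∔ μ ◂ w) v) ≡ q ^ k * size
    ∑ᵛ-cnt {k} p v {μ} μ≢0 = begin
      ∑ᵛ n (λ w → ∑ᵛ k (λ cs → χ ((p ∔ μ ◂ w) ∔ comb cs v)))  ≡⟨ ΣF.∑ᵛ-swap n k (λ w cs → χ ((p ∔ μ ◂ w) ∔ comb cs v)) ⟩
      ∑ᵛ k (λ cs → ∑ᵛ n (λ w → χ ((p ∔ μ ◂ w) ∔ comb cs v)))  ≡⟨ ΣF.∑ᵛ-cong k (λ cs → trans (ΣF.∑ᵛ-cong n (λ w → cong χ (lem p (μ ◂ w) (comb cs v)))) (∑ᵛ-affine n (p ∔ comb cs v) μ≢0 χ)) ⟩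
      ∑ᵛ k (λ _ → size)  ≡⟨ ∑ᵛ-const k size ⟩
      q ^ k * size ∎
      where
      open ≡-Reasoning
      lem : ∀ a b c → (a ∔ b) ∔ c ≡ (a ∔ c) ∔ b
      lem a b c = trans (∔-assoc a b c) (trans (cong (a ∔_) (∔-comm b c)) (sym (∔-assoc a c b)))

    ∑ᵛ-cnt₁ : ∀ {k} (v : Vec (Vec K n) k) → ∑ᵛ n (λ w → cnt w v) ≡ q ^ k * size
    ∑ᵛ-cnt₁ v = trans (ΣF.∑ᵛ-cong n (λ w → cong (λ u → cnt u v) (sym (trans (∔-identityˡ (1# ◂ w)) (1◂ w))))) (∑ᵛ-cnt 0ᵛ v 1≢0)

    instance
      q-nonZero : NonZero q
      q-nonZero = ℕ.>-nonZero 0<q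

    translates-bound : ∀ {k} j (v : Vec (Vec K n) k) → k + j ≡ n → ∀ t → (∀ w → t ≤ cnt w v) → q ^ j * t ≤ size
    translates-bound {k} j v k+j≡n t h = ℕ.*-cancelˡ-≤ (q ^ k) {{ℕ.m^n≢0 q k}} (begin
      q ^ k * (q ^ j * t)  ≡⟨ ℕ.*-assoc (q ^ k) (q ^ j) t ⟨
      q ^ k * q ^ j * t  ≡⟨ cong (_* t) (trans (sym (ℕ.^-distribˡ-+-* q k j)) (cong (q ^_) k+j≡n)) ⟩
      q ^ n * t  ≡⟨ ∑ᵛ-const n t ⟨
      ∑ᵛ n (λ _ → t)  ≤⟨ ∑ᵛ-mono n h ⟩
      ∑ᵛ n (λ w → cnt w v)  ≡⟨ ∑ᵛ-cnt₁ v ⟩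
      q ^ k * size ∎)
      where open ℕ.≤-Reasoning

    translates-strict : ∀ {k} j (v : Vec (Vec K n) k) → k + j ≡ n → ∀ t → (∀ w → t ≤ cnt w v) → ∀ w → t < cnt w v → q ^ j * t < size
    translates-strict {k} j v k+j≡n t h w lt = ℕ.*-cancelˡ-< (q ^ k) _ _ (begin-strict
      q ^ k * (q ^ j * t)  ≡⟨ ℕ.*-assoc (q ^ k) (q ^ j) t ⟨
      q ^ k * q ^ j * t  ≡⟨ cong (_* t) (trans (sym (ℕ.^-distribˡ-+-* q k j)) (cong (q ^_) k+j≡n)) ⟩
      q ^ n * t  ≡⟨ ∑ᵛ-const n t ⟨
      ∑ᵛ n (λ _ → t)  <⟨ ∑ᵛ-strict n h w lt ⟩
      ∑ᵛ n (λ w → cnt w v)  ≡⟨ ∑ᵛ-cnt₁ v ⟩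
      q ^ k * size ∎)
      where open ℕ.≤-Reasoning

    -- Average extra p v w over all w; the w outside the span of v contribute at least t each.
    extension-bound : ∀ {k} j p (v : Vec (Vec K n) k) → k + j ≡ n → Indep v → ∀ t → (∀ w → ¬ InSpan v w → t ≤ extra p v w) →
      q ^ j * t + (q ∸ 1) * cnt p v ≤ (q ∸ 1) * size + t
    extension-bound {k} j p v k+j≡n ind t h = ℕ.*-cancelˡ-≤ (q ^ k) {{ℕ.m^n≢0 q k}} (begin
      q ^ k * (q ^ j * t + q₁ * c)  ≡⟨ lem₁ (q ^ k) (q ^ j) t (q₁ * c) ⟩
      q ^ k * q ^ j * t + (q₁ * c) * q ^ k  ≡⟨ cong₂ (λ x y → x * t + (q₁ * c) * y) (trans (sym (ℕ.^-distribˡ-+-* q k j)) (cong (q ^_) k+j≡n)) (sym (∑ᵛ-span v ind)) ⟩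
      q ^ n * t + (q₁ * c) * ∑ᵛ n σ  ≡⟨ cong₂ _+_ (∑ᵛ-const n t) (∑ᵛ-* n (q₁ * c) σ) ⟨
      ∑ᵛ n (λ _ → t) + ∑ᵛ n (λ w → (q₁ * c) * σ w)  ≡⟨ ΣF.∑ᵛ-+ n (λ _ → t) (λ w → (q₁ * c) * σ w) ⟨
      ∑ᵛ n (λ w → t + (q₁ * c) * σ w)  ≤⟨ ∑ᵛ-mono n pointwise ⟩
      ∑ᵛ n (λ w → extra p v w + t * σ w)  ≡⟨ ΣF.∑ᵛ-+ n (extra p v) (λ w → t * σ w) ⟩
      ∑ᵛ n (extra p v) + ∑ᵛ n (λ w → t * σ w)  ≡⟨ cong₂ _+_ total (trans (∑ᵛ-* n t σ) (cong (t *_) (∑ᵛ-span v ind))) ⟩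
      (q ^ k * size) * q₁ + t * q ^ k  ≡⟨ lem₂ (q ^ k) size q₁ t ⟩
      q ^ k * (q₁ * size + t) ∎)
      where
      open ℕ.≤-Reasoning
      q₁ = q ∸ 1
      c = cnt p v
      σ = spanIndicator v
      lem₁ : ∀ a b t c → a * (b * t + c) ≡ a * b * t + c * a
      lem₁ = solve-∀
      lem₂ : ∀ a s q t → (a * s) * q + t * a ≡ a * (q * s + t)
      lem₂ = solve-∀
      ∑-nz : ∑ nonZero ≡ q₁
      ∑-nz = cong (_∸ 1) ∑-nonZero
      inside : ∀ w → InSpan v w → extra p v w ≡ q₁ * c
      inside w s = trans (ΣF.∑-cong (λ μ → trans (cong (nonZero μ *_) (cnt-shift p v (InSpan-◂ μ s))) (ℕ.*-comm (nonZero μ) c))) (trans (∑-* c nonZero) (trans (cong (c *_) ∑-nz) (ℕ.*-comm c q₁)))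
      pointwise : ∀ w → t + (q₁ * c) * σ w ≤ extra p v w + t * σ w
      pointwise w with InSpan? v w
      ... | yes s = ℕ.≤-reflexive (trans (ℕ.+-comm t _) (cong₂ _+_ (trans (ℕ.*-identityʳ (q₁ * c)) (sym (inside w s))) (sym (ℕ.*-identityʳ t))))
      ... | no ∉ = ℕ.≤-trans (ℕ.≤-reflexive (trans (cong (t +_) (ℕ.*-zeroʳ (q₁ * c))) (ℕ.+-identityʳ t))) (ℕ.≤-trans (h w ∉) (ℕ.m≤m+n (extra p v w) (t * 0)))
      weight : ∀ μ → ∑ᵛ n (λ w → nonZero μ * cnt (p ∔ μ ◂ w) v) ≡ (q ^ k * size) * nonZero μ
      weight μ with μ ≟ 0#
      ... | yes _  = trans (∑ᵛ-const n 0) (trans (ℕ.*-zeroʳ (q ^ n)) (sym (ℕ.*-zeroʳ (q ^ k * size))))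
      ... | no μ≢0 = trans (ΣF.∑ᵛ-cong n (λ w → ℕ.*-identityˡ _)) (trans (∑ᵛ-cnt p v μ≢0) (sym (ℕ.*-identityʳ _)))
      total : ∑ᵛ n (extra p v) ≡ (q ^ k * size) * q₁
      total = begin-equality
        ∑ᵛ n (λ w → ∑ (λ μ → nonZero μ * cnt (p ∔ μ ◂ w) v))  ≡⟨ ΣF.∑-∑ᵛ-swap n (λ μ w → nonZero μ * cnt (p ∔ μ ◂ w) v) ⟨
        ∑ (λ μ → ∑ᵛ n (λ w → nonZero μ * cnt (p ∔ μ ◂ w) v))  ≡⟨ ΣF.∑-cong weight ⟩
        ∑ (λ μ → (q ^ k * size) * nonZero μ)  ≡⟨ ∑-* (q ^ k * size) nonZero ⟩
        (q ^ k * size) * ∑ nonZero  ≡⟨ cong ((q ^ k * size) *_) ∑-nz ⟩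
        (q ^ k * size) * q₁ ∎

    -- Adjoin directions that add no zeros for as long as possible.
    raise : ∀ i {k} p (v : Vec (Vec K n) k) → Indep v →
      (∃[ v′ ] (Indep {k = i + k} v′ × cnt p v′ ≡ cnt p v)) ⊎
      (∃[ k′ ] ∃[ v′ ] (k′ < i + k × Indep {k = k′} v′ × cnt p v′ ≡ cnt p v × (∀ w → ¬ InSpan v′ w → 1 ≤ extra p v′ w)))
    raise zero    p v ind = inj₁ (v , ind , refl)
    raise (suc i) {k} p v ind with raise i p v ind
    ... | inj₂ (k′ , v′ , k′< , rest) = inj₂ (k′ , v′ , ℕ.m≤n⇒m≤1+n k′< , rest)
    ... | inj₁ (v′ , ind′ , eq) with searchᵛ n (λ w → extend? v′ w)
      where
      extend? : ∀ {k} (v : Vec (Vec K n) k) w → Dec (¬ InSpan v w × extra p v w ≡ 0)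
      extend? v w = ¬? (InSpan? v w) ×-dec (extra p v w ℕ.≟ 0)
    ... | yes (w , w∉ , e≡0) = inj₁ (w ∷ v′ , (w∉ , ind′) , trans (cnt-extra p w v′) (trans (cong (cnt p v′ +_) e≡0) (trans (ℕ.+-identityʳ _) eq)))
    ... | no none = inj₂ (i + k , v′ , ℕ.≤-refl , ind′ , eq , λ w w∉ → ℕ.n≢0⇒n>0 (λ e≡0 → none (w , w∉ , e≡0)))

-- From congruences on flats to lower bounds for the number of zeros.

indicator-mono : ∀ {a b} {P : Set a} {Q : Set b} (d : Dec P) (e : Dec Q) → (P → Q) → indicator d ≤ indicator e
indicator-mono (yes p) e h = ℕ.≤-reflexive (sym (indicator-yes e (h p)))
indicator-mono (no _)  e h = z≤n

indicator-positive : ∀ {a} {P : Set a} (d : Dec P) → 0 < indicator d → P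
indicator-positive (yes p) _ = p

module Geometry {q₂} (F : FiniteField (suc (suc q₂))) {n : ℕ} (z : Vec (FiniteField.Carrier F) n → Set) (z? : Decidable z) (d m : ℕ) (d+m≡n : d + m ≡ n)
  (parallel : ∀ a b (v : Vec (Vec (FiniteField.Carrier F) n) d) → Vectors.Counting.cnt F z z? a v % suc (suc q₂) ≡ Vectors.Counting.cnt F z z? b v % suc (suc q₂)) where

  open Vectors F hiding (module Counting)
  open Vectors.Counting F z z?

  q : ℕ
  q = suc (suc q₂)

  ∑-% : ∀ {f g} → (∀ x → f x % q ≡ g x % q) → ∑ f % q ≡ ∑ g % q
  ∑-% {f} {g} h = go (f ∘ from) (g ∘ from) (h ∘ from)
    where
    S : ∀ {n} → (Fin n → ℕ) → ℕ
    S = FinSum.sum ℕ.+-0-commutativeMonoid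
    go : ∀ {n} (s t : Fin n → ℕ) → (∀ i → s i % q ≡ t i % q) → S s % q ≡ S t % q
    go {zero}  s t h = refl
    go {suc n} s t h = trans (%-distribˡ-+ (s zero) (S (s ∘ suc)) q) (trans (cong₂ (λ x y → (x + y) % q) (h zero) (go (s ∘ suc) (t ∘ suc) (h ∘ suc))) (sym (%-distribˡ-+ (t zero) (S (t ∘ suc)) q)))

  parallel′ : ∀ {k} → k ≡ d → ∀ a b (v : Vec (Vec K n) k) → cnt a v % q ≡ cnt b v % q
  parallel′ refl = parallel

  -- A flat of dimension d + 1 is a union of q parallel flats of dimension d with congruent counts;
  -- higher flats are unions of these.
  cnt-above : ∀ i p (v : Vec (Vec K n) (suc (i + d))) → cnt p v % q ≡ 0
  cnt-above zero p (w ∷ v) = begin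
    cnt p (w ∷ v) % q  ≡⟨ cong (_% q) (cnt-∷ p w v) ⟩
    ∑ (λ μ → cnt (p ∔ μ ◂ w) v) % q  ≡⟨ ∑-% {λ μ → cnt (p ∔ μ ◂ w) v} {λ _ → cnt p v} (λ μ → parallel (p ∔ μ ◂ w) p v) ⟩
    ∑ (λ μ → cnt p v) % q  ≡⟨ cong (_% q) (trans (∑-const (cnt p v)) (ℕ.*-comm q (cnt p v))) ⟩
    (cnt p v * q) % q  ≡⟨ m*n%n≡0 (cnt p v) q ⟩
    0 ∎
    where open ≡-Reasoning
  cnt-above (suc i) p (w ∷ v) = trans (cong (_% q) (cnt-∷ p w v)) (trans (∑-% {λ μ → cnt (p ∔ μ ◂ w) v} {λ _ → 0} (λ μ → cnt-above i (p ∔ μ ◂ w) v)) (cong (_% q) (trans (∑-const 0) (ℕ.*-zeroʳ q))))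

  cnt-high : ∀ {k} p (v : Vec (Vec K n) k) → d < k → cnt p v % q ≡ 0
  cnt-high {k} p v d<k = go (k ∸ suc d) (trans (sym (ℕ.+-suc (k ∸ suc d) d)) (ℕ.m∸n+n≡m d<k)) v
    where
    go : ∀ i → suc (i + d) ≡ k → (v : Vec (Vec K n) k) → cnt p v % q ≡ 0
    go i refl v = cnt-above i p v

  ∑ᵛ-lower : ∀ {k} f (a : Vec K k) → f a ≤ ∑ᵛ k f
  ∑ᵛ-lower {k} f a = ℕ.≤-trans (ℕ.≤-reflexive (sym (trans (ΣF.∑ᵛ-single k _ a (λ y y≢a → cong (_* f y) (indicator-no (y ≟ᵛ a) y≢a)))
    (trans (cong (_* f a) (indicator-yes (a ≟ᵛ a) refl)) (ℕ.*-identityˡ (f a)))))) (∑ᵛ-mono k (λ x → ℕ.≤-trans (ℕ.*-monoˡ-≤ (f x) (indicator≤1 (x ≟ᵛ a))) (ℕ.≤-reflexive (ℕ.*-identityˡ (f x)))))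

  ∑ᵛ-positive : ∀ {k} f → 0 < ∑ᵛ k f → ∃[ a ] 0 < f a
  ∑ᵛ-positive {k} f pos′ with searchᵛ k (λ a → 0 ℕ.<? f a)
  ... | yes h = h
  ... | no none = contradiction pos′ (ℕ.≤⇒≯ (ℕ.≤-trans (∑ᵛ-mono k {g = λ _ → 0} (λ x → ℕ.≮⇒≥ (λ lt → none (x , lt)))) (ℕ.≤-reflexive (trans (∑ᵛ-const k 0) (ℕ.*-zeroʳ (q ^ k))))))

  ∑-delta : ∀ a → ∑ (λ x → indicator (x ≟ a)) ≡ 1
  ∑-delta a = trans (ΣF.∑-single _ a (λ y y≢a → indicator-no (y ≟ a) y≢a)) (indicator-yes (a ≟ a) refl)

  ∑-delta₂ : ∀ a b → ∑ (λ x → indicator (x ≟ a) + indicator (x ≟ b)) ≡ 2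
  ∑-delta₂ a b = trans (ΣF.∑-+ (λ x → indicator (x ≟ a)) (λ x → indicator (x ≟ b))) (cong₂ _+_ (∑-delta a) (∑-delta b))

  ∑-two : ∀ f {a b} → a ≢ b → 1 ≤ f a → 1 ≤ f b → 2 ≤ ∑ f
  ∑-two f {a} {b} a≢b fa fb = ℕ.≤-trans (ℕ.≤-reflexive (sym (∑-delta₂ a b))) (∑-mono bound)
    where
    bound : ∀ x → indicator (x ≟ a) + indicator (x ≟ b) ≤ f x
    bound x with x ≟ a | x ≟ b
    ... | yes refl | yes refl = contradiction refl a≢b
    ... | yes refl | no _     = fa
    ... | no _     | yes refl = fb
    ... | no _     | no _     = z≤n

  cnt-point : ∀ {k} p (v : Vec (Vec K n) k) cs → z (p ∔ comb cs v) → 1 ≤ cnt p v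
  cnt-point p v cs h = ℕ.≤-trans (ℕ.≤-reflexive (sym (indicator-yes (z? _) h))) (∑ᵛ-lower (λ cs → χ (p ∔ comb cs v)) cs)

  cnt-positive : ∀ {k} p (v : Vec (Vec K n) k) → 0 < cnt p v → ∃[ cs ] z (p ∔ comb cs v)
  cnt-positive p v h = let cs , lt = ∑ᵛ-positive (λ cs → χ (p ∔ comb cs v)) h in cs , indicator-positive (z? _) lt

  extra-positive : ∀ {k} p (v : Vec (Vec K n) k) w → 0 < extra p v w → ∃[ μ ] (μ ≢ 0# × ∃[ cs ] z ((p ∔ μ ◂ w) ∔ comb cs v))
  extra-positive p v w h with ∑ᵛ-positive {1} (λ { (μ ∷ []) → nonZero μ * cnt (p ∔ μ ◂ w) v }) h
  ... | μ ∷ [] , lt with μ ≟ 0#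
  ...   | no μ≢0 = μ , μ≢0 , cnt-positive (p ∔ μ ◂ w) v (subst (0 <_) (ℕ.*-identityˡ _) lt)

  cnt≤size : ∀ {k} p (v : Vec (Vec K n) k) → Indep v → cnt p v ≤ size
  cnt≤size {k} p v ind = ℕ.*-cancelˡ-≤ (q ^ k) {{ℕ.m^n≢0 q k}} (begin
    q ^ k * c  ≡⟨ trans (ℕ.*-comm (q ^ k) c) (cong (c *_) (sym (∑ᵛ-span v ind))) ⟩
    c * ∑ᵛ n (spanIndicator v)  ≡⟨ ∑ᵛ-* n c (spanIndicator v) ⟨
    ∑ᵛ n (λ w → c * spanIndicator v w)  ≤⟨ ∑ᵛ-mono n bound ⟩
    ∑ᵛ n (λ w → cnt (p ∔ w) v)  ≡⟨ ΣF.∑ᵛ-cong n (λ w → cong (λ u → cnt (p ∔ u) v) (sym (1◂ w))) ⟩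
    ∑ᵛ n (λ w → cnt (p ∔ 1# ◂ w) v)  ≡⟨ ∑ᵛ-cnt p v 1≢0 ⟩
    q ^ k * size ∎)
    where
    open ℕ.≤-Reasoning
    c = cnt p v
    bound : ∀ w → c * spanIndicator v w ≤ cnt (p ∔ w) v
    bound w with InSpan? v w
    ... | yes s = ℕ.≤-reflexive (trans (ℕ.*-identityʳ c) (sym (cnt-shift p v s)))
    ... | no _  = ℕ.≤-trans (ℕ.≤-reflexive (ℕ.*-zeroʳ c)) z≤n

  Q : ℕ
  Q = q ^ m

  1≤Q : 1 ≤ Q
  1≤Q = ℕ.m^n>0 q m

  -- A gap i between the dimension k and d becomes an excess i of the codimension n - k over m; this
  -- supplies the additional powers of q.
  codim : ∀ {k} i → i + k ≤ d → ∃[ j ] (k + (i + m + j) ≡ n)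
  codim {k} i le = d ∸ (i + k) , trans (lem k i m (d ∸ (i + k))) (trans (cong (_+ m) (ℕ.m+[n∸m]≡n le)) d+m≡n)
    where
    lem : ∀ k i m j → k + (i + m + j) ≡ (i + k) + j + m
    lem = solve-∀

  q^-bound : ∀ i j → q ^ i * Q ≤ q ^ (i + m + j)
  q^-bound i j = ℕ.≤-trans (ℕ.≤-reflexive (sym (ℕ.^-distribˡ-+-* q i m))) (ℕ.^-monoʳ-≤ q (ℕ.m≤m+n (i + m) j))

  -- A nonzero residue forces dimension at most d. If enlarging reaches dimension d, all parallel
  -- flats have at least one zero and this one has two, whence strictness. If it gets stuck before,
  -- averaging with t = 1 in codimension at least m + 1 suffices.
  many-points : ∀ {k} p (v : Vec (Vec K n) k) → Indep v → 2 ≤ cnt p v → cnt p v % q ≢ 0 → Q < size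
  many-points {k} p v ind 2≤c c≢0 with k ℕ.≤? d
  ... | no k≰d = contradiction (cnt-high p v (ℕ.≰⇒> k≰d)) c≢0
  ... | yes k≤d with raise (d ∸ k) p v ind
  ...   | inj₁ (v′ , ind′ , eq) = subst (_< size) (ℕ.*-identityʳ Q) (translates-strict m v′ (trans (cong (_+ m) k≡) d+m≡n) 1 positive p (subst (2 ≤_) (sym eq) 2≤c))
    where
    k≡ : d ∸ k + k ≡ d
    k≡ = ℕ.m∸n+n≡m k≤d
    positive : ∀ w → 1 ≤ cnt w v′
    positive w = ℕ.n≢0⇒n>0 (λ c≡0 → c≢0 (trans (cong (_% q) (sym eq)) (trans (parallel′ k≡ p w v′) (cong (_% q) c≡0))))
  ...   | inj₂ (k′ , v′ , k′< , ind′ , eq , h) = ℕ.≰⇒> λ size≤Q → ℕ.<-irrefl refl (begin-strict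
      suc q₂ * size + 1  ≤⟨ ℕ.+-monoˡ-≤ 1 (ℕ.*-monoʳ-≤ (suc q₂) size≤Q) ⟩
      suc q₂ * Q + 1  ≤⟨ ℕ.+-monoʳ-≤ (suc q₂ * Q) 1≤Q ⟩
      suc q₂ * Q + Q  ≡⟨ lem q₂ Q ⟩
      q ^ 1 * Q  ≤⟨ q^-bound 1 j ⟩
      q ^ (1 + m + j)  ≡⟨ ℕ.*-identityʳ _ ⟨
      q ^ (1 + m + j) * 1  <⟨ ℕ.m<m+n _ (ℕ.*-mono-≤ {1} {suc q₂} {1} (s≤s z≤n) (ℕ.≤-trans (s≤s z≤n) (subst (2 ≤_) (sym eq) 2≤c))) ⟩
      q ^ (1 + m + j) * 1 + suc q₂ * cnt p v′  ≤⟨ extension-bound (1 + m + j) p v′ (proj₂ cd) ind′ 1 h ⟩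
      suc q₂ * size + 1 ∎)
    where
    open ℕ.≤-Reasoning
    cd = codim 1 (ℕ.≤-trans k′< (ℕ.≤-reflexive (ℕ.m∸n+n≡m k≤d)))
    j = proj₁ cd
    lem : ∀ q Q → suc q * Q + Q ≡ (suc (suc q) * 1) * Q
    lem = solve-∀

  large-residues : ∀ {k} → k ≡ d → ∀ p (v : Vec (Vec K n) k) t → t ≤ cnt p v % q → Q * t ≤ size
  large-residues refl p v t le = translates-bound m v d+m≡n t (λ w → ℕ.≤-trans le (ℕ.≤-trans (ℕ.≤-reflexive (parallel p w v)) (m%n≤m (cnt w v) q)))

  line-lower : ∀ {a u} → z a → z (a ∔ u) → 2 ≤ cnt a (u ∷ [])
  line-lower {a} {u} za zu = ∑-two (λ ν → χ (a ∔ (ν ◂ u ∔ 0ᵛ))) 0≢1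
    (ℕ.≤-reflexive (sym (indicator-yes (z? _) (subst z (sym (trans (cong (a ∔_) (trans (cong (_∔ 0ᵛ) (0◂ u)) (∔-identityʳ 0ᵛ))) (∔-identityʳ a))) za))))
    (ℕ.≤-reflexive (sym (indicator-yes (z? _) (subst z (sym (cong (a ∔_) (trans (∔-identityʳ (1# ◂ u)) (1◂ u)))) zu))))

  line-indep : ∀ {u : Vec K n} → u ≢ 0ᵛ → Indep (u ∷ [])
  line-indep u≢0 = (λ { ([] , eq) → u≢0 (sym eq) }) , tt

  TwoPointLine : Vec K n → Set
  TwoPointLine a = ∃[ u ] (Indep (u ∷ []) × cnt a (u ∷ []) ≡ 2)

  -- Every ν u with ν ≠ 0 leaves the span of v, so a second zero on the line would be a second extra zero.
  two-point-line : ∀ {k} a (v : Vec (Vec K n) k) w → z a → ¬ InSpan v w → extra a v w ≡ 1 → TwoPointLine a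
  two-point-line {k} a v w za w∉ e≡1 with extra-positive a v w (subst (0 <_) (sym e≡1) (s≤s z≤n))
  ... | μ , μ≢0 , cs , zx = u , line-indep u≢0 , trans (ΣF.∑-cong values) (∑-delta₂ 0# 1#)
    where
    u = μ ◂ w ∔ comb cs v
    zu : z (a ∔ u)
    zu = subst z (∔-assoc a (μ ◂ w) (comb cs v)) zx
    u≢0 : u ≢ 0ᵛ
    u≢0 eq = w∉ (InSpan-◂⁻¹ μ≢0 ((⊟ 1#) ◂ cs , trans (comb-◂ (⊟ 1#) cs v) (trans (sym (∔-identityˡ _)) (trans (cong (_∔ ⊝ comb cs v) (sym eq))
      (trans (∔-assoc (μ ◂ w) (comb cs v) (⊝ comb cs v)) (trans (cong (μ ◂ w ∔_) (∔-inverseʳ (comb cs v))) (∔-identityʳ (μ ◂ w))))))))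
    scaled : ∀ ν → a ∔ (ν ◂ u ∔ 0ᵛ) ≡ (a ∔ (ν ⊠ μ) ◂ w) ∔ comb (ν ◂ cs) v
    scaled ν = trans (cong (a ∔_) (trans (∔-identityʳ (ν ◂ u)) (trans (◂-distribˡ ν (μ ◂ w) (comb cs v)) (cong₂ _∔_ (sym (◂-assoc ν μ w)) (sym (comb-◂ ν cs v)))))) (sym (∔-assoc a ((ν ⊠ μ) ◂ w) (comb (ν ◂ cs) v)))
    weight : ∀ ν → ν ≢ 0# → z (a ∔ (ν ◂ u ∔ 0ᵛ)) → 1 ≤ nonZero (ν ⊠ μ) * cnt (a ∔ (ν ⊠ μ) ◂ w) v
    weight ν ν≢0 h = ℕ.*-mono-≤ {1} {_} {1} (ℕ.≤-reflexive (sym (indicator-yes (¬? ((ν ⊠ μ) ≟ 0#)) (*-nonZero ν≢0 μ≢0))))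
      (cnt-point (a ∔ (ν ⊠ μ) ◂ w) v (ν ◂ cs) (subst z (scaled ν) h))
    1◂u : a ∔ (1# ◂ u ∔ 0ᵛ) ≡ a ∔ u
    1◂u = cong (a ∔_) (trans (∔-identityʳ (1# ◂ u)) (1◂ u))
    values : ∀ ν → χ (a ∔ (ν ◂ u ∔ 0ᵛ)) ≡ indicator (ν ≟ 0#) + indicator (ν ≟ 1#)
    values ν with ν ≟ 0# | ν ≟ 1#
    ... | yes refl | yes eq   = contradiction eq 0≢1
    ... | yes refl | no _     = indicator-yes (z? _) (subst z (sym (trans (cong (a ∔_) (trans (cong (_∔ 0ᵛ) (0◂ u)) (∔-identityʳ 0ᵛ))) (∔-identityʳ a))) za)
    ... | no _     | yes refl = indicator-yes (z? _) (subst z (sym 1◂u) zu)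
    ... | no ν≢0   | no ν≢1   = indicator-no (z? _) (λ h → ℕ.<⇒≱ (subst (_< 2) (sym e≡1) ℕ.≤-refl)
      (∑-two (λ μ → nonZero μ * cnt (a ∔ μ ◂ w) v) (λ eq → ν≢1 (*-cancelˡ {μ} μ≢0 (trans (*-comm μ ν) (trans eq (*-comm 1# μ))))) (weight ν ν≢0 h) (weight 1# 1≢0 (subst z (sym 1◂u) zu))))

  -- The flat is enlarged to dimension d - 1 only, so that the last direction can still be chosen.
  -- This fails to give 2Q only if some last direction adds fewer than two zeros and leaves a
  -- residue below 2; then exactly one zero is added and c + 1 = q.
  line-step : ∀ a u → z a → Indep (u ∷ []) → 2 ≤ cnt a (u ∷ []) → cnt a (u ∷ []) < q → Q * 2 ≤ size ⊎ (cnt a (u ∷ []) ≡ suc q₂ × TwoPointLine a)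
  line-step a u za ind 2≤c c<q = go d refl
    where
    c = cnt a (u ∷ [])
    c%q : c % q ≡ c
    c%q = m<n⇒m%n≡m c<q
    go : ∀ d′ → d′ ≡ d → Q * 2 ≤ size ⊎ (c ≡ suc q₂ × TwoPointLine a)
    -- For d = 0 a line already exceeds dimension d, so c would be 0 modulo q.
    go zero    eq = contradiction (trans (sym c%q) (cnt-high a (u ∷ []) (subst (_< 1) eq (s≤s z≤n)))) (ℕ.>⇒≢ (ℕ.≤-trans (s≤s z≤n) 2≤c))
    go (suc zero) eq = inj₁ (large-residues eq a (u ∷ []) 2 (subst (2 ≤_) (sym c%q) 2≤c))
    go (suc (suc d′)) eq with raise d′ a (u ∷ []) ind
    -- Stuck in dimension at most d - 2: the codimension is at least m + 2, and q² ≥ 2(q - 1).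
    ... | inj₂ (k′ , v′ , k′< , ind′ , eqc , h) = inj₁ (ℕ.≮⇒≥ λ size<2Q → ℕ.<-irrefl refl (begin-strict
      suc q₂ * size + 1  ≤⟨ ℕ.+-monoʳ-≤ (suc q₂ * size) (s≤s z≤n) ⟩
      suc q₂ * size + suc q₂  ≡⟨ trans (ℕ.+-comm _ (suc q₂)) (sym (ℕ.*-suc (suc q₂) size)) ⟩
      suc q₂ * suc size  ≤⟨ ℕ.*-monoʳ-≤ (suc q₂) size<2Q ⟩
      suc q₂ * (Q * 2)  ≤⟨ ℕ.m≤m+n _ (q₂ * q₂ * Q + 2 * q₂ * Q + 2 * Q) ⟩
      suc q₂ * (Q * 2) + (q₂ * q₂ * Q + 2 * q₂ * Q + 2 * Q) ≡⟨ lem q₂ Q ⟩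
      q ^ 2 * Q  ≤⟨ q^-bound 2 j ⟩
      q ^ (2 + m + j)  ≡⟨ ℕ.*-identityʳ _ ⟨
      q ^ (2 + m + j) * 1  <⟨ ℕ.m<m+n _ (ℕ.*-mono-≤ {1} {suc q₂} {1} (s≤s z≤n) (ℕ.≤-trans (s≤s z≤n) (subst (2 ≤_) (sym eqc) 2≤c))) ⟩
      q ^ (2 + m + j) * 1 + suc q₂ * cnt a v′  ≤⟨ extension-bound (2 + m + j) a v′ (proj₂ cd) ind′ 1 h ⟩
      suc q₂ * size + 1 ∎))
      where
      open ℕ.≤-Reasoning
      cd = codim {k′} 2 (ℕ.≤-trans (s≤s k′<) (ℕ.≤-reflexive (trans (cong suc (ℕ.+-comm d′ 1)) eq)))
      j = proj₁ cd
      lem : ∀ q Q → suc q * (Q * 2) + (q * q * Q + 2 * q * Q + 2 * Q) ≡ (suc (suc q) * (suc (suc q) * 1)) * Q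
      lem = solve-∀
    ... | inj₁ (v , ind′ , eqc) with searchᵛ n (λ w → ¬? (InSpan? v w) ×-dec (2 ℕ.≤? (cnt a (w ∷ v) % q)))
    ...   | yes (w , w∉ , le) = inj₁ (large-residues (trans (cong suc (ℕ.+-comm d′ 1)) eq) a (w ∷ v) 2 le)
    ...   | no none with searchᵛ n (λ w → ¬? (InSpan? v w) ×-dec (extra a v w ℕ.<? 2))
    -- Every last direction adds at least two zeros: average with t = 2 in codimension m + 1. The c
    -- ≥ 2 zeros already present absorb the summand t.
    ...     | no none′ = inj₁ (ℕ.*-cancelˡ-≤ (suc q₂) (ℕ.+-cancelʳ-≤ 2 _ _ (begin
      suc q₂ * (Q * 2) + 2  ≤⟨ ℕ.+-monoʳ-≤ (suc q₂ * (Q * 2)) (ℕ.≤-trans 2≤c (ℕ.≤-trans (ℕ.m≤m+n c (q₂ * c)) (ℕ.≤-reflexive (cong (suc q₂ *_) (sym eqc))))) ⟩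
      suc q₂ * (Q * 2) + suc q₂ * cnt a v  ≤⟨ ℕ.+-monoˡ-≤ (suc q₂ * cnt a v) (ℕ.≤-trans (ℕ.≤-trans (ℕ.m≤m+n _ (Q * 2)) (ℕ.≤-reflexive (lem q₂ Q))) (ℕ.*-monoˡ-≤ 2 (q^-bound 1 j))) ⟩
      q ^ (1 + m + j) * 2 + suc q₂ * cnt a v  ≤⟨ extension-bound (1 + m + j) a v (proj₂ cd) ind′ 2 (λ w w∉ → ℕ.≮⇒≥ (λ lt → none′ (w , w∉ , lt))) ⟩
      suc q₂ * size + 2 ∎)))
      where
      open ℕ.≤-Reasoning
      cd = codim {d′ + 1} 1 (ℕ.≤-reflexive (trans (cong suc (ℕ.+-comm d′ 1)) eq))
      j = proj₁ cd
      lem : ∀ q Q → suc q * (Q * 2) + Q * 2 ≡ (suc (suc q) * 1) * Q * 2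
      lem = solve-∀
    ...     | yes (w , w∉ , e<2) = inj₂ (c≡ , two-point-line a v w za w∉ e≡1)
      where
      total : cnt a (w ∷ v) ≡ c + extra a v w
      total = trans (cnt-extra a w v) (cong (_+ extra a v w) eqc)
      small : (c + extra a v w) % q < 2
      small = subst (λ t → t % q < 2) total (ℕ.≰⇒> (λ le → none (w , w∉ , le)))
      e≡1 : extra a v w ≡ 1
      e≡1 = only (extra a v w) e<2 small
        where
        only : ∀ e → e < 2 → (c + e) % q < 2 → e ≡ 1
        only zero          _ s = contradiction (subst (λ t → t % q < 2) (ℕ.+-identityʳ c) s) (ℕ.≤⇒≯ (subst (2 ≤_) (sym c%q) 2≤c))
        only (suc zero)    _ _ = refl
        only (suc (suc _)) (s≤s (s≤s ())) _
      c≡ : c ≡ suc q₂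
      c≡ with ℕ.<-cmp c (suc q₂)
      ... | tri≈ _ eq _ = eq
      ... | tri> _ _ gt = contradiction c<q (ℕ.≤⇒≯ gt)
      ... | tri< lt _ _ = contradiction small (ℕ.≤⇒≯ (ℕ.≤-trans (ℕ.m≤n⇒m≤1+n 2≤c) (ℕ.≤-reflexive (sym (trans (cong (λ e → (c + e) % q) e≡1) (trans (cong (_% q) (ℕ.+-comm c 1)) (m<n⇒m%n≡m (s≤s lt))))))))

  -- If the first line is exceptional, some line through a has exactly two zeros; were it
  -- exceptional as well, then 2 = q - 1, which q ≥ 4 excludes.
  twice-many-points : 2 ≤ q₂ → ∀ a u → z a → Indep (u ∷ []) → 2 ≤ cnt a (u ∷ []) → cnt a (u ∷ []) < q → Q * 2 ≤ size
  twice-many-points 2≤q₂ a u za ind 2≤c c<q with line-step a u za ind 2≤c c<q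
  ... | inj₁ h = h
  ... | inj₂ (_ , u′ , ind′ , c′≡2) with line-step a u′ za ind′ (ℕ.≤-reflexive (sym c′≡2)) (subst (_< q) (sym c′≡2) (s≤s (s≤s (ℕ.≤-trans (s≤s z≤n) 2≤q₂))))
  ...   | inj₁ h = h
  ...   | inj₂ (c′≡ , _) = contradiction (trans (sym c′≡2) c′≡) (ℕ.<⇒≢ (s≤s 2≤q₂))

  two-elements : q₂ ≡ 0 → ∀ x → x ≢ 0# → x ≡ 1#
  two-elements q₂≡0 x x≢0 with x ≟ 1#
  ... | yes eq = eq
  ... | no x≢1 = contradiction (ℕ.≤-trans (ℕ.≤-reflexive three) (ℕ.≤-trans (∑-mono bound) (ℕ.≤-reflexive (trans (∑-const 1) (ℕ.*-identityʳ q))))) (ℕ.<⇒≱ (s≤s (s≤s (s≤s (ℕ.≤-reflexive q₂≡0)))))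
    where
    three : 3 ≡ ∑ (λ y → indicator (y ≟ x) + (indicator (y ≟ 0#) + indicator (y ≟ 1#)))
    three = sym (trans (ΣF.∑-+ (λ y → indicator (y ≟ x)) (λ y → indicator (y ≟ 0#) + indicator (y ≟ 1#))) (cong₂ _+_ (∑-delta x) (∑-delta₂ 0# 1#)))
    bound : ∀ y → indicator (y ≟ x) + (indicator (y ≟ 0#) + indicator (y ≟ 1#)) ≤ 1
    bound y with y ≟ x | y ≟ 0# | y ≟ 1#
    ... | yes refl | yes eq   | _        = contradiction eq x≢0
    ... | yes refl | no _     | yes eq   = contradiction eq x≢1
    ... | yes _    | no _     | no _     = ℕ.≤-refl
    ... | no _     | yes refl | yes eq   = contradiction eq 0≢1
    ... | no _     | yes _    | no _     = ℕ.≤-refl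
    ... | no _     | no _     | yes _    = ℕ.≤-refl
    ... | no _     | no _     | no _     = z≤n

  third-element : 1 ≤ q₂ → ∃[ x ] (x ≢ 0# × x ≢ 1#)
  third-element 1≤q₂ with search (λ x → ¬? (x ≟ 0#) ×-dec ¬? (x ≟ 1#))
  ... | yes h = h
  ... | no none = contradiction (ℕ.≤-trans (ℕ.≤-reflexive (sym (trans (∑-const 1) (ℕ.*-identityʳ q)))) (ℕ.≤-trans (∑-mono bound) (ℕ.≤-reflexive (∑-delta₂ 0# 1#)))) (ℕ.<⇒≱ (s≤s (s≤s 1≤q₂)))
    where
    bound : ∀ x → 1 ≤ indicator (x ≟ 0#) + indicator (x ≟ 1#)
    bound x with x ≟ 0# | x ≟ 1#
    ... | yes _  | _      = s≤s z≤n
    ... | no _   | yes _  = s≤s z≤n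
    ... | no x≢0 | no x≢1 = contradiction (x , x≢0 , x≢1) none

  affine-criterion : ∀ a → z a → (∀ c u → z (a ∔ u) → z (a ∔ c ◂ u)) → (∀ u w → z (a ∔ u) → z (a ∔ w) → z (a ∔ (u ∔ w))) → IsAffineSubspace F z
  affine-criterion a za scale sum =
    a , (λ v → z (a ∔ v)) , (subst z (sym (∔-identityʳ a)) za , sum , scale) ,
    λ x → (λ zx → x ∔ ⊝ a , subst z (sym (∔-cancel a x)) zx , sym (∔-cancel a x)) , (λ { (v , zv , refl) → zv })

  -- For q ≥ 3 a nonempty set that contains the line through any two of its points is affine.
  secant : ∃ z → ¬ IsAffineSubspace F z → 1 ≤ q₂ → ∃[ a ] ∃[ u ] (z a × Indep (u ∷ []) × 2 ≤ cnt a (u ∷ []) × cnt a (u ∷ []) < q)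
  secant (a₀ , za₀) ¬affine 1≤q₂ with searchᵛ n (λ a → searchᵛ n (λ u → search (λ c → z? a ×-dec (z? (a ∔ u) ×-dec ¬? (z? (a ∔ c ◂ u))))))
  ... | yes (a , u , c , za , zu , ¬zc) = a , u , za , line-indep u≢0 , line-lower za zu ,
    subst (cnt a (u ∷ []) <_) (trans (∑ᵛ-const 1 1) (trans (ℕ.*-identityʳ (q * 1)) (ℕ.*-identityʳ q))) (∑ᵛ-strict 1 {f = λ cs → χ (a ∔ comb cs (u ∷ []))} {g = λ _ → 1} (λ x → indicator≤1 (z? (a ∔ comb x (u ∷ [])))) (c ∷ []) (ℕ.≤-reflexive (cong suc (indicator-no (z? _) (λ h → ¬zc (subst z (cong (a ∔_) (∔-identityʳ (c ◂ u))) h))))))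
    where
    u≢0 : u ≢ 0ᵛ
    u≢0 refl = ¬zc (subst z (sym (trans (cong (a ∔_) (◂0ᵛ c)) (∔-identityʳ a))) za)
  ... | no none = contradiction (affine-criterion a₀ za₀ (λ c u zu → closed a₀ u c za₀ zu) sum) ¬affine
    where
    closed : ∀ a u c → z a → z (a ∔ u) → z (a ∔ c ◂ u)
    closed a u c za zu with z? (a ∔ c ◂ u)
    ... | yes h = h
    ... | no ¬h = contradiction (a , u , c , za , zu , ¬h) none
    sum : ∀ u w → z (a₀ ∔ u) → z (a₀ ∔ w) → z (a₀ ∔ (u ∔ w))
    sum u w zu zw =
      -- a₀ + (u + w) lies on the line through a₀ + k w and a₀ + l′ u, where l l′ = 1 and (1 - l) k
      -- = 1; this requires l different from 0 and 1.
      let l , l≢0 , l≢1 = third-element 1≤q₂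
          l′ , ll′≡1 = invertible l l≢0
          k , k≡1 = invertible (1# ⊞ ⊟ l) (λ eq → l≢1 (sym (x-y≡0⇒x≡y 1# l eq)))
      in subst z (mix l l′ k ll′≡1 k≡1 a₀ u w)
           (closed (a₀ ∔ k ◂ w) (l′ ◂ u ∔ ⊝ (k ◂ w)) l (closed a₀ w k za₀ zw)
             (subst z (sym (swap a₀ (k ◂ w) (l′ ◂ u))) (closed a₀ u l′ za₀ zu)))
      where
      swap : ∀ (a b c : Vec K n) → (a ∔ b) ∔ (c ∔ ⊝ b) ≡ a ∔ c
      swap a b c = trans (∔-assoc a b (c ∔ ⊝ b)) (cong (a ∔_) (∔-cancel b c))
      mix : ∀ l l′ k → l ⊠ l′ ≡ 1# → (1# ⊞ ⊟ l) ⊠ k ≡ 1# → ∀ {n} (a u w : Vec K n) → (a ∔ k ◂ w) ∔ l ◂ (l′ ◂ u ∔ ⊝ (k ◂ w)) ≡ a ∔ (u ∔ w)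
      mix l l′ k e e′ [] [] [] = refl
      mix l l′ k e e′ (a ∷ as) (u ∷ us) (w ∷ ws) = cong₂ _∷_ (begin
        (a ⊞ k ⊠ w) ⊞ l ⊠ (l′ ⊠ u ⊞ (⊟ 1#) ⊠ (k ⊠ w))  ≡⟨ cong (λ x → (a ⊞ x) ⊞ l ⊠ (l′ ⊠ u ⊞ (⊟ 1#) ⊠ (k ⊠ w))) (*-identityˡ (k ⊠ w)) ⟨
        (a ⊞ 1# ⊠ (k ⊠ w)) ⊞ l ⊠ (l′ ⊠ u ⊞ (⊟ 1#) ⊠ (k ⊠ w))  ≡⟨ solve 7 (λ o a u w l l′ k → (a :+ o :* (k :* w)) :+ l :* (l′ :* u :+ (:- o) :* (k :* w)) := a :+ ((l :* l′) :* u :+ (o :* ((o :* k) :* w) :+ ((:- o) :* (l :* k) :* w :+ (o :- o :* o) :* (k :* w))))) refl 1# a u w l l′ k ⟩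
        _ ≡⟨ cong (λ x → a ⊞ ((l ⊠ l′) ⊠ u ⊞ x)) tidy ⟩
        a ⊞ ((l ⊠ l′) ⊠ u ⊞ ((1# ⊞ ⊟ l) ⊠ k) ⊠ w)  ≡⟨ cong₂ (λ x y → a ⊞ (x ⊠ u ⊞ y ⊠ w)) e e′ ⟩
        a ⊞ (1# ⊠ u ⊞ 1# ⊠ w)  ≡⟨ cong₂ (λ x y → a ⊞ (x ⊞ y)) (*-identityˡ u) (*-identityˡ w) ⟩
        a ⊞ (u ⊞ w) ∎) (mix l l′ k e e′ as us ws)
        where
        open ≡-Reasoning
        open FS
        tidy : 1# ⊠ ((1# ⊠ k) ⊠ w) ⊞ ((⊟ 1#) ⊠ (l ⊠ k) ⊠ w ⊞ (1# ⊞ ⊟ (1# ⊠ 1#)) ⊠ (k ⊠ w)) ≡ ((1# ⊞ ⊟ l) ⊠ k) ⊠ w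
        tidy = trans (cong₂ (λ x y → x ⊞ ((⊟ 1#) ⊠ (l ⊠ k) ⊠ w ⊞ (1# ⊞ ⊟ y) ⊠ (k ⊠ w))) (*-identityˡ _) (*-identityˡ 1#))
          (trans (solve 4 (λ o l k w → (o :* k) :* w :+ ((:- o) :* (l :* k) :* w :+ (o :+ :- o) :* (k :* w)) := (o :* k) :* w :- o :* ((l :* k) :* w)) refl 1# l k w)
            (trans (cong (λ x → (1# ⊠ k) ⊠ w ⊞ ⊟ x) (*-identityˡ _)) (solve 4 (λ o l k w → (o :* k) :* w :- (l :* k) :* w := ((o :+ :- l) :* k) :* w) refl 1# l k w)))

  -- Over two elements a line through two zeros consists of them, so lines carry no information. A
  -- parallelogram with exactly one vertex outside z takes the place of the secant; its count 3 is
  -- odd.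
  three-point-plane : ∃ z → ¬ IsAffineSubspace F z → q₂ ≡ 0 → ∃[ a ] ∃[ v ] (Indep {k = 2} v × cnt a v ≡ 3)
  three-point-plane (a₀ , za₀) ¬affine q₂≡0 with searchᵛ n (λ a → searchᵛ n (λ u → searchᵛ n (λ w → z? a ×-dec (z? (a ∔ u) ×-dec (z? (a ∔ w) ×-dec ¬? (z? (a ∔ (u ∔ w))))))))
  ... | no none = contradiction (affine-criterion a₀ za₀ scale (λ u w zu zw → sum u w zu zw)) ¬affine
    where
    sum : ∀ u w → z (a₀ ∔ u) → z (a₀ ∔ w) → z (a₀ ∔ (u ∔ w))
    sum u w zu zw with z? (a₀ ∔ (u ∔ w))
    ... | yes h = h
    ... | no ¬h = contradiction (a₀ , u , w , za₀ , zu , zw , ¬h) none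
    scale : ∀ c u → z (a₀ ∔ u) → z (a₀ ∔ c ◂ u)
    scale c u zu with c ≟ 0#
    ... | yes refl = subst z (sym (trans (cong (a₀ ∔_) (0◂ u)) (∔-identityʳ a₀))) za₀
    ... | no c≢0 = subst z (cong (a₀ ∔_) (sym (trans (cong (_◂ u) (two-elements q₂≡0 c c≢0)) (1◂ u)))) zu
  ... | yes (a , u , w , za , zu , zw , ¬zuw) = a , u ∷ w ∷ [] , (u∉ , proj₁ (line-indep w≢0) , tt) , total
    where
    w≢0 : w ≢ 0ᵛ
    w≢0 refl = ¬zuw (subst z (cong (a ∔_) (sym (∔-identityʳ u))) zu)
    u≢0 : u ≢ 0ᵛ
    u≢0 refl = ¬zuw (subst z (cong (a ∔_) (sym (∔-identityˡ w))) zw)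
    1+1≡0 : 1# ⊞ 1# ≡ 0#
    1+1≡0 = trans (cong (1# ⊞_) (sym (+-identityʳ 1#))) (subst (λ k → suc (suc k) · 1# ≡ 0#) q₂≡0 q·1≡0)
    u∉ : ¬ InSpan (w ∷ []) u
    u∉ (c ∷ [] , eq) with c ≟ 0#
    ... | yes refl = u≢0 (trans (sym eq) (trans (∔-identityʳ (0# ◂ w)) (0◂ w)))
    ... | no c≢0 = ¬zuw (subst z (sym (trans (cong (a ∔_) u+w≡0) (∔-identityʳ a))) za)
      where
      u≡w : u ≡ w
      u≡w = trans (sym eq) (trans (∔-identityʳ (c ◂ w)) (trans (cong (_◂ w) (two-elements q₂≡0 c c≢0)) (1◂ w)))
      u+w≡0 : u ∔ w ≡ 0ᵛ
      u+w≡0 = trans (cong₂ _∔_ (trans u≡w (sym (1◂ w))) (sym (1◂ w))) (trans (sym (◂-distribʳ 1# 1# w)) (trans (cong (_◂ w) 1+1≡0) (0◂ w)))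
    ∑-two-elements : ∀ f → ∑ f ≡ f 0# + f 1#
    ∑-two-elements f = trans (∑-split f) (cong (f 0# +_) (trans (ΣF.∑-single _ 1# vanish) (trans (cong (_* f 1#) (indicator-yes (¬? (1# ≟ 0#)) 1≢0)) (ℕ.*-identityˡ (f 1#)))))
      where
      vanish : ∀ y → y ≢ 1# → nonZero y * f y ≡ 0
      vanish y y≢1 with y ≟ 0#
      ... | yes _  = refl
      ... | no y≢0 = contradiction (two-elements q₂≡0 y y≢0) y≢1
    g : K → K → ℕ
    g μ ν = χ (a ∔ (μ ◂ u ∔ (ν ◂ w ∔ 0ᵛ)))
    eq₀₀ : a ∔ (0# ◂ u ∔ (0# ◂ w ∔ 0ᵛ)) ≡ a
    eq₀₀ = trans (cong (a ∔_) (trans (cong₂ _∔_ (0◂ u) (trans (∔-identityʳ (0# ◂ w)) (0◂ w))) (∔-identityʳ 0ᵛ))) (∔-identityʳ a)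
    eq₀₁ : a ∔ (0# ◂ u ∔ (1# ◂ w ∔ 0ᵛ)) ≡ a ∔ w
    eq₀₁ = cong (a ∔_) (trans (cong₂ _∔_ (0◂ u) (trans (∔-identityʳ (1# ◂ w)) (1◂ w))) (∔-identityˡ w))
    eq₁₀ : a ∔ (1# ◂ u ∔ (0# ◂ w ∔ 0ᵛ)) ≡ a ∔ u
    eq₁₀ = cong (a ∔_) (trans (cong₂ _∔_ (1◂ u) (trans (∔-identityʳ (0# ◂ w)) (0◂ w))) (∔-identityʳ u))
    eq₁₁ : a ∔ (1# ◂ u ∔ (1# ◂ w ∔ 0ᵛ)) ≡ a ∔ (u ∔ w)
    eq₁₁ = cong (a ∔_) (cong₂ _∔_ (1◂ u) (trans (∔-identityʳ (1# ◂ w)) (1◂ w)))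
    total : cnt a (u ∷ w ∷ []) ≡ 3
    total = begin
      ∑ (λ μ → ∑ (g μ))  ≡⟨ ∑-two-elements (λ μ → ∑ (g μ)) ⟩
      ∑ (g 0#) + ∑ (g 1#)  ≡⟨ cong₂ _+_ (∑-two-elements (g 0#)) (∑-two-elements (g 1#)) ⟩
      (g 0# 0# + g 0# 1#) + (g 1# 0# + g 1# 1#)  ≡⟨ cong₂ _+_ (cong₂ _+_ (indicator-yes (z? _) (subst z (sym eq₀₀) za)) (indicator-yes (z? _) (subst z (sym eq₀₁) zw)))
                                                                 (cong₂ _+_ (indicator-yes (z? _) (subst z (sym eq₁₀) zu)) (indicator-no (z? _) (λ h → ¬zuw (subst z eq₁₁ h)))) ⟩
      3 ∎
      where open ≡-Reasoning

  strict-bound : ∃ z → ¬ IsAffineSubspace F z → Q < size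
  strict-bound nonempty ¬affine with q₂ ℕ.≟ 0
  ... | yes q₂≡0 =
    let a , v , ind , c≡3 = three-point-plane nonempty ¬affine q₂≡0
    in many-points a v ind (subst (2 ≤_) (sym c≡3) (s≤s (s≤s z≤n))) (λ eq → odd (trans (cong (_% q) (sym c≡3)) eq))
    where
    odd : 3 % q ≢ 0
    odd = subst (λ k → 3 % suc (suc k) ≢ 0) (sym q₂≡0) (λ ())
  ... | no q₂≢0 =
    let a , u , za , ind , 2≤c , c<q = secant nonempty ¬affine (ℕ.n≢0⇒n>0 q₂≢0)
    in many-points a (u ∷ []) ind 2≤c (λ eq → ℕ.>⇒≢ (ℕ.≤-trans (s≤s z≤n) 2≤c) (trans (sym (m<n⇒m%n≡m c<q)) eq))

  double-bound : ∃ z → ¬ IsAffineSubspace F z → 2 ≤ q₂ → Q * 2 ≤ size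
  double-bound nonempty ¬affine 2≤q₂ =
    let a , u , za , ind , 2≤c , c<q = secant nonempty ¬affine (ℕ.≤-trans (s≤s z≤n) 2≤q₂)
    in twice-many-points 2≤q₂ a u za ind 2≤c c<q

  -- Zero sets closed under scalar multiplication.

  module Cone (cone : ∀ c x → z x → z (c ◂ x)) (nonempty : ∃ z) where
    z0 : z 0ᵛ
    z0 = subst z (0◂ (proj₁ nonempty)) (cone 0# (proj₁ nonempty) (proj₂ nonempty))

    -- Equals n + 2 - d. A plane residue counts as large from q / M on, and M - 1 is the dimension
    -- that `tower` reaches.
    M : ℕ
    M = suc (suc m)

    -- The nonzero multiples of one extra zero are extra zeros, one in each of the q - 1 translates
    -- ν w + ⟨v⟩ with ν ≠ 0.
    extra-cone : ∀ {k} (v : Vec (Vec K n) k) w → 0 < extra 0ᵛ v w → suc q₂ ≤ extra 0ᵛ v w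
    extra-cone v w 0<e =
      let μ , μ≢0 , cs , zx = extra-positive 0ᵛ v w 0<e
          μ′ , μμ′≡1 = invertible μ μ≢0
      in ℕ.≤-trans (ℕ.≤-reflexive (sym (cong (_∸ 1) ∑-nonZero))) (∑-mono (λ ν → bound ν (cnt-point (0ᵛ ∔ ν ◂ w) v ((ν ⊠ μ′) ◂ cs)
           (subst z (scaled (ν ⊠ μ′) μ ν (trans (*-assoc ν μ′ μ) (trans (cong (ν ⊠_) (trans (*-comm μ′ μ) μμ′≡1)) (*-identityʳ ν))) cs) (cone (ν ⊠ μ′) _ zx)))))
      where
      bound : ∀ ν {c} → 1 ≤ c → nonZero ν ≤ nonZero ν * c
      bound ν {suc c} _ = ℕ.m≤m*n (nonZero ν) (suc c)
      scaled : ∀ c μ ν → c ⊠ μ ≡ ν → ∀ cs → c ◂ ((0ᵛ ∔ μ ◂ w) ∔ comb cs v) ≡ (0ᵛ ∔ ν ◂ w) ∔ comb (c ◂ cs) v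
      scaled c μ ν eq cs = trans (◂-distribˡ c (0ᵛ ∔ μ ◂ w) (comb cs v)) (cong₂ _∔_
        (trans (◂-distribˡ c 0ᵛ (μ ◂ w)) (cong₂ _∔_ (◂0ᵛ c) (trans (sym (◂-assoc c μ w)) (cong (_◂ w) eq)))) (sym (comb-◂ c cs v)))

    origin : ∀ {k} (v : Vec (Vec K n) k) → 1 ≤ cnt 0ᵛ v
    origin v = cnt-point 0ᵛ v 0ᵛ (subst z (sym (trans (∔-identityˡ _) (comb-0 v))) z0)

    -- If the flat grows to dimension d, its residue r bounds all translates, and r M ≥ q turns Q r
    -- into q Q / M. If it gets stuck, each new direction adds at least q - 1 zeros, and averaging
    -- gives even q Q.
    rich-flat : ∀ {k} (v : Vec (Vec K n) k) → Indep v → q ≤ (cnt 0ᵛ v % q) * M → q * Q ≤ M * size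
    rich-flat {k} v ind rich with k ℕ.≤? d
    ... | no k≰d = contradiction (subst (λ r → q ≤ r * M) (cnt-high 0ᵛ v (ℕ.≰⇒> k≰d)) rich) (ℕ.<⇒≱ (s≤s z≤n))
    ... | yes k≤d with raise (d ∸ k) 0ᵛ v ind
    ...   | inj₁ (v′ , ind′ , eq) = begin
      q * Q  ≤⟨ ℕ.*-monoˡ-≤ Q rich ⟩
      (cnt 0ᵛ v % q) * M * Q  ≡⟨ lem (cnt 0ᵛ v % q) M Q ⟩
      M * (Q * (cnt 0ᵛ v % q))  ≤⟨ ℕ.*-monoʳ-≤ M (large-residues (ℕ.m∸n+n≡m k≤d) 0ᵛ v′ (cnt 0ᵛ v % q) (ℕ.≤-reflexive (cong (_% q) (sym eq)))) ⟩
      M * size ∎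
      where
      open ℕ.≤-Reasoning
      lem : ∀ r M Q → r * M * Q ≡ M * (Q * r)
      lem = solve-∀
    ...   | inj₂ (k′ , v′ , k′< , ind′ , eq , h) = begin
      q * Q  ≡⟨ cong (_* Q) (ℕ.*-identityʳ q) ⟨
      q ^ 1 * Q  ≤⟨ q^-bound 1 j ⟩
      q ^ (1 + m + j)  ≤⟨ ℕ.*-cancelˡ-≤ (suc q₂) (ℕ.+-cancelʳ-≤ (suc q₂) _ _ (begin
        suc q₂ * q ^ (1 + m + j) + suc q₂  ≤⟨ ℕ.+-mono-≤ (ℕ.≤-reflexive (ℕ.*-comm (suc q₂) _)) (ℕ.m≤m*n (suc q₂) (cnt 0ᵛ v′) {{ℕ.>-nonZero (origin v′)}}) ⟩
        q ^ (1 + m + j) * suc q₂ + suc q₂ * cnt 0ᵛ v′  ≤⟨ extension-bound (1 + m + j) 0ᵛ v′ (proj₂ cd) ind′ (suc q₂) (λ w w∉ → extra-cone v′ w (h w w∉)) ⟩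
        suc q₂ * size + suc q₂ ∎)) ⟩
      size  ≤⟨ ℕ.m≤m+n size (suc m * size) ⟩
      M * size ∎
      where
      open ℕ.≤-Reasoning
      cd = codim 1 (ℕ.≤-trans k′< (ℕ.≤-reflexive (ℕ.m∸n+n≡m k≤d)))
      j = proj₁ cd

    pencil : Vec K n → Vec K n → ℕ
    pencil x y = ∑ (λ μ → χ (y ∔ μ ◂ x))

    pencil≤q : ∀ x y → pencil x y ≤ q
    pencil≤q x y = ℕ.≤-trans (∑-mono (λ μ → indicator≤1 (z? (y ∔ μ ◂ x)))) (ℕ.≤-reflexive (trans (∑-const 1) (ℕ.*-identityʳ q)))

    pencil-0 : ∀ x → z x → pencil x 0ᵛ ≡ q
    pencil-0 x zx = trans (ΣF.∑-cong (λ μ → indicator-yes (z? _) (subst z (sym (∔-identityˡ (μ ◂ x))) (cone μ x zx)))) (trans (∑-const 1) (ℕ.*-identityʳ q))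

    pencil-scale : ∀ x y {α} → α ≢ 0# → pencil x (α ◂ y) ≡ pencil x y
    pencil-scale x y {α} α≢0 = trans (sym (ΣF.∑-dilate α≢0 (λ μ → χ (α ◂ y ∔ μ ◂ x)))) (ΣF.∑-cong (λ μ → ℕ.≤-antisym (forth μ) (back μ)))
      where
      eq : ∀ μ → α ◂ (y ∔ μ ◂ x) ≡ α ◂ y ∔ (α ⊠ μ) ◂ x
      eq μ = trans (◂-distribˡ α y (μ ◂ x)) (cong (α ◂ y ∔_) (sym (◂-assoc α μ x)))
      back : ∀ μ → χ (y ∔ μ ◂ x) ≤ χ (α ◂ y ∔ (α ⊠ μ) ◂ x)
      back μ = indicator-mono (z? _) (z? _) (λ h → subst z (eq μ) (cone α _ h))
      forth : ∀ μ → χ (α ◂ y ∔ (α ⊠ μ) ◂ x) ≤ χ (y ∔ μ ◂ x)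
      forth μ = indicator-mono (z? _) (z? _) (λ h → let β , inv = ◂-inverse α≢0 in subst z (trans (cong (β ◂_) (sym (eq μ))) (inv (y ∔ μ ◂ x))) (cone β _ h))

    -- The line ⟨x⟩ lies in z, which gives q. The other q - 1 lines α y + ⟨x⟩ are multiples of one
    -- another and have equally many zeros.
    cnt-pencil : ∀ x y → z x → cnt 0ᵛ (y ∷ x ∷ []) ≡ q + suc q₂ * pencil x y
    cnt-pencil x y zx = begin
      ∑ (λ α → ∑ (λ μ → χ (0ᵛ ∔ (α ◂ y ∔ (μ ◂ x ∔ 0ᵛ)))))  ≡⟨ ΣF.∑-cong (λ α → ΣF.∑-cong (λ μ → cong χ (trans (∔-identityˡ _) (cong (α ◂ y ∔_) (∔-identityʳ (μ ◂ x)))))) ⟩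
      ∑ (λ α → pencil x (α ◂ y))  ≡⟨ ∑-split (λ α → pencil x (α ◂ y)) ⟩
      pencil x (0# ◂ y) + ∑ (λ α → nonZero α * pencil x (α ◂ y)) ≡⟨ cong₂ _+_ (trans (cong (pencil x) (0◂ y)) (pencil-0 x zx)) (trans (ΣF.∑-cong scale) (trans (∑-* (pencil x y) nonZero) (trans (cong (pencil x y *_) (cong (_∸ 1) ∑-nonZero)) (ℕ.*-comm (pencil x y) (suc q₂))))) ⟩
      q + suc q₂ * pencil x y ∎
      where
      open ≡-Reasoning
      scale : ∀ α → nonZero α * pencil x (α ◂ y) ≡ pencil x y * nonZero α
      scale α with α ≟ 0#
      ... | yes _  = sym (ℕ.*-zeroʳ (pencil x y))
      ... | no α≢0 = trans (ℕ.*-identityˡ _) (trans (pencil-scale x y α≢0) (sym (ℕ.*-identityʳ _)))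

    residue : ∀ g → 1 ≤ g → g ≤ q → (q + suc q₂ * g) % q ≡ q ∸ g
    residue g 1≤g g≤q = trans (cong (_% q) rearrange) (trans ([m+kn]%n≡m%n (q ∸ g) g q) (m<n⇒m%n≡m (ℕ.∸-monoʳ-< 1≤g g≤q)))
      where
      rearrange : q + suc q₂ * g ≡ q ∸ g + g * q
      rearrange = trans (cong (_+ suc q₂ * g) (sym (ℕ.m∸n+n≡m g≤q))) (lem (q ∸ g) g q₂)
        where
        lem : ∀ a g q → a + g + suc q * g ≡ a + g * suc (suc q)
        lem = solve-∀

    Rich : Vec K n → Vec K n → Set
    Rich x y = z x × z y × Indep (y ∷ x ∷ []) × q ≤ (cnt 0ᵛ (y ∷ x ∷ []) % q) * M

    Rich? : ∀ x y → Dec (Rich x y)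
    Rich? x y = z? x ×-dec (z? y ×-dec ((¬? (InSpan? (x ∷ []) y) ×-dec (¬? (InSpan? [] x) ×-dec yes tt)) ×-dec (q ℕ.≤? (cnt 0ᵛ (y ∷ x ∷ []) % q) * M)))

    -- With g the number of zeros on y + ⟨x⟩, the plane has residue q - g. If it is not rich, (q -
    -- g) M < q, that is, M g > (M - 1) q. For y = 0 the line lies in z and g = q.
    pencil-large : (∀ x y → ¬ Rich x y) → ∀ x y → z x → z y → (y ≢ 0ᵛ → Indep (y ∷ x ∷ [])) → suc m * q ≤ M * pencil x y
    pencil-large poor x y zx zy ind with y ≟ᵛ 0ᵛ
    ... | yes refl = subst (λ g → suc m * q ≤ M * g) (sym (pencil-0 x zx)) (ℕ.m≤n+m (suc m * q) q)
    ... | no y≢0 = ℕ.+-cancelʳ-≤ q _ _ (begin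
      suc m * q + q  ≡⟨ lem₁ m q ⟩
      q * M  ≡⟨ cong (_* M) (ℕ.m∸n+n≡m g≤q) ⟨
      (q ∸ g + g) * M  ≡⟨ lem₂ (q ∸ g) g M ⟩
      M * g + (q ∸ g) * M  ≤⟨ ℕ.+-monoʳ-≤ (M * g) (ℕ.<⇒≤ small) ⟩
      M * g + q ∎)
      where
      open ℕ.≤-Reasoning
      g = pencil x y
      g≤q : g ≤ q
      g≤q = pencil≤q x y
      1≤g : 1 ≤ g
      1≤g = ℕ.≤-trans (ℕ.≤-reflexive (sym (indicator-yes (z? _) (subst z (sym (trans (cong (y ∔_) (0◂ x)) (∔-identityʳ y))) zy)))) (∑ᵛ-lower {1} (λ { (μ ∷ []) → χ (y ∔ μ ◂ x) }) (0# ∷ []))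
      small : (q ∸ g) * M < q
      small = ℕ.≰⇒> (λ le → poor x y (zx , zy , ind y≢0 , subst (λ r → q ≤ r * M) (sym (trans (cong (_% q) (cnt-pencil x y zx)) (residue g 1≤g g≤q))) le))
      lem₁ : ∀ m q → suc m * q + q ≡ q * suc (suc m)
      lem₁ = solve-∀
      lem₂ : ∀ a g M → (a + g) * M ≡ M * g + a * M
      lem₂ = solve-∀

    cnt-∷-pencil : ∀ {k} x (v : Vec (Vec K n) k) → cnt 0ᵛ (x ∷ v) ≡ ∑ᵛ k (λ cs → pencil x (comb cs v))
    cnt-∷-pencil {k} x v = trans (ΣF.∑-cong (λ μ → ΣF.∑ᵛ-cong k (λ cs → cong χ (trans (∔-identityˡ _) (∔-comm (μ ◂ x) (comb cs v)))))) (ΣF.∑-∑ᵛ-swap k (λ μ cs → χ (comb cs v ∔ μ ◂ x)))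

    -- The flat ⟨x, v⟩ is the union of the lines y + ⟨x⟩ with y in ⟨v⟩; each y in z yields at least
    -- (1 - 1/M) q zeros on its line.
    cnt-growth : (∀ x y → ¬ Rich x y) → ∀ {k} x (v : Vec (Vec K n) k) → z x → ¬ InSpan v x → suc m * q * cnt 0ᵛ v ≤ M * cnt 0ᵛ (x ∷ v)
    cnt-growth poor {k} x v zx x∉ = begin
      suc m * q * cnt 0ᵛ v  ≡⟨ ∑ᵛ-* k (suc m * q) (λ cs → χ (0ᵛ ∔ comb cs v)) ⟨
      ∑ᵛ k (λ cs → suc m * q * χ (0ᵛ ∔ comb cs v))  ≤⟨ ∑ᵛ-mono k bound ⟩
      ∑ᵛ k (λ cs → M * pencil x (comb cs v))  ≡⟨ ∑ᵛ-* k M (λ cs → pencil x (comb cs v)) ⟩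
      M * ∑ᵛ k (λ cs → pencil x (comb cs v))  ≡⟨ cong (M *_) (cnt-∷-pencil x v) ⟨
      M * cnt 0ᵛ (x ∷ v) ∎
      where
      open ℕ.≤-Reasoning
      indep : ∀ cs → comb cs v ≢ 0ᵛ → Indep (comb cs v ∷ x ∷ [])
      indep cs y≢0 = (λ { (c ∷ [] , eq) → x∉ (InSpan-◂⁻¹ {w = x} (λ { refl → y≢0 (trans (sym eq) (trans (∔-identityʳ (0# ◂ x)) (0◂ x))) }) (cs , trans (sym eq) (∔-identityʳ (c ◂ x)))) })
        , (λ { ([] , eq) → x∉ (0ᵛ , trans (comb-0 v) eq) }) , tt
      bound : ∀ cs → suc m * q * χ (0ᵛ ∔ comb cs v) ≤ M * pencil x (comb cs v)
      bound cs with z? (0ᵛ ∔ comb cs v)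
      ... | no _  = ℕ.≤-trans (ℕ.≤-reflexive (ℕ.*-zeroʳ (suc m * q))) z≤n
      ... | yes h = ℕ.≤-trans (ℕ.≤-reflexive (ℕ.*-identityʳ (suc m * q))) (pencil-large poor x (comb cs v) zx (subst z (∔-identityˡ _) h) (indep cs))

    -- The span has only qᵏ ≤ Q elements, fewer than z.
    outside-span : Q < size → ∀ {k} (v : Vec (Vec K n) k) → Indep v → k ≤ m → ∃[ x ] (z x × ¬ InSpan v x)
    outside-span Q<size {k} v ind k≤m with searchᵛ n (λ x → z? x ×-dec ¬? (InSpan? v x))
    ... | yes h = h
    ... | no none = contradiction Q<size (ℕ.≤⇒≯ (ℕ.≤-trans (∑ᵛ-mono n (λ x → indicator-mono (z? x) (InSpan? v x) (inside x))) (ℕ.≤-trans (ℕ.≤-reflexive (∑ᵛ-span v ind)) (ℕ.^-monoʳ-≤ q k≤m))))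
      where
      inside : ∀ x → z x → InSpan v x
      inside x zx with InSpan? v x
      ... | yes s = s
      ... | no ∉  = contradiction (x , zx , ∉) none

    -- After k steps the fraction of zeros in the span is at least (1 - 1/M)ᵏ ≥ 1 - k/M = s/M; the
    -- induction carries the linear form of the bound.
    tower : Q < size → (∀ x y → ¬ Rich x y) → ∀ k s → k + s ≡ M → 1 ≤ s → ∃[ v ] (Indep {k = k} v × s * q ^ k ≤ M * cnt 0ᵛ v)
    tower Q<size poor zero    s eq 1≤s = [] , tt , ℕ.≤-trans (ℕ.≤-reflexive (trans (ℕ.*-identityʳ s) (trans eq (sym (ℕ.*-identityʳ M))))) (ℕ.*-monoʳ-≤ M (origin []))
    tower Q<size poor (suc k) s eq 1≤s =
      let v , ind , le = tower Q<size poor k (suc s) (trans (ℕ.+-suc k s) eq) (s≤s z≤n)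
          x , zx , x∉ = outside-span Q<size v ind k≤m
      in x ∷ v , (x∉ , ind) , ℕ.*-cancelˡ-≤ M (begin
        -- Here M s ≤ (M - 1)(s + 1) with difference k, as k + 1 + s = M: the step of Bernoulli's
        -- inequality.
        M * (s * (q * q ^ k))  ≤⟨ ℕ.m≤m+n _ (k * (q * q ^ k)) ⟩
        M * (s * (q * q ^ k)) + k * (q * q ^ k)  ≡⟨ cong (λ M → M * (s * (q * q ^ k)) + k * (q * q ^ k)) eq ⟨
        suc (k + s) * (s * (q * q ^ k)) + k * (q * q ^ k) ≡⟨ lem k s q (q ^ k) ⟩
        (k + s) * q * (suc s * q ^ k)  ≡⟨ cong (λ t → t * q * (suc s * q ^ k)) (ℕ.suc-injective eq) ⟩
        suc m * q * (suc s * q ^ k)  ≤⟨ ℕ.*-monoʳ-≤ (suc m * q) le ⟩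
        suc m * q * (M * cnt 0ᵛ v)  ≡⟨ lem′ (suc m * q) M (cnt 0ᵛ v) ⟩
        M * (suc m * q * cnt 0ᵛ v)  ≤⟨ ℕ.*-monoʳ-≤ M (cnt-growth poor x v zx x∉) ⟩
        M * (M * cnt 0ᵛ (x ∷ v)) ∎)
      where
      open ℕ.≤-Reasoning
      k≤m : k ≤ m
      k≤m = ℕ.s≤s⁻¹ (ℕ.≤-trans (ℕ.≤-trans (ℕ.≤-reflexive (ℕ.+-comm 1 k)) (ℕ.+-monoʳ-≤ k 1≤s)) (ℕ.≤-reflexive (ℕ.suc-injective eq)))
      lem : ∀ k s q r → suc (k + s) * (s * (q * r)) + k * (q * r) ≡ (k + s) * q * (suc s * r)
      lem = solve-∀
      lem′ : ∀ a M c → a * (M * c) ≡ M * (a * c)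
      lem′ = solve-∀

    cone-bound : Q < size → q * Q ≤ M * size
    cone-bound Q<size with searchᵛ n (λ x → searchᵛ n (λ y → Rich? x y))
    ... | yes (x , y , _ , _ , ind , rich) = rich-flat (y ∷ x ∷ []) ind rich
    ... | no poor =
      -- At k = m + 1 and s = 1 the span contains at least qᵐ⁺¹ / M zeros.
      let v , ind , le = tower Q<size (λ x y r → poor (x , y , r)) (suc m) 1 (ℕ.+-comm (suc m) 1) ℕ.≤-refl
      in ℕ.≤-trans (ℕ.≤-reflexive (sym (ℕ.*-identityˡ (q * Q)))) (ℕ.≤-trans le (ℕ.*-monoʳ-≤ M (cnt≤size 0ᵛ v ind)))

-- Polynomials as functions of bounded degree, and affine substitution.

open import Data.Vec using (sum; tabulate)

module PolynomialFunctions {q} (F : FiniteField q) where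
  open Vectors F
  open Monomials F
  open FS
  module Poly = Span FR id (λ _ _ → refl) refl
  open Poly using (Span; mono; add; Span-resp; Span-mono; Span-const; Span-+; Span-*; Span-↑)

  keep : ∀ {n} {P : Monomial F n → Set} → Decidable P → Poly F n → Poly F n
  keep P? [] = []
  keep P? ((c , e) ∷ f) with P? e
  ... | yes _ = (c , e) ∷ keep P? f
  ... | no  _ = keep P? f

  keep-length : ∀ {n} {P : Monomial F n → Set} (P? : Decidable P) f → length (keep P? f) ≤ length f
  keep-length P? [] = z≤n
  keep-length P? ((c , e) ∷ f) with P? e
  ... | yes _ = s≤s (keep-length P? f)
  ... | no  _ = ℕ.m≤n⇒m≤1+n (keep-length P? f)

  coeff-keep : ∀ {n} {P : Monomial F n → Set} (P? : Decidable P) f m → P m → coeff F (keep P? f) m ≡ coeff F f m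
  coeff-keep P? [] m Pm = refl
  coeff-keep P? ((c , e) ∷ f) m Pm with P? e
  ... | yes _ with Vec.≡-dec ℕ._≟_ e m
  ...   | yes _ = cong (c ⊞_) (coeff-keep P? f m Pm)
  ...   | no  _ = coeff-keep P? f m Pm
  coeff-keep P? ((c , e) ∷ f) m Pm | no ¬Pe with Vec.≡-dec ℕ._≟_ e m
  ...   | yes refl = contradiction Pm ¬Pe
  ...   | no  _    = coeff-keep P? f m Pm

  coeff-drop : ∀ {n} {P : Monomial F n → Set} (P? : Decidable P) f m → ¬ P m → coeff F (keep P? f) m ≡ 0#
  coeff-drop P? [] m ¬Pm = refl
  coeff-drop P? ((c , e) ∷ f) m ¬Pm with P? e
  ... | no _ = coeff-drop P? f m ¬Pm
  ... | yes Pe with Vec.≡-dec ℕ._≟_ e m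
  ...   | yes refl = contradiction Pe ¬Pm
  ...   | no  _    = coeff-drop P? f m ¬Pm

  eval-keep : ∀ {n} {P : Monomial F n → Set} (P? : Decidable P) f x → eval F f x ≡ eval F (keep P? f) x ⊞ eval F (keep (¬? ∘ P?) f) x
  eval-keep P? [] x = sym (+-identityʳ 0#)
  eval-keep P? ((c , e) ∷ f) x with P? e
  ... | yes _ = trans (cong (c ⊠ evalMono F e x ⊞_) (eval-keep P? f x)) (sym (+-assoc _ _ _))
  ... | no  _ = trans (cong (c ⊠ evalMono F e x ⊞_) (eval-keep P? f x)) (solve 3 (λ a b c → a :+ (b :+ c) := b :+ (a :+ c)) refl (c ⊠ evalMono F e x) (eval F (keep P? f) x) (eval F (keep (¬? ∘ P?) f) x))

  eval-monomial : ∀ {n} e (f : Poly F n) x → eval F (keep (λ e′ → Vec.≡-dec ℕ._≟_ e′ e) f) x ≡ coeff F f e ⊠ evalMono F e x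
  eval-monomial e [] x = sym (zeroˡ _)
  eval-monomial e ((c , e′) ∷ f) x with Vec.≡-dec ℕ._≟_ e′ e
  ... | yes refl = trans (cong (c ⊠ evalMono F e x ⊞_) (eval-monomial e f x)) (sym (distribʳ _ _ _))
  ... | no  _    = eval-monomial e f x

  -- A list may repeat exponents. The terms sharing the exponent of the first one evaluate to its
  -- coefficient, which is 0, times the monomial; the rest is a shorter list with the same property.
  eval-zero : ∀ {n} (f : Poly F n) → (∀ m → coeff F f m ≡ 0#) → ∀ x → eval F f x ≡ 0#
  eval-zero f h x = go (length f) f ℕ.≤-refl h
    where
    go : ∀ l f → length f ≤ l → (∀ m → coeff F f m ≡ 0#) → eval F f x ≡ 0#
    go l [] _ h = refl
    go (suc l) f@((c , e) ∷ f′) (s≤s len) h = trans (eval-keep is-e f x) (trans (cong₂ _⊞_ (trans (eval-monomial e f x) (trans (cong (_⊠ evalMono F e x) (h e)) (zeroˡ _)))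
      (go l (keep (¬? ∘ is-e) f) (ℕ.≤-trans shorter len) rest)) (+-identityʳ 0#))
      where
      is-e : Decidable (_≡ e)
      is-e e′ = Vec.≡-dec ℕ._≟_ e′ e
      shorter : length (keep (¬? ∘ is-e) f) ≤ length f′
      shorter with Vec.≡-dec ℕ._≟_ e e
      ... | yes _ = keep-length (¬? ∘ is-e) f′
      ... | no n  = contradiction refl n
      rest : ∀ m → coeff F (keep (¬? ∘ is-e) f) m ≡ 0#
      rest m with is-e m
      ... | yes eq = coeff-drop (¬? ∘ is-e) f m (λ ne → ne eq)
      ... | no ne  = trans (coeff-keep (¬? ∘ is-e) f m ne) (h m)

  -- The terms outside P cancel, although they need not be absent from the list f.
  eval-support : ∀ {n} {P : Monomial F n → Set} (P? : Decidable P) f → (∀ m → coeff F f m ≢ 0# → P m) → ∀ x → eval F f x ≡ eval F (keep P? f) x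
  eval-support P? f h x = trans (eval-keep P? f x) (trans (cong (eval F (keep P? f) x ⊞_) (eval-zero (keep (¬? ∘ P?) f) vanish x)) (+-identityʳ _))
    where
    vanish : ∀ m → coeff F (keep (¬? ∘ P?) f) m ≡ 0#
    vanish m with P? m
    ... | yes Pm = coeff-drop (¬? ∘ P?) f m (λ ¬Pm → ¬Pm Pm)
    ... | no ¬Pm with coeff F f m ≟ 0#
    ...   | yes z = trans (coeff-keep (¬? ∘ P?) f m ¬Pm) z
    ...   | no nz = contradiction (h m nz) ¬Pm

  Span-eval : ∀ {n} {f : Poly F n} {d} → HasTotalDegree F f d → Span d (eval F f)
  Span-eval {n} {f} {d} (_ , bounded) = Span-resp (eval-support small? f bounded) (go f)
    where
    small? : Decidable (λ (m : Monomial F n) → mdeg F m ≤ d)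
    small? m = mdeg F m ℕ.≤? d
    go : ∀ f → Span d (eval F (keep small? f))
    go [] = Span-mono z≤n (Span-const 0#)
    go ((c , e) ∷ f) with small? e
    ... | yes le = Span-+ (mono c e le (λ _ → refl)) (go f)
    ... | no  _  = go f

  evalMono-◂ : ∀ {n} c (e : Monomial F n) x → evalMono F e (c ◂ x) ≡ c ↑ mdeg F e ⊠ evalMono F e x
  evalMono-◂ c []      []       = sym (*-identityˡ 1#)
  evalMono-◂ c (a ∷ e) (x ∷ xs) = begin
    _^ᶠ_ F (c ⊠ x) a ⊠ evalMono F e (c ◂ xs)  ≡⟨ cong₂ _⊠_ (trans (^ᶠ≡↑ (c ⊠ x) a) (^-distrib-* c x a)) (evalMono-◂ c e xs) ⟩
    (c ↑ a ⊠ x ↑ a) ⊠ (c ↑ mdeg F e ⊠ evalMono F e xs)  ≡⟨ solve 4 (λ a b c d → (a :* b) :* (c :* d) := (a :* c) :* (b :* d)) refl (c ↑ a) (x ↑ a) (c ↑ mdeg F e) (evalMono F e xs) ⟩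
    (c ↑ a ⊠ c ↑ mdeg F e) ⊠ (x ↑ a ⊠ evalMono F e xs)  ≡⟨ cong₂ _⊠_ (^-homo-* c a (mdeg F e)) (cong (_⊠ evalMono F e xs) (^ᶠ≡↑ x a)) ⟨
    c ↑ mdeg F (a ∷ e) ⊠ evalMono F (a ∷ e) (x ∷ xs) ∎
    where open ≡-Reasoning

  eval-homogeneous : ∀ {n} {f : Poly F n} {d} → IsHomogeneous F f d → ∀ c x → eval F f (c ◂ x) ≡ c ↑ d ⊠ eval F f x
  eval-homogeneous {n} {f} {d} hom c x = trans (eval-support exact? f hom (c ◂ x)) (trans (go f) (cong (c ↑ d ⊠_) (sym (eval-support exact? f hom x))))
    where
    exact? : Decidable (λ (m : Monomial F n) → mdeg F m ≡ d)
    exact? m = mdeg F m ℕ.≟ d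
    go : ∀ f → eval F (keep exact? f) (c ◂ x) ≡ c ↑ d ⊠ eval F (keep exact? f) x
    go [] = sym (zeroʳ _)
    go ((b , e) ∷ f) with exact? e
    ... | no  _    = go f
    ... | yes refl = trans (cong₂ (λ u v → b ⊠ u ⊞ v) (evalMono-◂ c e x) (go f))
      (solve 4 (λ b c m r → b :* (c :* m) :+ c :* r := c :* (b :* m :+ r)) refl b (c ↑ mdeg F e) (evalMono F e x) (eval F (keep exact? f) x))

  -- Affine maps are described by the degree of their coordinates and not by a matrix, which is the
  -- form needed for substitution into monomials.
  record Affine {m n} (L : Vec K m → Vec K n) : Set where
    constructor affine
    field coordinate : ∀ (i : Fin n) → Span 1 (λ x → lookup (L x) i)
  open Affine

  lookup-head : ∀ {n} (v : Vec K (suc n)) → lookup v zero ≡ head v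
  lookup-head (x ∷ v) = refl

  lookup-tail : ∀ {n} (v : Vec K (suc n)) i → lookup (tail v) i ≡ lookup v (suc i)
  lookup-tail (x ∷ v) i = refl

  Affine-tail : ∀ {m n} {L : Vec K m → Vec K (suc n)} → Affine L → Affine (tail ∘ L)
  Affine-tail {L = L} aff = affine λ i → Span-resp (λ x → lookup-tail (L x) i) (coordinate aff (suc i))

  Span-evalMono : ∀ {m n} (e : Monomial F n) {L : Vec K m → Vec K n} → Affine L → Span (mdeg F e) (λ x → evalMono F e (L x))
  Span-evalMono []      {L} aff = Span-resp (λ x → eq (L x)) (Span-const 1#)
    where
    eq : ∀ v → evalMono F [] v ≡ 1#
    eq [] = refl
  Span-evalMono (a ∷ e) {L} aff = Span-resp (λ x → eq (L x))
    (Span-* (Span-mono (ℕ.≤-reflexive (ℕ.*-identityʳ a)) (Span-↑ a (Span-resp (λ x → sym (lookup-head (L x))) (coordinate aff zero)))) (Span-evalMono e (Affine-tail aff)))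
    where
    eq : ∀ v → evalMono F (a ∷ e) v ≡ head v ↑ a ⊠ evalMono F e (tail v)
    eq (x ∷ v) = cong (_⊠ evalMono F e v) (^ᶠ≡↑ x a)

  Span-∘ : ∀ {m n D} {f : Vec K n → K} {L : Vec K m → Vec K n} → Affine L → Span D f → Span D (f ∘ L)
  Span-∘ {L = L} aff (mono c e d h) = Span-mono d (Span-resp (λ x → h (L x)) (Span-* (Span-const c) (Span-evalMono e aff)))
  Span-∘ {L = L} aff (add s t h)    = add (Span-∘ aff s) (Span-∘ aff t) (λ x → h (L x))

  Span-lookup : ∀ {m} (i : Fin m) → Span {m} 1 (λ x → lookup x i)
  Span-lookup i = mono 1# (unit i) (ℕ.≤-reflexive (mdeg-unit i)) (λ x → sym (trans (*-identityˡ _) (evalMono-unit i x)))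
    where
    unit : ∀ {m} → Fin m → Monomial F m
    unit {suc m} zero    = 1 ∷ replicate m 0
    unit (suc i)         = 0 ∷ unit i
    mdeg-unit : ∀ {m} (i : Fin m) → mdeg F (unit i) ≡ 1
    mdeg-unit {suc m} zero    = cong suc (mdeg-0 m)
    mdeg-unit (suc i)         = mdeg-unit i
    evalMono-unit : ∀ {m} (i : Fin m) x → evalMono F (unit i) x ≡ lookup x i
    evalMono-unit zero    (x ∷ xs) = trans (cong₂ _⊠_ (*-identityʳ x) (evalMono-0 xs)) (*-identityʳ x)
    evalMono-unit (suc i) (x ∷ xs) = trans (*-identityˡ _) (evalMono-unit i xs)

  Affine-const : ∀ {m n} (p : Vec K n) → Affine {m} (λ _ → p)
  Affine-const p = affine λ i → Span-mono z≤n (Span-const (lookup p i))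

  Affine-∔ : ∀ {m n} {L M : Vec K m → Vec K n} → Affine L → Affine M → Affine (λ x → L x ∔ M x)
  Affine-∔ {L = L} {M} a b = affine λ i → Span-resp (λ x → Vec.lookup-zipWith _⊞_ i (L x) (M x)) (Span-+ (coordinate a i) (coordinate b i))

  Affine-◂ : ∀ {m n} {c : Vec K m → K} → Span 1 c → ∀ (w : Vec K n) → Affine (λ x → c x ◂ w)
  Affine-◂ {c = c} s w = affine λ i → Span-resp (λ x → Vec.lookup-map i (c x ⊠_) w) (Span-* s (Span-const (lookup w i)))

  Affine-comb : ∀ {m n k} {g : Vec K m → Vec K k} → Affine g → ∀ (v : Vec (Vec K n) k) → Affine (λ x → comb (g x) v)
  Affine-comb {g = g} a []      = affine λ i → Span-resp (λ x → cong (λ u → lookup u i) (eq (g x))) (coordinate (Affine-const 0ᵛ) i)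
    where
    eq : ∀ cs → comb cs [] ≡ 0ᵛ
    eq [] = refl
  Affine-comb {g = g} a (w ∷ v) = affine λ i → Span-resp (λ x → cong (λ u → lookup u i) (eq (g x)))
    (coordinate (Affine-∔ (Affine-◂ (Span-resp (λ x → sym (lookup-head (g x))) (coordinate a zero)) w) (Affine-comb (Affine-tail a) v)) i)
    where
    eq : ∀ cs → comb cs (w ∷ v) ≡ head cs ◂ w ∔ comb (tail cs) v
    eq (c ∷ cs) = refl

  Vanishes : ∀ {m r} → (Fin r → Vec K m → K) → Vec K m → Set
  Vanishes gs x = ∀ i → gs i x ≡ 0#

  Vanishes? : ∀ {m r} (gs : Fin r → Vec K m → K) → Decidable (Vanishes gs)
  Vanishes? gs x = Fin.all? (λ i → gs i x ≟ 0#)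

-- Congruent zero counts on parallel flats.

module ParallelCounts {q} (F : FiniteField q) (p k : ℕ) (pr : Prime p) (p·1≡0 : CommRing._·_ (FieldTheory.FR F) p (FiniteField.1# F) ≡ FiniteField.0# F)
                      (q≡p^k : q ≡ p ^ k) (0<k : 0 < k) (W : Teichmüller F p k) where
  open Vectors F
  open PolynomialFunctions F
  open Poly using (Span)
  open Ax F p k pr p·1≡0 q≡p^k 0<k W hiding (module F; module Poly)
  open Teichmüller W
  open CommRing B using (_≈_; ≈-refl; ≈-sym; ≈-trans) renaming (_·_ to _·ᴮ_; Carrier to A; 0# to 0ᴮ; 1# to 1ᴮ; _⊞_ to _⊞ᴮ_; _⊠_ to _⊠ᴮ_; ⊟_ to ⊟ᴮ_; _↑_ to _↑ᴮ_)
  module R = CommRing B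

  -- Lifted indicator of the common zeros: a factor is 1 where its function vanishes, by T 0 = 0,
  -- and 0 elsewhere by Fermat.
  detector : ∀ {m} r → (Fin r → Vec K m → K) → Vec K m → A
  detector zero    gs x = 1ᴮ
  detector (suc r) gs x = (1ᴮ ⊞ᴮ ⊟ᴮ (T (gs zero x) ↑ᴮ (q ∸ 1))) ⊠ᴮ detector r (gs ∘ suc) x

  Weighted-detector : ∀ {m} r (gs : Fin r → Vec K m → K) ds → (∀ i → Span (ds i) (gs i)) → Weighted (λ _ → (q ∸ 1) * sum (tabulate ds)) (detector r gs)
  Weighted-detector zero    gs ds s = Weighted-Degrees (Degrees-const 1ᴮ)
  Weighted-detector (suc r) gs ds s = Weighted-mono (λ _ → ℕ.≤-reflexive (sym (ℕ.*-distribˡ-+ (q ∸ 1) (ds zero) (sum (tabulate (ds ∘ suc))))))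
    (Weighted-* (Weighted-1-T↑ (s zero)) (Weighted-detector r (gs ∘ suc) (ds ∘ suc) (s ∘ suc)))

  factor-zero : ∀ y → y ≡ 0# → 1ᴮ ⊞ᴮ ⊟ᴮ (T y ↑ᴮ (q ∸ 1)) ≈ 1ᴮ
  factor-zero y refl = ≈-trans (R.+-congˡ (≈-trans (R.-‿cong (≈-trans (≈-sym (T-↑ 0# (q ∸ 1))) (≈-trans (R.reflexive (cong T (↑-zero 0<q∸1))) T-0))) R.-0#≈0#)) (R.+-identityʳ 1ᴮ)

  factor-nonzero : ∀ y → y ≢ 0# → 1ᴮ ⊞ᴮ ⊟ᴮ (T y ↑ᴮ (q ∸ 1)) ≈ 0ᴮ
  factor-nonzero y y≢0 = ≈-trans (R.+-congˡ (R.-‿cong (≈-trans (≈-sym (T-↑ y (q ∸ 1))) (≈-trans (R.reflexive (cong T (fermat-unit y≢0))) T-1)))) (R.-‿inverseʳ 1ᴮ)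

  detector-yes : ∀ {m} r (gs : Fin r → Vec K m → K) x → Vanishes gs x → detector r gs x ≈ 1ᴮ
  detector-yes zero    gs x h = ≈-refl
  detector-yes (suc r) gs x h = ≈-trans (R.*-cong (factor-zero _ (h zero)) (detector-yes r (gs ∘ suc) x (h ∘ suc))) (R.*-identityˡ 1ᴮ)

  detector-no : ∀ {m} r (gs : Fin r → Vec K m → K) x → ¬ Vanishes gs x → detector r gs x ≈ 0ᴮ
  detector-no zero    gs x h = contradiction (λ ()) h
  detector-no (suc r) gs x h with gs zero x ≟ 0#
  ... | no nz = ≈-trans (R.*-congʳ (factor-nonzero _ nz)) (R.zeroˡ _)
  ... | yes z = ≈-trans (R.*-congˡ (detector-no r (gs ∘ suc) x (λ h′ → h (λ { zero → z ; (suc i) → h′ i })))) (R.zeroʳ _)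

  detector-indicator : ∀ {m} r (gs : Fin r → Vec K m → K) x → detector r gs x ≈ indicator (Vanishes? gs x) ·ᴮ 1ᴮ
  detector-indicator r gs x with Vanishes? gs x
  ... | yes h = ≈-trans (detector-yes r gs x h) (≈-sym (R.+-identityʳ 1ᴮ))
  ... | no ¬h = detector-no r gs x ¬h

  ∑-·1 : ∀ f → ΣB.∑ (λ x → f x ·ᴮ 1ᴮ) ≈ ∑ f ·ᴮ 1ᴮ
  ∑-·1 f = go (f ∘ from)
    where
    go : ∀ {n} (t : Fin n → ℕ) → FinSum.sum R.+-commutativeMonoid (λ i → t i ·ᴮ 1ᴮ) ≈ FinSum.sum ℕ.+-0-commutativeMonoid t ·ᴮ 1ᴮ
    go {zero}  t = ≈-refl
    go {suc n} t = ≈-trans (R.+-congˡ (go (t ∘ suc))) (≈-sym (R.×-homo-+ 1ᴮ (t zero) _))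

  ∑ᵛ-·1 : ∀ m f → ΣB.∑ᵛ m (λ x → f x ·ᴮ 1ᴮ) ≈ ∑ᵛ m f ·ᴮ 1ᴮ
  ∑ᵛ-·1 zero    f = ≈-refl
  ∑ᵛ-·1 (suc m) f = ≈-trans (ΣB.∑-cong (λ x → ∑ᵛ-·1 m (λ xs → f (x ∷ xs)))) (∑-·1 (λ x → ∑ᵛ m (λ xs → f (x ∷ xs))))

  parallel : ∀ {r} (ds : Fin r → ℕ) → let d = sum (tabulate ds) in (gs : Fin r → Vec K (suc d) → K) → (∀ i → Span (ds i) (gs i)) →
    p ^ k ∣ ℕ.∣ ∑ᵛ d (λ x → indicator (Vanishes? gs (0# ∷ x))) - ∑ᵛ d (λ x → indicator (Vanishes? gs (1# ∷ x))) ∣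
  parallel {r} ds gs s = faithful (∑ᵛ d (λ x → indicator (Vanishes? gs (0# ∷ x)))) (∑ᵛ d (λ x → indicator (Vanishes? gs (1# ∷ x)))) (≈-trans (≈-sym (total 0#)) (≈-trans (Weighted-independent (Weighted-detector r gs ds s)) (total 1#)))
    where
    d = sum (tabulate ds)
    total : ∀ a → ΣB.∑ᵛ d (λ x → detector r gs (a ∷ x)) ≈ ∑ᵛ d (λ x → indicator (Vanishes? gs (a ∷ x))) ·ᴮ 1ᴮ
    total a = ≈-trans (ΣB.∑ᵛ-cong d (λ x → detector-indicator r gs (a ∷ x))) (∑ᵛ-·1 d (λ x → indicator (Vanishes? gs (a ∷ x))))

module Congruence {q} (F : FiniteField q) (1<q : 1 < q) where
  open Vectors F
  open PolynomialFunctions F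
  open Poly using (Span)

  private
    instance
      q-nonZero′ : NonZero q
      q-nonZero′ = ℕ.>-nonZero 0<q

  abstract
    teichmüller-lift : ∃[ p ] ∃[ k ] (Prime p × (p · 1# ≡ 0#) × q ≡ p ^ k × 0 < k × Teichmüller F p k)
    teichmüller-lift =
      let p , pr , p·1≡0 = characteristic
          k , q≡p^k = Characteristic.prime-power p pr p·1≡0
          0<k = ℕ.n≢0⇒n>0 (λ k≡0 → contradiction (trans q≡p^k (cong (p ^_) k≡0)) (ℕ.>⇒≢ 1<q))
      in p , k , pr , p·1≡0 , q≡p^k , 0<k , IdealPowers.Powers.Quotient.teichmüller F (MonoidRing.multiplicativeLift F) p pr p·1≡0 k 0<k

  parallel : ∀ {r} (ds : Fin r → ℕ) → let d = sum (tabulate ds) in (gs : Fin r → Vec K (suc d) → K) → (∀ i → Span (ds i) (gs i)) →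
    q ∣ ℕ.∣ ∑ᵛ d (λ x → indicator (Vanishes? gs (0# ∷ x))) - ∑ᵛ d (λ x → indicator (Vanishes? gs (1# ∷ x))) ∣
  parallel ds gs s =
    let p , k , pr , p·1≡0 , q≡p^k , 0<k , W = teichmüller-lift
    in subst (_∣ ℕ.∣ ∑ᵛ (sum (tabulate ds)) (λ x → indicator (Vanishes? gs (0# ∷ x))) - ∑ᵛ (sum (tabulate ds)) (λ x → indicator (Vanishes? gs (1# ∷ x))) ∣) (sym q≡p^k)
         (ParallelCounts.parallel F p k pr p·1≡0 q≡p^k 0<k W ds gs s)

  ∣-∣⇒%≡ : ∀ m n → q ∣ ℕ.∣ m - n ∣ → m % q ≡ n % q
  ∣-∣⇒%≡ m n h with ℕ.≤-total m n
  ... | inj₁ m≤n = sym (lem m n m≤n (subst (q ∣_) (ℕ.m≤n⇒∣m-n∣≡n∸m m≤n) h))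
    where
    lem : ∀ m n → m ≤ n → q ∣ n ∸ m → n % q ≡ m % q
    lem m n m≤n (divides c eq) = trans (cong (_% q) (trans (sym (ℕ.m+[n∸m]≡n m≤n)) (cong (m +_) eq))) ([m+kn]%n≡m%n m c q)
  ... | inj₂ n≤m = trans (cong (_% q) (trans (sym (ℕ.m+[n∸m]≡n n≤m)) (cong (n +_) (_∣_.equality h′)))) ([m+kn]%n≡m%n n (_∣_.quotient h′) q)
    where
    h′ : q ∣ m ∸ n
    h′ = subst (q ∣_) (trans (ℕ.∣-∣-comm m n) (ℕ.m≤n⇒∣m-n∣≡n∸m n≤m)) h

  module ZeroSets {n r} (fs : Fin r → Poly F n) (ds : Fin r → ℕ) (deg : ∀ i → HasTotalDegree F (fs i) (ds i)) where
    ZeroSet? : Decidable (ZeroSet F fs)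
    ZeroSet? x = Fin.all? (λ i → eval F (fs i) x ≟ 0#)

    open Counting (ZeroSet F fs) ZeroSet? public

    d : ℕ
    d = sum (tabulate ds)

    -- The affine map L satisfies L(0, x) = a + comb x v and L(1, x) = b + comb x v, so both counts
    -- belong to one polynomial system in d + 1 variables.
    cnt-parallel : ∀ a b (v : Vec (Vec K n) d) → cnt a v % q ≡ cnt b v % q
    cnt-parallel a b v = ∣-∣⇒%≡ (cnt a v) (cnt b v) 
      (subst₂ (λ s t → q ∣ ℕ.∣ s - t ∣) (ΣF.∑ᵛ-cong d (λ x → cong χ (L-0 x))) (ΣF.∑ᵛ-cong d (λ x → cong χ (L-1 x)))
        (parallel ds (λ i x → eval F (fs i) (L x)) (λ i → Span-∘ Affine-L (Span-eval {f = fs i} (deg i)))))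
      where
      L : Vec K (suc d) → Vec K n
      L x = (a ∔ head x ◂ (b ∔ ⊝ a)) ∔ comb (tail x) v
      Affine-id : Affine {suc d} id
      Affine-id = affine Span-lookup
      Affine-L : Affine L
      Affine-L = Affine-∔ (Affine-∔ (Affine-const a) (Affine-◂ (Poly.Span-resp (λ x → sym (lookup-head x)) (Span-lookup zero)) (b ∔ ⊝ a))) (Affine-comb (Affine-tail Affine-id) v)
      L-0 : ∀ x → L (0# ∷ x) ≡ a ∔ comb x v
      L-0 x = cong (_∔ comb x v) (trans (cong (a ∔_) (0◂ (b ∔ ⊝ a))) (∔-identityʳ a))
      L-1 : ∀ x → L (1# ∷ x) ≡ b ∔ comb x v
      L-1 x = cong (_∔ comb x v) (trans (cong (a ∔_) (1◂ (b ∔ ⊝ a))) (∔-cancel a b))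

-- Comparison with the given enumeration of the zeros, and the three bounds.

-- Each zero is the point with its own label, so its indicator is dominated by the sum of the
-- indicators of the N labelled points, each of which has total 1.
size≤ : ∀ {q} (F : FiniteField q) {n} (z : Vec (FiniteField.Carrier F) n → Set) (z? : Decidable z) {N} → (∃ z ↔ Fin N) → Vectors.Counting.size F z z? ≤ N
size≤ {q} F {n} z z? {N} bij = ℕ.≤-trans (∑ᵛ-mono n bound) (ℕ.≤-reflexive (trans (swap N points) (ones N)))
  where
  open Vectors F
  open Counting z z?
  open Inverse bij using () renaming (to to label; from to point; strictlyInverseʳ to point-label)
  S : ∀ {N} → (Fin N → ℕ) → ℕ
  S = FinSum.sum ℕ.+-0-commutativeMonoid
  points : Fin N → Vec K n → ℕ
  points j x = indicator (x ≟ᵛ proj₁ (point j))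
  bound : ∀ x → χ x ≤ S (λ j → points j x)
  bound x with z? x
  ... | no _   = z≤n
  ... | yes zx = ℕ.≤-trans (ℕ.≤-reflexive (sym (indicator-yes (x ≟ᵛ proj₁ (point j)) (cong proj₁ (sym (point-label (x , zx))))))) (term (λ j → points j x) j)
    where
    j = label (x , zx)
    term : ∀ {N} (t : Fin N → ℕ) j → t j ≤ S t
    term t zero    = ℕ.m≤m+n (t zero) _
    term t (suc j) = ℕ.≤-trans (term (t ∘ suc) j) (ℕ.m≤n+m _ (t zero))
  swap : ∀ N (f : Fin N → Vec K n → ℕ) → ∑ᵛ n (λ x → S (λ j → f j x)) ≡ S (λ j → ∑ᵛ n (f j))
  swap zero    f = trans (∑ᵛ-const n 0) (ℕ.*-zeroʳ (q ^ n))
  swap (suc N) f = trans (ΣF.∑ᵛ-+ n (f zero) (λ x → S (λ j → f (suc j) x))) (cong (∑ᵛ n (f zero) +_) (swap N (f ∘ suc)))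
  ones : ∀ N {g : Fin N → Vec K n} → S (λ j → ∑ᵛ n (λ x → indicator (x ≟ᵛ g j))) ≡ N
  ones zero        = refl
  ones (suc N) {g} = cong₂ _+_ (∑ᵛ-delta n (g zero)) (ones N)

theorem2 : ∀ {q} (F : FiniteField q) (n r : ℕ) (fs : Fin r → Poly F n) (ds : Fin r → ℕ)
    → (∀ i → HasTotalDegree F (fs i) (ds i))
    → (N : ℕ) → Zeros F fs ↔ Fin N
    → sum (tabulate ds) < n
    → ∃[ x ] ZeroSet F fs x
    → ¬ IsAffineSubspace F (ZeroSet F fs)
    → (q ^ (n ∸ sum (tabulate ds)) < N)
    × (4 ≤ q → 2 * q ^ (n ∸ sum (tabulate ds)) ≤ N)
    × ((∀ i → IsHomogeneous F (fs i) (ds i))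
    → q ^ (n + 1 ∸ sum (tabulate ds)) ≤ (n + 2 ∸ sum (tabulate ds)) * N)
-- The cases q = 0 and q = 1 are impossible since 0 ≠ 1 in F; this brings q into the form q₂ + 2.
theorem2 {zero}  F n r fs ds deg N bij d<n nonempty ¬affine = contradiction (Inverse.to (FiniteField.enum F) (FiniteField.0# F)) λ ()
theorem2 {suc zero} F n r fs ds deg N bij d<n nonempty ¬affine = contradiction collapse (FieldTheory.0≢1 F)
  where
  open FieldTheory F
  only : (i j : Fin 1) → i ≡ j
  only zero zero = refl
  collapse : 0# ≡ 1#
  collapse = trans (sym (strictlyInverseʳ 0#)) (trans (cong from (only (to 0#) (to 1#))) (strictlyInverseʳ 1#))
theorem2 {suc (suc q₂)} F n r fs ds deg N bij d<n nonempty ¬affine =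
  ℕ.<-≤-trans Q<size size≤N ,
  (λ { (s≤s (s≤s 2≤q₂)) → ℕ.≤-trans (ℕ.≤-reflexive (ℕ.*-comm 2 Q)) (ℕ.≤-trans (double-bound nonempty ¬affine 2≤q₂) size≤N) }) ,
  -- With m = n - d, the exponent n + 1 - d is m + 1 and the factor n + 2 - d is M = m + 2;
  -- truncated subtraction is harmless because d ≤ n.
  (λ hom → ℕ.≤-trans (ℕ.≤-reflexive (cong (suc (suc q₂) ^_) (trans (ℕ.+-∸-comm 1 d≤n) (ℕ.+-comm m 1))))
    (ℕ.≤-trans (Cone.cone-bound (cone hom) nonempty Q<size)
      (ℕ.≤-trans (ℕ.*-monoʳ-≤ (suc (suc m)) size≤N) (ℕ.≤-reflexive (cong (_* N) (sym (trans (ℕ.+-∸-comm 2 d≤n) (ℕ.+-comm m 2))))))))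
  where
  open Vectors F
  open PolynomialFunctions F using (eval-homogeneous)
  open Congruence F (s≤s (s≤s z≤n))
  open ZeroSets fs ds deg using (ZeroSet?; size; cnt-parallel)
  d≤n : sum (tabulate ds) ≤ n
  d≤n = ℕ.<⇒≤ d<n
  m : ℕ
  m = n ∸ sum (tabulate ds)
  open Geometry F (ZeroSet F fs) ZeroSet? (sum (tabulate ds)) m (ℕ.m+[n∸m]≡n d≤n) cnt-parallel using (Q; strict-bound; double-bound; module Cone)
  size≤N : size ≤ N
  size≤N = size≤ F (ZeroSet F fs) ZeroSet? bij
  Q<size : Q < size
  Q<size = strict-bound nonempty ¬affine
  cone : (∀ i → IsHomogeneous F (fs i) (ds i)) → ∀ c x → ZeroSet F fs x → ZeroSet F fs (c ◂ x)
  cone hom c x zx i = trans (eval-homogeneous {f = fs i} (hom i) c x) (trans (cong (c ↑ ds i ⊠_) (zx i)) (zeroʳ _))
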